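{- Let $$\mathcal{G}(t;x,u,v,q,z)=\sum_{n=1}^{\infty}t^n\sum_{\pi\in\mathfrak{S}_n}\frac{u^{\mathsf{des}(\pi)}x^{\mathsf{ides}(\pi)}q^{\mathsf{lmin}(\pi)}v^{\mathsf{rmax}(\pi)}z^{\mathsf{lmax}(\pi)}}{(1-u)^n(1-x)^n}.$$ The generating function $\mathcal{G}(t;x,u,v,1,1)$ of permutations with respect to the triple $(\mathsf{des},\mathsf{ides},\mathsf{rmax})$, or equivalently $(\mathsf{des},\mathsf{ides},\mathsf{lmin})$, $(\mathsf{ides},\mathsf{des},\mathsf{lmin})$ or $(\mathsf{ides},\mathsf{des},\mathsf{rmax})$, satisfies both $$\mathcal{G}(t;x,u,v,1,1)=\sum_{n=1}^{\infty}\frac{vt\,u^{n-1}}{(1-t)^n-x}\prod_{i=1}^{n-1}\frac{x-(1-t)^i-xvt}{x-(1-t)^i}$$ and $$\mathcal{G}(t;x,u,v,1,1)=\sum_{n=1}^{\infty}\frac{vt(1-t)^{n-1}}{u^{n}\big(x(1-t)^{n-1}-1\big)}\prod_{i=1}^{n}\frac{1-x(1-t)^{i-1}}{x(1-t)^{i-1}(vt-1)+1}.$$ Furthermore, $\mathcal{G}(t;x,u,v,1,1)=\mathcal{G}(t;u,x,1,v,1)=\mathcal{G}(t;x,u,1,v,1)=\mathcal{G}(t;u,x,v,1,1)$.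
   Context: $\mathfrak{S}_n$ is the set of permutations $\pi=\pi_1\pi_2\cdots\pi_n$ of $[n]=\{1,\dots,n\}$. $\mathsf{des}(\pi)=|\{i\in[n-1]:\pi_i>\pi_{i+1}\}|$; $\mathsf{ides}(\pi)=\mathsf{des}(\pi^{ -1})$; $\mathsf{lmax}(\pi)=|\{\pi_i:\pi_i>\pi_j\text{ for all }j<i\}|$; $\mathsf{lmin}(\pi)=|\{\pi_i:\pi_i<\pi_j\text{ for all }j<i\}|$; $\mathsf{rmax}(\pi)=|\{\pi_i:\pi_i>\pi_j\text{ for all }j>i\}|$. Empty products equal $1$. The coefficient of each power of $t$ in $\mathcal{G}(t;x,u,v,1,1)$ is a rational function of $x,u$ (polynomial in $v$). The first formula is an identity of formal power series in $u$ with coefficients in $\mathbb{Q}[v][[x,t]]$ (expand $\mathcal G$ in nonnegative powers of $u$); the second is an identity of formal power series in $u^{ -1}$ with coefficients in $\mathbb{Q}[v][[x,t]]$ (expand the rational functions of $u$ occurring in $\mathcal G$ in powers of $u^{ -1}$). -}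

module Defs where

open import Algebra.Bundles using (CommutativeRing; module Semiring)
import Algebra.Definitions.RawSemiring
import Algebra.Properties.Ring
import Algebra.Properties.Semiring.Sum
import Algebra.Solver.Ring.NaturalCoefficients.Default as Solver
open import Algebra.Structures using (IsCommutativeRing)
open import Data.Fin.Base using (Fin; zero; suc; toℕ; inject₁; punchIn)
open import Data.Fin.Permutation as Perm
  using (Permutation; _⟨$⟩ʳ_; flip; insert; remove)
open import Data.Fin.Properties as Fin using (_<?_; all?)
open import Data.List.Base using (List; []; _∷_; map; foldr; allFin; cartesianProductWith)
import Data.List.Membership.Propositional.Properties as ∈
import Data.List.Membership.Setoid.Properties as ∈ₛ
open import Data.List.Relation.Unary.AllPairs using (AllPairs; []; _∷_)
open import Data.List.Relation.Unary.All using ([])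
open import Data.List.Relation.Unary.Any using (Any; here)
import Data.List.Relation.Unary.Unique.Propositional.Properties as Unique
import Data.List.Relation.Unary.Unique.Setoid.Properties as Uniqueₛ
open import Data.Nat.Base as ℕ using (ℕ; zero; suc; _∸_; z≤n; s≤s)
import Data.Nat.Properties as ℕ
open import Data.Product.Base using (∃; _×_; _,_; proj₁; proj₂)
open import Data.Rational.Properties using () renaming (+-*-commutativeRing to ℚ-ring)
open import Data.Sum.Base using (inj₁; inj₂)
import Data.Vec.Base as Vec
open import Function.Base using (_∘_)
open import Level using (Level; _⊔_; 0ℓ)
open import Relation.Binary.Bundles using (Setoid)
open import Relation.Binary.PropositionalEquality as ≡ using (_≡_)
import Relation.Binary.Reasoning.Setoid
open import Relation.Nullary.Decidable using (_→-dec_)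
open import Relation.Nullary.Negation using (¬_)

private
  variable
    c ℓ : Level
    n : ℕ

-- The one-line notation of π is (π ⟨$⟩ʳ 0) (π ⟨$⟩ʳ 1) ⋯, with [n] shifted
-- down to {0,…,n-1}.  `insert zero j π` has first letter j, and its
-- remaining letters are order-isomorphic to π.
permutations : ∀ n → List (Permutation n n)
permutations zero    = Perm.id ∷ []
permutations (suc n) = cartesianProductWith (insert zero) (allFin (suc n)) (permutations n)

des : Permutation n n → ℕ
des {zero}  π = 0
des {suc m} π = Vec.count (λ i → (π ⟨$⟩ʳ suc i) <? (π ⟨$⟩ʳ inject₁ i)) (Vec.allFin m)

ides : Permutation n n → ℕ
ides π = des (flip π)

-- As π is injective, letters π_i are counted by their positions i.
lmax lmin rmax : Permutation n n → ℕ
lmax {n} π = Vec.count (λ i → all? λ j → (j <? i) →-dec ((π ⟨$⟩ʳ j) <? (π ⟨$⟩ʳ i))) (Vec.allFin n)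
lmin {n} π = Vec.count (λ i → all? λ j → (j <? i) →-dec ((π ⟨$⟩ʳ i) <? (π ⟨$⟩ʳ j))) (Vec.allFin n)
rmax {n} π = Vec.count (λ i → all? λ j → (i <? j) →-dec ((π ⟨$⟩ʳ j) <? (π ⟨$⟩ʳ i))) (Vec.allFin n)

-- Every permutation occurs in `permutations n` exactly once.
module _ where
  permutationSetoid : ℕ → Setoid 0ℓ 0ℓ
  permutationSetoid n = record
    { Carrier       = Permutation n n
    ; _≈_           = Perm._≈_
    ; isEquivalence = record
      { refl  = λ _ → ≡.refl
      ; sym   = λ p i → ≡.sym (p i)
      ; trans = λ p q i → ≡.trans (p i) (q i)
      }
    }

  private
    insert₀-cong : ∀ {i j : Fin (suc n)} {π ρ : Permutation n n} →
                   i ≡ j → π Perm.≈ ρ → insert zero i π Perm.≈ insert zero j ρ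
    insert₀-cong         ≡.refl p zero    = ≡.refl
    insert₀-cong {i = i} ≡.refl p (suc k) = ≡.cong (punchIn i) (p k)

    insert₀-injective : ∀ {i j : Fin (suc n)} {π ρ : Permutation n n} →
                        insert zero i π Perm.≈ insert zero j ρ → i ≡ j × π Perm.≈ ρ
    insert₀-injective {i = i} p with p zero
    ... | ≡.refl = ≡.refl , λ k → Fin.punchIn-injective i _ _ (p (suc k))

  permutations-complete : ∀ (π : Permutation n n) → Any (π Perm.≈_) (permutations n)
  permutations-complete {zero}  π = here λ ()
  permutations-complete {suc n} π =
    ∈ₛ.∈-resp-≈ (permutationSetoid (suc n))
      {x = insert zero (π ⟨$⟩ʳ zero) (remove zero π)} {y = π} (Perm.insert-remove zero π)
      (∈ₛ.∈-cartesianProductWith⁺ (≡.setoid (Fin (suc n))) (permutationSetoid n)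
        (permutationSetoid (suc n)) insert₀-cong
        (∈.∈-allFin (π ⟨$⟩ʳ zero)) (permutations-complete (remove zero π)))

  permutations-unique : ∀ n → AllPairs (λ π ρ → ¬ (π Perm.≈ ρ)) (permutations n)
  permutations-unique zero    = [] ∷ []
  permutations-unique (suc n) =
    Uniqueₛ.cartesianProductWith⁺ (≡.setoid (Fin (suc n))) (permutationSetoid n)
      (permutationSetoid (suc n)) (insert zero) insert₀-injective
      (Unique.allFin⁺ (suc n)) (permutations-unique n)

module RingOps (R : CommutativeRing c ℓ) where
  open CommutativeRing R public
  open Algebra.Definitions.RawSemiring (Semiring.rawSemiring semiring) public using (_^_; product)
  open Algebra.Properties.Ring ring using (-‿distribˡ-*; -‿distribʳ-*; -‿involutive; -0#≈0#)
  open Relation.Binary.Reasoning.Setoid setoid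
  open Solver commutativeSemiring using (solve; _:+_; _:*_; _:=_)

  record Unit (a : Carrier) : Set (c ⊔ ℓ) where
    constructor mkUnit
    field
      {inverse} : Carrier
      isInverse : a * inverse ≈ 1#

  infixl 7 _/_[_]
  _/_[_] : Carrier → (b : Carrier) → Unit b → Carrier
  a / b [ p ] = a * Unit.inverse p

  ∏-syntax : ℕ → (ℕ → Carrier) → Carrier
  ∏-syntax n f = product {n} λ i → f (suc (toℕ i))

  infixl 10 ∏-syntax
  syntax ∏-syntax n (λ i → e) = ∏[1≤ i ≤ n ] e

  record Regular (q : Carrier) : Set (c ⊔ ℓ) where
    constructor mkRegular
    field
      cancel : ∀ {a b} → a * q ≈ b * q → a ≈ b

  abstract
    unit-cong : ∀ {a b} → a ≈ b → Unit a → Unit b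
    unit-cong p (mkUnit {a⁻¹} q) = mkUnit (trans (*-congʳ (sym p)) q)

    unit-1 : Unit 1#
    unit-1 = mkUnit (*-identityˡ 1#)

    unit-* : ∀ {a b} → Unit a → Unit b → Unit (a * b)
    unit-* {a} {b} (mkUnit {a⁻¹} p) (mkUnit {b⁻¹} q) = mkUnit (begin
      a * b * (a⁻¹ * b⁻¹)
        ≈⟨ solve 4 (λ a b c d → a :* b :* (c :* d) := a :* c :* (b :* d)) refl a b a⁻¹ b⁻¹ ⟩
      a * a⁻¹ * (b * b⁻¹)  ≈⟨ *-cong p q ⟩
      1# * 1#              ≈⟨ *-identityˡ 1# ⟩
      1#                   ∎)

    unit-^ : ∀ {a} n → Unit a → Unit (a ^ n)
    unit-^ zero    p = unit-1
    unit-^ (suc n) p = unit-* p (unit-^ n p)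

    unit-neg : ∀ {a} → Unit a → Unit (- a)
    unit-neg {a} (mkUnit {a⁻¹} p) = mkUnit (begin
      - a * - a⁻¹      ≈⟨ -‿distribˡ-* a (- a⁻¹) ⟨
      - (a * - a⁻¹)    ≈⟨ -‿cong (-‿distribʳ-* a a⁻¹) ⟨
      - - (a * a⁻¹)    ≈⟨ -‿involutive _ ⟩
      a * a⁻¹          ≈⟨ p ⟩
      1#               ∎)

    neg-minus : ∀ a b → - (a - b) ≈ b - a
    neg-minus a b = trans (sym (Algebra.Properties.Ring.-‿+-comm ring a (- b)))
      (trans (+-comm _ _) (+-congʳ (-‿involutive b)))

    unit-swap : ∀ {a b} → Unit (a - b) → Unit (b - a)
    unit-swap {a} {b} p = unit-cong (neg-minus a b) (unit-neg p)

  neg-0 : - 0# ≈ 0#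
  neg-0 = -0#≈0#

  a-0≈a : ∀ a → a - 0# ≈ a
  a-0≈a a = trans (+-congˡ neg-0) (+-identityʳ a)

  abstract
    regular-cong : ∀ {a b} → a ≈ b → Regular a → Regular b
    regular-cong p (mkRegular r) = mkRegular λ q → r (trans (*-congˡ p) (trans q (*-congˡ (sym p))))

    unit-regular : ∀ {a} → Unit a → Regular a
    unit-regular {a} (mkUnit {a⁻¹} p) = mkRegular λ {b} {d} q → begin
      b              ≈⟨ *-identityʳ b ⟨
      b * 1#         ≈⟨ *-congˡ p ⟨
      b * (a * a⁻¹)  ≈⟨ *-assoc b a a⁻¹ ⟨
      b * a * a⁻¹    ≈⟨ *-congʳ q ⟩
      d * a * a⁻¹    ≈⟨ *-assoc d a a⁻¹ ⟩
      d * (a * a⁻¹)  ≈⟨ *-congˡ p ⟩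
      d * 1#         ≈⟨ *-identityʳ d ⟩
      d              ∎

    regular-* : ∀ {a b} → Regular a → Regular b → Regular (a * b)
    regular-* (mkRegular p) (mkRegular q) = mkRegular λ r → p (q (trans (*-assoc _ _ _) (trans r (sym (*-assoc _ _ _)))))

-- Formal power series in one variable X over R, as coefficient sequences;
-- C a is the constant series a.

module Series (R : CommutativeRing c ℓ) where
  private
    module R = RingOps R
    open R using (Carrier; _≈_; _+_; _*_; -_; 0#; 1#)
    open Algebra.Properties.Semiring.Sum R.semiring
    open Relation.Binary.Reasoning.Setoid R.setoid
    open Solver R.commutativeSemiring using (solve; _:+_; _:*_; _:=_; con)

  infix  4 _≈ₛ_
  infixl 6 _+ₛ_
  infixl 7 _*ₛ_

  _≈ₛ_ : (f g : ℕ → Carrier) → Set ℓ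
  f ≈ₛ g = ∀ n → f n ≈ g n

  _+ₛ_ _*ₛ_ : (f g : ℕ → Carrier) → ℕ → Carrier
  (f +ₛ g) n = f n + g n
  (f *ₛ g) n = ∑[ i ≤ n ] (f (toℕ i) * g (n ∸ toℕ i))

  -ₛ_ : (ℕ → Carrier) → ℕ → Carrier
  (-ₛ f) n = - f n

  C : Carrier → ℕ → Carrier
  C a zero    = a
  C a (suc _) = 0#

  X : ℕ → Carrier
  X 1 = 1#
  X _ = 0#

  private
    *-cong-upTo : ∀ f f′ g g′ n → (∀ i → i ℕ.≤ n → f i ≈ f′ i) →
                  (∀ i → i ℕ.≤ n → g i ≈ g′ i) → (f *ₛ g) n ≈ (f′ *ₛ g′) n
    *-cong-upTo f f′ g g′ n p q = sum-cong-≋ {suc n} λ i → R.*-cong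
      (p (toℕ i) (ℕ.≤-pred (Fin.toℕ<n i))) (q (n ∸ toℕ i) (ℕ.m∸n≤m n (toℕ i)))

  *ₛ-cong : ∀ {f f′ g g′} → f ≈ₛ f′ → g ≈ₛ g′ → f *ₛ g ≈ₛ f′ *ₛ g′
  *ₛ-cong {f} {f′} {g} {g′} p q n = *-cong-upTo f f′ g g′ n (λ i _ → p i) (λ i _ → q i)

  sum-zero : ∀ {n} (t : Fin n → Carrier) → (∀ i → t i ≈ 0#) → sum t ≈ 0#
  sum-zero {n} t p = R.trans (sum-cong-≋ p) (sum-replicate-zero n)

  *ₛ-head : ∀ f g → (f *ₛ g) 0 ≈ f 0 * g 0
  *ₛ-head f g = R.+-identityʳ _

  *ₛ-last : ∀ f g n → (f *ₛ g) (suc n) ≈ (f *ₛ (g ∘ suc)) n + f (suc n) * g 0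
  *ₛ-last f g zero    = begin
    f 0 * g 1 + (f 1 * g 0 + 0#) ≈⟨ R.+-congˡ (R.+-identityʳ _) ⟩
    f 0 * g 1 + f 1 * g 0        ≈⟨ R.+-congʳ (R.+-identityʳ _) ⟨
    f 0 * g 1 + 0# + f 1 * g 0   ∎
  *ₛ-last f g (suc n) = R.trans (R.+-congˡ (*ₛ-last (f ∘ suc) g n)) (R.sym (R.+-assoc _ _ _))

  *ₛ-comm : ∀ f g → f *ₛ g ≈ₛ g *ₛ f
  *ₛ-comm f g zero    = R.+-congʳ (R.*-comm _ _)
  *ₛ-comm f g (suc n) = begin
    f 0 * g (suc n) + ((f ∘ suc) *ₛ g) n ≈⟨ R.+-cong (R.*-comm _ _) (*ₛ-comm (f ∘ suc) g n) ⟩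
    g (suc n) * f 0 + (g *ₛ (f ∘ suc)) n ≈⟨ R.+-comm _ _ ⟩
    (g *ₛ (f ∘ suc)) n + g (suc n) * f 0 ≈⟨ *ₛ-last g f n ⟨
    (g *ₛ f) (suc n)                     ∎

  *ₛ-distribʳ : ∀ f g h → (g +ₛ h) *ₛ f ≈ₛ g *ₛ f +ₛ h *ₛ f
  *ₛ-distribʳ f g h n = R.trans
    (sum-cong-≋ {suc n} λ i → R.distribʳ (f (n ∸ toℕ i)) (g (toℕ i)) (h (toℕ i)))
    (∑-distrib-+ {suc n} (λ i → g (toℕ i) * f (n ∸ toℕ i)) (λ i → h (toℕ i) * f (n ∸ toℕ i)))

  *ₛ-scale : ∀ a f g n → ((λ i → a * f i) *ₛ g) n ≈ a * (f *ₛ g) n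
  *ₛ-scale a f g n = R.trans
    (sum-cong-≋ {suc n} λ i → R.*-assoc a (f (toℕ i)) (g (n ∸ toℕ i)))
    (R.sym (*-distribˡ-sum {suc n} a (λ i → f (toℕ i) * g (n ∸ toℕ i))))

  *ₛ-assoc : ∀ f g h → (f *ₛ g) *ₛ h ≈ₛ f *ₛ (g *ₛ h)
  *ₛ-assoc f g h zero    = begin
    (f *ₛ g) 0 * h 0 + 0#  ≈⟨ R.+-identityʳ _ ⟩
    (f *ₛ g) 0 * h 0       ≈⟨ R.*-congʳ (*ₛ-head f g) ⟩
    f 0 * g 0 * h 0        ≈⟨ R.*-assoc _ _ _ ⟩
    f 0 * (g 0 * h 0)      ≈⟨ R.*-congˡ (*ₛ-head g h) ⟨
    f 0 * (g *ₛ h) 0       ≈⟨ R.+-identityʳ _ ⟨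
    f 0 * (g *ₛ h) 0 + 0#  ∎
  *ₛ-assoc f g h (suc n) = begin
    (f *ₛ g) 0 * h (suc n) + (((λ i → f 0 * g (suc i)) +ₛ f′ *ₛ g) *ₛ h) n
      ≈⟨ R.+-cong (R.*-congʳ (*ₛ-head f g)) (*ₛ-distribʳ h (λ i → f 0 * g (suc i)) (f′ *ₛ g) n) ⟩
    f 0 * g 0 * h (suc n) + (((λ i → f 0 * g (suc i)) *ₛ h) n + (f′ *ₛ g *ₛ h) n)
      ≈⟨ R.+-congˡ (R.+-cong (*ₛ-scale (f 0) (g ∘ suc) h n) (*ₛ-assoc f′ g h n)) ⟩
    f 0 * g 0 * h (suc n) + (f 0 * ((g ∘ suc) *ₛ h) n + (f′ *ₛ (g *ₛ h)) n)
      ≈⟨ solve 5 (λ a b c d e → a :* b :* c :+ (a :* d :+ e) := a :* (b :* c :+ d) :+ e)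
           R.refl (f 0) (g 0) (h (suc n)) (((g ∘ suc) *ₛ h) n) ((f′ *ₛ (g *ₛ h)) n) ⟩
    f 0 * (g *ₛ h) (suc n) + (f′ *ₛ (g *ₛ h)) n ∎
    where f′ = f ∘ suc

  *ₛ-zeroˡ : ∀ f → (λ _ → 0#) *ₛ f ≈ₛ λ _ → 0#
  *ₛ-zeroˡ f n = sum-zero {suc n} (λ i → 0# * f (n ∸ toℕ i)) λ i → R.zeroˡ (f (n ∸ toℕ i))

  C-*ₛ : ∀ a f n → (C a *ₛ f) n ≈ a * f n
  C-*ₛ a f zero    = R.+-identityʳ _
  C-*ₛ a f (suc n) = R.trans (R.+-congˡ (*ₛ-zeroˡ f n)) (R.+-identityʳ _)

  X-*ₛ : ∀ f n → (X *ₛ f) (suc n) ≈ f n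
  X-*ₛ f n = begin
    0# * f (suc n) + ((X ∘ suc) *ₛ f) n ≈⟨ R.+-cong (R.zeroˡ _) (*ₛ-cong {X ∘ suc} {C 1#} {f} {f} X∘suc (λ _ → R.refl) n) ⟩
    0# + (C 1# *ₛ f) n                  ≈⟨ R.+-identityˡ _ ⟩
    (C 1# *ₛ f) n                       ≈⟨ C-*ₛ 1# f n ⟩
    1# * f n                            ≈⟨ R.*-identityˡ _ ⟩
    f n                                 ∎
    where
    X∘suc : (X ∘ suc) ≈ₛ C 1#
    X∘suc zero    = R.refl
    X∘suc (suc _) = R.refl

  *ₛ-identityˡ : ∀ f → C 1# *ₛ f ≈ₛ f
  *ₛ-identityˡ f n = R.trans (C-*ₛ 1# f n) (R.*-identityˡ (f n))

  abstract
    isCommutativeRing : IsCommutativeRing _≈ₛ_ _+ₛ_ _*ₛ_ -ₛ_ (λ _ → 0#) (C 1#)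
    isCommutativeRing = record
      { isRing = record
        { +-isAbelianGroup = record
          { isGroup = record
            { isMonoid = record
              { isSemigroup = record
                { isMagma = record
                  { isEquivalence = record
                    { refl  = λ _ → R.refl
                    ; sym   = λ p n → R.sym (p n)
                    ; trans = λ p q n → R.trans (p n) (q n)
                    }
                  ; ∙-cong = λ p q n → R.+-cong (p n) (q n)
                  }
                ; assoc = λ f g h n → R.+-assoc (f n) (g n) (h n)
                }
              ; identity = (λ f n → R.+-identityˡ (f n)) , (λ f n → R.+-identityʳ (f n))
              }
            ; inverse = (λ f n → R.-‿inverseˡ (f n)) , (λ f n → R.-‿inverseʳ (f n))
            ; ⁻¹-cong = λ p n → R.-‿cong (p n)
            }
          ; comm = λ f g n → R.+-comm (f n) (g n)
          }
        ; *-cong     = *ₛ-cong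
        ; *-assoc    = *ₛ-assoc
        ; *-identity = *ₛ-identityˡ , λ f n → R.trans (*ₛ-comm f (C 1#) n) (*ₛ-identityˡ f n)
        ; distrib    =
            (λ f g h n → R.trans (*ₛ-comm f (g +ₛ h) n)
              (R.trans (*ₛ-distribʳ f g h n) (R.+-cong (*ₛ-comm g f n) (*ₛ-comm h f n))))
          , *ₛ-distribʳ
        }
      ; *-comm = *ₛ-comm
      }

  powerSeries : CommutativeRing c ℓ
  powerSeries = record { isCommutativeRing = isCommutativeRing }

  module S = RingOps powerSeries

  private
    module Inverse (f : ℕ → Carrier) (a : Carrier) where
      approx : ℕ → ℕ → Carrier
      approx _       zero    = a
      approx zero    (suc n) = 0#
      approx (suc k) (suc n) = - a * ((f ∘ suc) *ₛ approx k) n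

      inverse : ℕ → Carrier
      inverse n = approx n n

      stable : ∀ k l n → n ℕ.≤ k → n ℕ.≤ l → approx k n ≈ approx l n
      stable k       l       zero    _       _       = R.refl
      stable (suc k) (suc l) (suc n) (s≤s p) (s≤s q) = R.*-congˡ
        (*-cong-upTo (f ∘ suc) (f ∘ suc) (approx k) (approx l) n (λ _ _ → R.refl)
          λ i i≤n → stable k l i (ℕ.≤-trans i≤n p) (ℕ.≤-trans i≤n q))

      isInverse : f 0 * a ≈ 1# → f *ₛ inverse ≈ₛ C 1#
      isInverse p zero    = R.trans (*ₛ-head f inverse) p
      isInverse p (suc n) = begin
        f 0 * (- a * ((f ∘ suc) *ₛ approx n) n) + s
          ≈⟨ R.+-congʳ (R.*-congˡ (R.*-congˡ
               (*-cong-upTo (f ∘ suc) (f ∘ suc) (approx n) inverse n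
                 (λ _ _ → R.refl) λ i i≤n → stable n i i i≤n ℕ.≤-refl))) ⟩
        f 0 * (- a * s) + s    ≈⟨ R.+-congʳ (R.*-assoc _ _ _) ⟨
        f 0 * - a * s + s      ≈⟨ R.+-congʳ (R.*-congʳ (-‿distribʳ-* (f 0) a)) ⟨
        - (f 0 * a) * s + s    ≈⟨ R.+-congʳ (R.*-congʳ (R.-‿cong p)) ⟩
        - 1# * s + s           ≈⟨ R.+-congʳ (-1*x≈-x s) ⟩
        - s + s                ≈⟨ R.-‿inverseˡ s ⟩
        0#                     ∎
        where
        s = ((f ∘ suc) *ₛ inverse) n
        open Algebra.Properties.Ring R.ring using (-‿distribʳ-*; -1*x≈-x)

  abstract
    unit-series : ∀ f → R.Unit (f 0) → S.Unit f
    unit-series f (R.mkUnit {a} p) = S.mkUnit {inverse = Inverse.inverse f a} (Inverse.isInverse f a p)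

    unit-1-X : S.Unit (S.1# S.- X)
    unit-1-X = unit-series (S.1# S.- X) (R.unit-cong (R.sym (R.a-0≈a 1#)) R.unit-1)

  ^-head : ∀ f n → f 0 ≈ 1# → (f S.^ n) 0 ≈ 1#
  ^-head f zero    p = R.refl
  ^-head f (suc n) p = R.trans (*ₛ-head f (f S.^ n))
    (R.trans (R.*-cong p (^-head f n p)) (R.*-identityˡ 1#))

  abstract
    regular-X : S.Regular X
    regular-X = S.mkRegular λ {f} {g} p n → begin
      f n              ≈⟨ X-*ₛ f n ⟨
      (X *ₛ f) (suc n) ≈⟨ *ₛ-comm X f (suc n) ⟩
      (f *ₛ X) (suc n) ≈⟨ p (suc n) ⟩
      (g *ₛ X) (suc n) ≈⟨ *ₛ-comm g X (suc n) ⟩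
      (X *ₛ g) (suc n) ≈⟨ X-*ₛ g n ⟩
      g n              ∎

  1-C≈C : ∀ a → S.1# S.- C a ≈ₛ C (1# R.- a)
  1-C≈C a zero    = R.refl
  1-C≈C a (suc n) = R.a-0≈a 0#

-- R[X] as the subring of R⟦X⟧ of series with finitely many nonzero terms.

module Poly (R : CommutativeRing c ℓ) where
  private
    module R = RingOps R
    open R using (Carrier; _≈_; 0#; 1#)
    module PS = Series R
    module S = PS.S
    open S using () renaming (Carrier to Seq)

  FiniteSupport : Seq → Set ℓ
  FiniteSupport f = ∃ λ N → ∀ n → N ℕ.≤ n → f n ≈ 0#

  Polynomial : Set (c ⊔ ℓ)
  Polynomial = ∃ FiniteSupport

  private
    abstract
      finite-+ : ∀ {f g} → FiniteSupport f → FiniteSupport g → FiniteSupport (f S.+ g)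
      finite-+ (M , p) (N , q) = M ℕ.+ N , λ n b → R.trans
        (R.+-cong (p n (ℕ.m+n≤o⇒m≤o M b)) (q n (ℕ.m+n≤o⇒n≤o M b))) (R.+-identityʳ 0#)

      finite-* : ∀ {f g} → FiniteSupport f → FiniteSupport g → FiniteSupport (f S.* g)
      finite-* {f} {g} (M , p) (N , q) = M ℕ.+ N , λ n b → PS.sum-zero {suc n} (λ i → f (toℕ i) R.* g (n ∸ toℕ i)) λ i → vanish n b (toℕ i)
        where
        vanish : ∀ n → M ℕ.+ N ℕ.≤ n → ∀ i → f i R.* g (n ∸ i) ≈ 0#
        vanish n b i with ℕ.≤-total M i
        ... | inj₁ M≤i = R.trans (R.*-congʳ (p i M≤i)) (R.zeroˡ _)
        ... | inj₂ i≤M = R.trans (R.*-congˡ (q (n ∸ i) (ℕ.≤-trans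
          (ℕ.≤-trans (ℕ.≤-reflexive (≡.sym (ℕ.m+n∸m≡n M N))) (ℕ.∸-monoˡ-≤ M b))
          (ℕ.∸-monoʳ-≤ n i≤M)))) (R.zeroʳ _)

      finite-neg : ∀ {f} → FiniteSupport f → FiniteSupport (S.- f)
      finite-neg (M , p) = M , λ n b → R.trans (R.-‿cong (p n b)) R.neg-0

      finite-C : ∀ a → FiniteSupport (PS.C a)
      finite-C a = 1 , λ { (suc n) _ → R.refl }

      finite-X : FiniteSupport PS.X
      finite-X = 2 , λ { (suc (suc n)) _ → R.refl ; 1 (s≤s ()) }

  polynomial : CommutativeRing (c ⊔ ℓ) ℓ
  polynomial = record
    { Carrier = Polynomial
    ; _≈_     = λ f g → proj₁ f S.≈ proj₁ g
    ; _+_     = λ (f , p) (g , q) → f S.+ g , finite-+ p q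
    ; _*_     = λ (f , p) (g , q) → f S.* g , finite-* {f} {g} p q
    ; -_      = λ (f , p) → S.- f , finite-neg p
    ; 0#      = S.0# , 0 , λ _ _ → R.refl
    ; 1#      = S.1# , finite-C 1#
    ; isCommutativeRing = record
      { isRing = record
        { +-isAbelianGroup = record
          { isGroup = record
            { isMonoid = record
              { isSemigroup = record
                { isMagma = record
                  { isEquivalence = record
                    { refl = λ _ → R.refl ; sym = λ p n → R.sym (p n) ; trans = λ p q n → R.trans (p n) (q n) }
                  ; ∙-cong = λ p q n → R.+-cong (p n) (q n)
                  }
                ; assoc = λ f g h → S.+-assoc (proj₁ f) (proj₁ g) (proj₁ h)
                }
              ; identity = (λ f → S.+-identityˡ (proj₁ f)) , (λ f → S.+-identityʳ (proj₁ f))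
              }
            ; inverse = (λ f → S.-‿inverseˡ (proj₁ f)) , (λ f → S.-‿inverseʳ (proj₁ f))
            ; ⁻¹-cong = λ p n → R.-‿cong (p n)
            }
          ; comm = λ f g → S.+-comm (proj₁ f) (proj₁ g)
          }
        ; *-cong     = λ {f} {f′} {g} {g′} → PS.*ₛ-cong {proj₁ f} {proj₁ f′} {proj₁ g} {proj₁ g′}
        ; *-assoc    = λ f g h → S.*-assoc (proj₁ f) (proj₁ g) (proj₁ h)
        ; *-identity = (λ f → S.*-identityˡ (proj₁ f)) , (λ f → S.*-identityʳ (proj₁ f))
        ; distrib    = (λ f g h → S.distribˡ (proj₁ f) (proj₁ g) (proj₁ h))
                     , (λ f g h → S.distribʳ (proj₁ f) (proj₁ g) (proj₁ h))
        }
      ; *-comm = λ f g → S.*-comm (proj₁ f) (proj₁ g)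
      }
    }

  private module P = RingOps polynomial

  C : Carrier → Polynomial
  C a = PS.C a , finite-C a

  X : Polynomial
  X = PS.X , finite-X

  abstract
    regular-1-X : P.Regular (P.1# P.- X)
    regular-1-X = P.mkRegular λ {f} {g} → S.Regular.cancel (S.unit-regular PS.unit-1-X) {proj₁ f} {proj₁ g}

    regular-1-C : ∀ {a} → R.Regular (1# R.- a) → P.Regular (P.1# P.- C a)
    regular-1-C {a} (R.mkRegular r) = P.mkRegular λ {f} {g} p n → r (begin
      proj₁ f n R.* (1# R.- a)              ≈⟨ coeff (proj₁ f) n ⟨
      (proj₁ f S.* (S.1# S.- PS.C a)) n     ≈⟨ p n ⟩
      (proj₁ g S.* (S.1# S.- PS.C a)) n     ≈⟨ coeff (proj₁ g) n ⟩
      proj₁ g n R.* (1# R.- a)              ∎)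
      where
      open Relation.Binary.Reasoning.Setoid R.setoid
      coeff : ∀ f n → (f S.* (S.1# S.- PS.C a)) n ≈ f n R.* (1# R.- a)
      coeff f n = R.trans (S.*-comm f (S.1# S.- PS.C a) n) (R.trans
        (PS.*ₛ-cong {S.1# S.- PS.C a} {PS.C (1# R.- a)} {f} {f} (PS.1-C≈C a) (λ _ → R.refl) n)
        (R.trans (PS.C-*ₛ (1# R.- a) f n) (R.*-comm _ _)))

    unit-1-C : ∀ {a} → R.Unit (1# R.- a) → P.Unit (P.1# P.- C a)
    unit-1-C {a} (R.mkUnit {b} p) = P.mkUnit {inverse = C b} λ n → R.trans
      (PS.*ₛ-cong {S.1# S.- PS.C a} {PS.C (1# R.- a)} {PS.C b} {PS.C b} (PS.1-C≈C a) (λ _ → R.refl) n)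
      (R.trans (PS.C-*ₛ (1# R.- a) (PS.C b) n) (helper n))
      where
      helper : ∀ n → (1# R.- a) R.* PS.C b n ≈ PS.C 1# n
      helper zero    = p
      helper (suc n) = R.zeroʳ _

-- The total ring of fractions, whose denominators are the regular elements:
-- the field of fractions when R is an integral domain.
module Frac (R : CommutativeRing c ℓ) where
  private
    module R = RingOps R
    open R using (Carrier; _≈_; _+_; _*_; -_; 0#; 1#; Regular)
    open Relation.Binary.Reasoning.Setoid R.setoid
    open Solver R.commutativeSemiring using (solve; _:+_; _:*_; _:=_)
    open Algebra.Properties.Ring R.ring using (-‿distribˡ-*)

  record Fraction : Set (c ⊔ ℓ) where
    constructor _÷_[_]
    field
      num den : Carrier
      regular : Regular den
  open Fraction

  infix 4 _≈ᶠ_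
  record _≈ᶠ_ (p q : Fraction) : Set ℓ where
    constructor cross
    field
      cross-multiplied : num p * den q ≈ num q * den p

  private
    infix 4 _~_
    _~_ : (p q : Fraction) → Set ℓ
    p ~ q = num p * den q ≈ num q * den p

    _+ᶠ_ _*ᶠ_ : (p q : Fraction) → Fraction
    p +ᶠ q = (num p * den q + num q * den p) ÷ (den p * den q) [ R.regular-* (regular p) (regular q) ]
    p *ᶠ q = (num p * num q) ÷ (den p * den q) [ R.regular-* (regular p) (regular q) ]

    -ᶠ_ : Fraction → Fraction
    -ᶠ p = (- num p) ÷ den p [ regular p ]

  ι : Carrier → Fraction
  ι a = a ÷ 1# [ R.unit-regular R.unit-1 ]

  private
    ~-trans : ∀ {p q r} → p ~ q → q ~ r → p ~ r
    ~-trans {a ÷ b [ _ ]} {x ÷ y [ reg ]} {e ÷ f [ _ ]} s t = R.Regular.cancel reg (begin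
      a * f * y ≈⟨ solve 3 (λ a f y → a :* f :* y := a :* y :* f) R.refl a f y ⟩
      a * y * f ≈⟨ R.*-congʳ s ⟩
      x * b * f ≈⟨ solve 3 (λ x b f → x :* b :* f := x :* f :* b) R.refl x b f ⟩
      x * f * b ≈⟨ R.*-congʳ t ⟩
      e * y * b ≈⟨ solve 3 (λ e y b → e :* y :* b := e :* b :* y) R.refl e y b ⟩
      e * b * y ∎)

    +ᶠ-cong : ∀ {p p′ q q′} → p ~ p′ → q ~ q′ → (p +ᶠ q) ~ (p′ +ᶠ q′)
    +ᶠ-cong {a ÷ b [ _ ]} {a′ ÷ b′ [ _ ]} {x ÷ y [ _ ]} {x′ ÷ y′ [ _ ]} s t = begin
      (a * y + x * b) * (b′ * y′)
        ≈⟨ solve 6 (λ a b x y b′ y′ → (a :* y :+ x :* b) :* (b′ :* y′)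
             := a :* b′ :* (y :* y′) :+ x :* y′ :* (b :* b′)) R.refl a b x y b′ y′ ⟩
      a * b′ * (y * y′) + x * y′ * (b * b′)
        ≈⟨ R.+-cong (R.*-congʳ s) (R.*-congʳ t) ⟩
      a′ * b * (y * y′) + x′ * y * (b * b′)
        ≈⟨ solve 6 (λ a′ b x′ y b′ y′ → a′ :* b :* (y :* y′) :+ x′ :* y :* (b :* b′)
             := (a′ :* y′ :+ x′ :* b′) :* (b :* y)) R.refl a′ b x′ y b′ y′ ⟩
      (a′ * y′ + x′ * b′) * (b * y) ∎

    *ᶠ-cong : ∀ {p p′ q q′} → p ~ p′ → q ~ q′ → (p *ᶠ q) ~ (p′ *ᶠ q′)
    *ᶠ-cong {a ÷ b [ _ ]} {a′ ÷ b′ [ _ ]} {x ÷ y [ _ ]} {x′ ÷ y′ [ _ ]} s t = begin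
      a * x * (b′ * y′)
        ≈⟨ solve 4 (λ a x b y → a :* x :* (b :* y) := a :* b :* (x :* y)) R.refl a x b′ y′ ⟩
      a * b′ * (x * y′) ≈⟨ R.*-cong s t ⟩
      a′ * b * (x′ * y)
        ≈⟨ solve 4 (λ a x b y → a :* b :* (x :* y) := a :* x :* (b :* y)) R.refl a′ x′ b y ⟩
      a′ * x′ * (b * y) ∎

    -ᶠ-cong : ∀ {p q} → p ~ q → (-ᶠ p) ~ (-ᶠ q)
    -ᶠ-cong {a ÷ b [ _ ]} {x ÷ y [ _ ]} s = begin
      - a * y   ≈⟨ -‿distribˡ-* a y ⟨
      - (a * y) ≈⟨ R.-‿cong s ⟩
      - (x * b) ≈⟨ -‿distribˡ-* x b ⟩
      - x * b   ∎

    +ᶠ-comm : ∀ p q → (p +ᶠ q) ~ (q +ᶠ p)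
    +ᶠ-comm (a ÷ b [ _ ]) (x ÷ y [ _ ]) =
      solve 4 (λ a b x y → (a :* y :+ x :* b) :* (y :* b) := (x :* b :+ a :* y) :* (b :* y)) R.refl a b x y

    +ᶠ-assoc : ∀ p q r → ((p +ᶠ q) +ᶠ r) ~ (p +ᶠ (q +ᶠ r))
    +ᶠ-assoc (a ÷ b [ _ ]) (x ÷ y [ _ ]) (e ÷ f [ _ ]) =
      solve 6 (λ a b x y e f →
        ((a :* y :+ x :* b) :* f :+ e :* (b :* y)) :* (b :* (y :* f))
          := (a :* (y :* f) :+ (x :* f :+ e :* y) :* b) :* (b :* y :* f)) R.refl a b x y e f

    0+ᶠ : ∀ p → (ι 0# +ᶠ p) ~ p
    0+ᶠ (a ÷ b [ _ ]) = begin
      (0# * b + a * 1#) * b ≈⟨ R.*-congʳ (R.+-congʳ (R.zeroˡ b)) ⟩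
      (0# + a * 1#) * b     ≈⟨ R.*-congʳ (R.+-identityˡ _) ⟩
      a * 1# * b            ≈⟨ R.*-assoc a 1# b ⟩
      a * (1# * b)          ∎

    -+ᶠ : ∀ p → ((-ᶠ p) +ᶠ p) ~ ι 0#
    -+ᶠ (a ÷ b [ _ ]) = begin
      (- a * b + a * b) * 1#  ≈⟨ R.*-congʳ (R.distribʳ b (- a) a) ⟨
      ((- a + a) * b) * 1#    ≈⟨ R.*-congʳ (R.*-congʳ (R.-‿inverseˡ a)) ⟩
      (0# * b) * 1#           ≈⟨ R.*-congʳ (R.zeroˡ b) ⟩
      0# * 1#                 ≈⟨ R.zeroˡ 1# ⟩
      0#                      ≈⟨ R.zeroˡ (b * b) ⟨
      0# * (b * b)            ∎

    *ᶠ-comm : ∀ p q → (p *ᶠ q) ~ (q *ᶠ p)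
    *ᶠ-comm (a ÷ b [ _ ]) (x ÷ y [ _ ]) = R.*-cong (R.*-comm a x) (R.*-comm y b)

    *ᶠ-assoc : ∀ p q r → ((p *ᶠ q) *ᶠ r) ~ (p *ᶠ (q *ᶠ r))
    *ᶠ-assoc (a ÷ b [ _ ]) (x ÷ y [ _ ]) (e ÷ f [ _ ]) =
      R.*-cong (R.*-assoc a x e) (R.sym (R.*-assoc b y f))

    1*ᶠ : ∀ p → (ι 1# *ᶠ p) ~ p
    1*ᶠ (a ÷ b [ _ ]) = solve 3 (λ o a b → o :* a :* b := a :* (o :* b)) R.refl 1# a b

    *ᶠ-distribʳ : ∀ p q r → ((q +ᶠ r) *ᶠ p) ~ ((q *ᶠ p) +ᶠ (r *ᶠ p))
    *ᶠ-distribʳ (a ÷ b [ _ ]) (x ÷ y [ _ ]) (e ÷ f [ _ ]) =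
      solve 6 (λ a b x y e f →
        (x :* f :+ e :* y) :* a :* (y :* b :* (f :* b))
          := (x :* a :* (f :* b) :+ e :* a :* (y :* b)) :* (y :* f :* b)) R.refl a b x y e f

    trans³ : ∀ {p q r s} → p ~ q → q ~ r → r ~ s → p ~ s
    trans³ {p} {q} {r} {s} x y z = ~-trans {p} {q} {s} x (~-trans {q} {r} {s} y z)

  fractions : CommutativeRing (c ⊔ ℓ) ℓ
  fractions = record
    { Carrier = Fraction
    ; _≈_ = _≈ᶠ_
    ; _+_ = _+ᶠ_
    ; _*_ = _*ᶠ_
    ; -_  = -ᶠ_
    ; 0#  = ι 0#
    ; 1#  = ι 1#
    ; isCommutativeRing = record
      { isRing = record
        { +-isAbelianGroup = record
          { isGroup = record
            { isMonoid = record
              { isSemigroup = record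
                { isMagma = record
                  { isEquivalence = record
                    { refl  = cross R.refl
                    ; sym   = λ (cross s) → cross (R.sym s)
                    ; trans = λ {p} {q} {r} (cross s) (cross t) → cross (~-trans {p} {q} {r} s t)
                    }
                  ; ∙-cong = λ {p} {p′} {q} {q′} (cross s) (cross t) → cross (+ᶠ-cong {p} {p′} {q} {q′} s t)
                  }
                ; assoc = λ p q r → cross (+ᶠ-assoc p q r)
                }
              ; identity = (λ p → cross (0+ᶠ p))
                         , λ p → cross (~-trans {p +ᶠ ι 0#} {ι 0# +ᶠ p} {p} (+ᶠ-comm p (ι 0#)) (0+ᶠ p))
              }
            ; inverse = (λ p → cross (-+ᶠ p))
                      , λ p → cross (~-trans {p +ᶠ (-ᶠ p)} {(-ᶠ p) +ᶠ p} {ι 0#} (+ᶠ-comm p (-ᶠ p)) (-+ᶠ p))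
            ; ⁻¹-cong = λ {p} {q} (cross s) → cross (-ᶠ-cong {p} {q} s)
            }
          ; comm = λ p q → cross (+ᶠ-comm p q)
          }
        ; *-cong     = λ {p} {p′} {q} {q′} (cross s) (cross t) → cross (*ᶠ-cong {p} {p′} {q} {q′} s t)
        ; *-assoc    = λ p q r → cross (*ᶠ-assoc p q r)
        ; *-identity = (λ p → cross (1*ᶠ p))
                     , λ p → cross (~-trans {p *ᶠ ι 1#} {ι 1# *ᶠ p} {p} (*ᶠ-comm p (ι 1#)) (1*ᶠ p))
        ; distrib    =
            (λ p q r → cross (trans³ {p *ᶠ (q +ᶠ r)} {(q +ᶠ r) *ᶠ p} {(q *ᶠ p) +ᶠ (r *ᶠ p)} {(p *ᶠ q) +ᶠ (p *ᶠ r)}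
              (*ᶠ-comm p (q +ᶠ r)) (*ᶠ-distribʳ p q r)
              (+ᶠ-cong {q *ᶠ p} {p *ᶠ q} {r *ᶠ p} {p *ᶠ r} (*ᶠ-comm q p) (*ᶠ-comm r p))))
          , λ p q r → cross (*ᶠ-distribʳ p q r)
        }
      ; *-comm = λ p q → cross (*ᶠ-comm p q)
      }
    }

  private module F = RingOps fractions

  abstract
    unit-fraction : ∀ p → Regular (num p) → F.Unit p
    unit-fraction p r = F.mkUnit {inverse = den p ÷ num p [ r ]}
      (cross (R.trans (R.*-identityʳ _) (R.trans (R.*-comm _ _) (R.sym (R.*-identityˡ _)))))

    unit-1-ι : ∀ {a} → Regular (1# R.- a) → F.Unit (F.1# F.- ι a)
    unit-1-ι {a} r = unit-fraction (F.1# F.- ι a) (R.regular-cong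
      (R.sym (R.+-cong (R.*-identityʳ 1#) (R.*-identityʳ (- a)))) r)

    unit-1-recip : ∀ {a} (r : Regular a) → Regular (a R.- 1#) → F.Unit (F.1# F.- (1# ÷ a [ r ]))
    unit-1-recip {a} r r′ = unit-fraction (F.1# F.- (1# ÷ a [ r ])) (R.regular-cong
      (R.sym (R.+-cong (R.*-identityˡ a) (R.*-identityʳ (- 1#)))) r′)

-- The coefficients of the powers of t in 𝒢(t;x,u,v,q,z), for elements of any
-- commutative ring in which 1 - x and 1 - u are invertible.  Interpreting the
-- rational functions of x and u in a ring of series is what expands them.
module _ (R : CommutativeRing c ℓ) where
  open RingOps R

  private
    ∑ₚ : ∀ n → (Permutation n n → Carrier) → Carrier
    ∑ₚ n w = foldr _+_ 0# (map w (permutations n))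

  𝒢 : (x u v q z : Carrier) → Unit (1# - x) → Unit (1# - u) → ℕ → Carrier
  𝒢 x u v q z 1-x 1-u zero      = 0#
  𝒢 x u v q z 1-x 1-u n@(suc _) = ∑ₚ n λ π →
    (u ^ des π * x ^ ides π * q ^ lmin π * v ^ rmax π * z ^ lmax π)
      / ((1# - u) ^ n * (1# - x) ^ n) [ unit-* (unit-^ n 1-u) (unit-^ n 1-x) ]

-- An element of A⟦y⟧⟦t⟧ as an element of A⟦t⟧⟦y⟧.
swap : ∀ {a} {A : Set a} → (ℕ → ℕ → A) → ℕ → ℕ → A
swap f i j = f j i

-- The instance needed is K = ℚ[v] with v₀ = v, here and below.
module ExpansionAtZero (K : CommutativeRing c ℓ) (v₀ : CommutativeRing.Carrier K) where
  private
    module Sx = Series K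
    module Su = Series Sx.powerSeries

  K⟦x⟧⟦u⟧ : CommutativeRing c ℓ
  K⟦x⟧⟦u⟧ = Su.powerSeries

  open RingOps K⟦x⟧⟦u⟧ using (Carrier; _-_; Unit)
  open RingOps K⟦x⟧⟦u⟧ public using (1#)
  open Series K⟦x⟧⟦u⟧ public using (_≈ₛ_)

  x u v : Carrier
  x = Su.C Sx.X
  u = Su.X
  v = Su.C (Sx.C v₀)

  abstract
    unit-1-x : Unit (1# - x)
    unit-1-x = Su.unit-series (1# - x) Sx.unit-1-X

    unit-1-u : Unit (1# - u)
    unit-1-u = Su.unit-1-X

-- With w = u⁻¹, the rational functions of u occurring in 𝒢 lie in the ring of
-- fractions of K⟦x⟧⟦w⟧, which contains the Laurent series in w over K⟦x⟧; such
-- an element has expansion f ∈ K⟦x⟧⟦w⟧ exactly when it equals ι f.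
module ExpansionAtInfinity (K : CommutativeRing c ℓ) (v₀ : CommutativeRing.Carrier K) where
  private
    module Sx = Series K
    module Sw = Series Sx.powerSeries
    module W = RingOps Sw.powerSeries
    module F = Frac Sw.powerSeries

  Frac-K⟦x⟧⟦w⟧ : CommutativeRing (c ⊔ ℓ) ℓ
  Frac-K⟦x⟧⟦w⟧ = F.fractions

  open RingOps Frac-K⟦x⟧⟦w⟧ using (Carrier; _-_; Unit)
  open RingOps Frac-K⟦x⟧⟦w⟧ public using (1#)
  open Series Frac-K⟦x⟧⟦w⟧ public using (_≈ₛ_)
  open F public using (ι)

  private
    abstract
      regular-w : W.Regular Sw.X
      regular-w = Sw.regular-X

  x u v : Carrier
  x = ι (Sw.C Sx.X)
  u = W.1# F.÷ Sw.X [ regular-w ]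
  v = ι (Sw.C (Sx.C v₀))

  abstract
    unit-1-x : Unit (1# - x)
    unit-1-x = F.unit-1-ι (W.unit-regular (Sw.unit-series (W.1# W.- Sw.C Sx.X) Sx.unit-1-X))

    unit-1-u : Unit (1# - u)
    unit-1-u = F.unit-1-recip regular-w
      (W.unit-regular (W.unit-swap {W.1#} {Sw.X} Sw.unit-1-X))

-- For a field K, K⟨x,u⟩[v] is K(x,u)[v]: rational functions of x and u,
-- polynomial in v.
module RationalFunctions (K : CommutativeRing c ℓ) where
  private
    module Px = Poly K
    module Pu = Poly Px.polynomial
    module F = Frac Pu.polynomial
    module V = Poly F.fractions

  K⟨x,u⟩[v] : CommutativeRing (c ⊔ ℓ) ℓ
  K⟨x,u⟩[v] = V.polynomial

  open RingOps K⟨x,u⟩[v] using (Carrier; _-_; Unit)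
  open RingOps K⟨x,u⟩[v] public using (1#)
  open Series K⟨x,u⟩[v] public using (_≈ₛ_)

  x u v : Carrier
  x = V.C (F.ι (Pu.C Px.X))
  u = V.C (F.ι Pu.X)
  v = V.X

  abstract
    unit-1-x : Unit (1# - x)
    unit-1-x = V.unit-1-C (F.unit-1-ι (Pu.regular-1-C {Px.X} Px.regular-1-X))

    unit-1-u : Unit (1# - u)
    unit-1-u = V.unit-1-C (F.unit-1-ι Pu.regular-1-X)

-- Both right-hand sides are written in K⟦x⟧⟦t⟧⟦y⟧, for y = u and y = u⁻¹.
module RightHandSides (K : CommutativeRing c ℓ) (v₀ : CommutativeRing.Carrier K) where
  private
    module Sx = Series K
    module X = RingOps Sx.powerSeries
    module St = Series Sx.powerSeries

  open RingOps St.powerSeries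

  x t v : Carrier
  x = St.C Sx.X
  t = St.X
  v = St.C (Sx.C v₀)

  private
    pow-head : ∀ n → ((1# - t) ^ n) 0 X.≈ X.1#
    pow-head n = St.^-head (1# - t) n (X.a-0≈a X.1#)

    x*-head : ∀ f → f 0 X.≈ X.1# → (x * f) 0 X.≈ Sx.X
    x*-head f p = X.trans (St.*ₛ-head x f) (X.trans (X.*-congˡ {Sx.X} p) (X.*-identityʳ Sx.X))

    unit-X-1 : X.Unit (Sx.X X.- X.1#)
    unit-X-1 = X.unit-swap {X.1#} {Sx.X} Sx.unit-1-X

  abstract
    unit₁ : ∀ n → Unit ((1# - t) ^ n - x)
    unit₁ n = St.unit-series ((1# - t) ^ n - x)
      (X.unit-cong (X.+-congʳ (X.sym (pow-head n))) Sx.unit-1-X)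

    unit₂ : ∀ n → Unit (x - (1# - t) ^ n)
    unit₂ n = unit-swap {(1# - t) ^ n} {x} (unit₁ n)

    unit₃ : ∀ n → Unit (x * (1# - t) ^ n - 1#)
    unit₃ n = St.unit-series (x * (1# - t) ^ n - 1#)
      (X.unit-cong (X.+-congʳ (X.sym (x*-head ((1# - t) ^ n) (pow-head n)))) unit-X-1)

    unit₄ : ∀ n → Unit (x * (1# - t) ^ n * (v * t - 1#) + 1#)
    unit₄ n = St.unit-series (x * (1# - t) ^ n * (v * t - 1#) + 1#)
      (X.unit-cong (X.sym head≈) Sx.unit-1-X)
      where
      open Relation.Binary.Reasoning.Setoid X.setoid
      open Algebra.Properties.Ring X.ring using (-‿distribʳ-*)
      p : Carrier
      p = (1# - t) ^ n
      vt-1-head : (v * t - 1#) 0 X.≈ X.- X.1#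
      vt-1-head = X.trans (X.+-congʳ (X.trans (St.*ₛ-head v t) (X.zeroʳ (v 0)))) (X.+-identityˡ (X.- X.1#))
      head≈ : (x * p * (v * t - 1#) + 1#) 0 X.≈ X.1# X.- Sx.X
      head≈ = begin
        (x * p * (v * t - 1#)) 0 X.+ X.1#
          ≈⟨ X.+-congʳ (St.*ₛ-head (x * p) (v * t - 1#)) ⟩
        (x * p) 0 X.* (v * t - 1#) 0 X.+ X.1#
          ≈⟨ X.+-congʳ (X.*-cong (x*-head p (pow-head n)) vt-1-head) ⟩
        Sx.X X.* X.- X.1# X.+ X.1#
          ≈⟨ X.+-congʳ (-‿distribʳ-* Sx.X X.1#) ⟨
        X.- (Sx.X X.* X.1#) X.+ X.1#
          ≈⟨ X.+-congʳ (X.-‿cong (X.*-identityʳ Sx.X)) ⟩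
        X.- Sx.X X.+ X.1#
          ≈⟨ X.+-comm (X.- Sx.X) X.1# ⟩
        X.1# X.- Sx.X ∎

  -- The factors multiplying uⁿ⁻¹ and u⁻ⁿ; only n ≥ 1 is used.
  firstSummand secondSummand : ℕ → Carrier
  firstSummand n =
    v * t / ((1# - t) ^ n - x) [ unit₁ n ] *
    (∏[1≤ i ≤ n ∸ 1 ] (((x - (1# - t) ^ i) - x * v * t) / (x - (1# - t) ^ i) [ unit₂ i ]))
  secondSummand n =
    v * t * (1# - t) ^ (n ∸ 1) / (x * (1# - t) ^ (n ∸ 1) - 1#) [ unit₃ (n ∸ 1) ] *
    (∏[1≤ i ≤ n ] ((1# - x * (1# - t) ^ (i ∸ 1)) /
                     (x * (1# - t) ^ (i ∸ 1) * (v * t - 1#) + 1#) [ unit₄ (i ∸ 1) ]))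

  -- ∑_{n≥1} firstSummand n · uⁿ⁻¹
  firstSeries : ℕ → Carrier
  firstSeries k = firstSummand (suc k)

  -- ∑_{n≥1} secondSummand n · u⁻ⁿ
  secondSeries : ℕ → Carrier
  secondSeries zero      = 0#
  secondSeries n@(suc _) = secondSummand n

ℚ[v] : CommutativeRing 0ℓ 0ℓ
ℚ[v] = Poly.polynomial ℚ-ring

module AtZero = ExpansionAtZero ℚ[v] (Poly.X ℚ-ring)
  renaming (K⟦x⟧⟦u⟧ to ℚ[v]⟦x⟧⟦u⟧)
module AtInfinity = ExpansionAtInfinity ℚ[v] (Poly.X ℚ-ring)
  renaming (Frac-K⟦x⟧⟦w⟧ to Frac-ℚ[v]⟦x⟧⟦w⟧)
module Rational = RationalFunctions ℚ-ring
  renaming (K⟨x,u⟩[v] to ℚ⟨x,u⟩[v])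
module Summands = RightHandSides ℚ[v] (Poly.X ℚ-ring)

{-# OPTIONS --safe #-}
-- A permutation τ together with a monotone sequence that is strict at prescribed
-- places is the same thing as a word standardising to τ.  Expanding
-- uᵉ / (1 - u)ⁿ, with e counting the ascents of τ⁻¹, therefore turns the
-- coefficient of tⁿ in 𝒢 into ∑ₘ uᵐ · (words of length n with largest letter m,
-- weighted by their descents and right-to-left records).  Since
-- uᵉ / (1 - u)ⁿ = (-1)ⁿ wⁿ⁻ᵉ / (1 - w)ⁿ for w = u⁻¹, the expansion at infinity
-- counts words in the same way, but with > replaced by ≥ and t by -t.
-- Words with largest letter m, classified by their first letter, satisfy a linear
-- system; its solution gives M (qᵐ⁺¹ - x) = vtD resp. M (x qᵐ - 1) = v t qᵐ D′,
-- where q = 1 - t, M is the generating function of these words, and D, D′ are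
-- 1 + x times that of the words with all letters < m, resp. ≤ m.  As D′ = D + x M,
-- both D and D′ are products.
-- The symmetries come from π ↦ π⁻¹ and from the reverse-complement.
module Submission where

open import Defs
import Algebra.Construct.NaturalChoice.Max
open import Algebra.Bundles using (CommutativeRing)
open import Algebra.Morphism.Construct.Identity using (isRingHomomorphism)
open import Algebra.Morphism.Structures using (IsRingHomomorphism)
import Algebra.Properties.CommutativeMonoid.Sum
import Algebra.Properties.CommutativeSemiring.Exp
import Algebra.Properties.Monoid.Sum
import Algebra.Properties.Ring
import Algebra.Properties.Semiring.Exp
import Algebra.Properties.Semiring.Sum
import Algebra.Solver.Ring.NaturalCoefficients.Default as Solver
open import Data.Bool.Base using (Bool; true; false; not; if_then_else_)
open import Data.Fin.Base as Fin using (Fin; zero; suc; toℕ; fromℕ; fromℕ<; inject₁; opposite; punchIn)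
open import Data.Fin.Permutation as Perm
  using (Permutation; _⟨$⟩ʳ_; _⟨$⟩ˡ_; flip; insert; reverse; _∘ₚ_; inverseˡ; inverseʳ)
open import Data.Fin.Properties as Fin using (_<?_; all?)
open import Data.List.Base as List using (List; []; _∷_; _++_; map; foldr; allFin; cartesianProductWith)
import Data.List.Membership.Propositional.Properties as ∈
open import Data.List.Relation.Unary.All using (All; []; _∷_)
open import Data.List.Relation.Unary.AllPairs using (AllPairs; []; _∷_)
open import Data.List.Relation.Unary.Any using (Any; here; there)
import Data.List.Relation.Unary.Unique.Propositional.Properties as Unique
open import Data.Nat.Base as ℕ using (ℕ; zero; suc; z≤n; s≤s)
import Data.Nat.Properties as ℕ
open import Data.Product.Base using (_×_; _,_; proj₁; proj₂; ∃)
open import Data.Rational.Properties using () renaming (+-*-commutativeRing to ℚ-ring)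
open import Data.Sum.Base using (_⊎_; inj₁; inj₂; [_,_]′)
import Data.Vec.Base as Vec
import Data.Vec.Functional as Vector
open import Function.Base using (_∘_) renaming (flip to swapArguments)
open import Function.Bundles using (_⇔_; mk⇔; Equivalence)
open import Level using (Level; 0ℓ)
open import Relation.Binary.Bundles using (Setoid)
open import Relation.Binary.Core using (Rel)
open import Relation.Binary.Definitions using (Decidable; tri<; tri≈; tri>)
open import Relation.Binary.PropositionalEquality as ≡ using (_≡_; _≢_; _≗_)
import Relation.Binary.Reasoning.Setoid
open import Relation.Nullary.Decidable
  using (Dec; yes; no; does; map′; _→-dec_; _×-dec_; does-⇔; dec-true; dec-false)
open import Relation.Nullary.Negation using (¬_; contradiction)

open Equivalence using (to; from)

-- The factor (1 - x)⁻ⁿ is what makes the linear system solvable. Put y = 1 - x, and let P j collect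
-- the words with largest letter m whose first letter is less than j. Prepending a letter a < m to
-- the words with largest letter m gives t(M - y P a), because x = 1 - y is paid only when a descent
-- is created. Once t is scaled by σ = 1/y, this is t(σM - P a), so σM - P is multiplied by 1 - t at
-- each step from a to a + 1. With ≥, a descent means a following letter below a + 1; the scale σ =
-- -1/y contains the sign of the expansion at infinity, and σM + P is divided by 1 - t at each step.
-- This is the origin of the powers of q.
--
-- The quotients in 𝒢 are never expanded themselves: a candidate coefficient is multiplied by (1 -
-- u)ⁿ (1 - x)ⁿ and compared with the numerator. Bijections are replaced by sums: uniqueness of
-- standardisation is the equation ∑ [τ standardises w] = 1, which is inserted under a sum over
-- words, and then the two sums are exchanged.

private
  variable
    c ℓ c′ ℓ′ : Level
    n k : ℕ
    A B P Q S : Set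

-- Statistics of permutations

module ℕΣ = Algebra.Properties.CommutativeMonoid.Sum ℕ.+-0-commutativeMonoid

bit : Bool → ℕ
bit b = if b then 1 else 0

-- Counting is written as a finite sum so that a permutation of the positions can be absorbed by the
-- invariance of sums.
# : (Fin n → Bool) → ℕ
# f = ℕΣ.sum (bit ∘ f)

#-cong : {f g : Fin n → Bool} → f ≗ g → # f ≡ # g
#-cong p = ℕΣ.sum-cong-≗ (≡.cong bit ∘ p)

#-permute : (f : Fin n → Bool) (π : Permutation n n) → # f ≡ # (f ∘ (π ⟨$⟩ʳ_))
#-permute f π = ℕΣ.sum-permute (bit ∘ f) π

#-not : (f : Fin n → Bool) → # f ℕ.+ # (not ∘ f) ≡ n
#-not {zero}  f = ≡.refl
#-not {suc n} f with f zero
... | true  = ≡.cong suc (#-not (f ∘ suc))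
... | false = ≡.trans (ℕ.+-suc _ _) (≡.cong suc (#-not (f ∘ suc)))

count-tabulate : ∀ {P : A → Set} (P? : ∀ a → Dec (P a)) (f : Fin n → A) →
                 Vec.count P? (Vec.tabulate f) ≡ # (does ∘ P? ∘ f)
count-tabulate {n = zero}  P? f = ≡.refl
count-tabulate {n = suc n} P? f with does (P? (f zero))
... | true  = ≡.cong suc (count-tabulate P? (f ∘ suc))
... | false = count-tabulate P? (f ∘ suc)

count-allFin : ∀ {P : Fin n → Set} (P? : ∀ i → Dec (P i)) →
               Vec.count P? (Vec.allFin n) ≡ # (does ∘ P?)
count-allFin {n} P? = count-tabulate {A = Fin n} {n = n} P? (λ i → i)

-- The relation is left open so that letters under > or ≥ and values of a permutation under < or >
-- share one notion; for > these are the right-to-left maxima.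
IsRightRecord : Rel A 0ℓ → (Fin n → A) → Fin n → Set
IsRightRecord R f i = ∀ j → i Fin.< j → R (f i) (f j)

module _ {R : Rel A 0ℓ} (R? : Decidable R) where
  adjacent : (Fin n → A) → ℕ
  adjacent {zero}  f = 0
  adjacent {suc n} f = # λ i → does (R? (f (inject₁ i)) (f (suc i)))

  isRightRecord? : (f : Fin n → A) → ∀ i → Dec (IsRightRecord R f i)
  isRightRecord? f i = all? λ j → (i <? j) →-dec R? (f i) (f j)

  rightRecords : (Fin n → A) → ℕ
  rightRecords f = # (does ∘ isRightRecord? f)

inject₁<suc : (i : Fin n) → inject₁ i Fin.< suc i
inject₁<suc i = s≤s (ℕ.≤-reflexive (Fin.toℕ-inject₁ i))

module _ {R : Rel A 0ℓ} (R? : Decidable R) {S : Rel B 0ℓ} (S? : Decidable S)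
         {f : Fin n → A} {g : Fin n → B}
         (iso : ∀ p q → p Fin.< q → R (f p) (f q) ⇔ S (g p) (g q)) where
  -- `iso` compares only pairs in the order of their positions. That is all a standardisation
  -- provides, and both statistics look at no other pairs.
  adjacent-cong : adjacent R? f ≡ adjacent S? g
  adjacent-cong = go f g iso
    where
    go : ∀ {n} (f : Fin n → A) (g : Fin n → B) →
         (∀ p q → p Fin.< q → R (f p) (f q) ⇔ S (g p) (g q)) →
         adjacent R? f ≡ adjacent S? g
    go {zero}  f g iso = ≡.refl
    go {suc n} f g iso = #-cong {n = n} λ i → does-⇔ (iso (inject₁ i) (suc i) (inject₁<suc i)) (R? _ _) (S? _ _)

  rightRecords-cong : rightRecords R? f ≡ rightRecords S? g
  rightRecords-cong = #-cong {n = n} λ i → does-⇔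
    (mk⇔ (λ h j i<j → to (iso i j i<j) (h j i<j)) (λ h j i<j → from (iso i j i<j) (h j i<j)))
    (isRightRecord? R? f i) (isRightRecord? S? g i)

opposite-inject₁ : (i : Fin n) → opposite (inject₁ i) ≡ suc (opposite i)
opposite-inject₁ zero    = ≡.refl
opposite-inject₁ (suc i) = ≡.cong inject₁ (opposite-inject₁ i)

opposite-< : {i j : Fin n} → i Fin.< j → opposite j Fin.< opposite i
opposite-< {i = i} {j} i<j = ≡.subst₂ ℕ._<_
  (≡.sym (Fin.opposite-prop j)) (≡.sym (Fin.opposite-prop i)) (ℕ.∸-monoʳ-< (s≤s i<j) (Fin.toℕ<n j))

opposite-<⁻¹ : {i j : Fin n} → opposite i Fin.< opposite j → j Fin.< i
opposite-<⁻¹ p = ≡.subst₂ Fin._<_ (Fin.opposite-involutive _) (Fin.opposite-involutive _) (opposite-< p)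

flip-cong : {π ρ : Permutation n n} → π Perm.≈ ρ → flip π Perm.≈ flip ρ
flip-cong {π = π} {ρ} p i = begin
  π ⟨$⟩ˡ i                     ≡⟨ ≡.cong (π ⟨$⟩ˡ_) (inverseʳ ρ) ⟨
  π ⟨$⟩ˡ (ρ ⟨$⟩ʳ (ρ ⟨$⟩ˡ i))  ≡⟨ ≡.cong (π ⟨$⟩ˡ_) (p (ρ ⟨$⟩ˡ i)) ⟨
  π ⟨$⟩ˡ (π ⟨$⟩ʳ (ρ ⟨$⟩ˡ i))  ≡⟨ inverseˡ π ⟩
  ρ ⟨$⟩ˡ i                     ∎
  where open ≡.≡-Reasoning

module _ {R : Rel A 0ℓ} (R? : Decidable R) where
  adjacent-≗ : {f g : Fin n → A} → f ≗ g → adjacent R? f ≡ adjacent R? g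
  adjacent-≗ p = adjacent-cong R? R? λ i j _ → mk⇔ (≡.subst₂ R (p i) (p j)) (≡.subst₂ R (≡.sym (p i)) (≡.sym (p j)))

  rightRecords-≗ : {f g : Fin n → A} → f ≗ g → rightRecords R? f ≡ rightRecords R? g
  rightRecords-≗ p = rightRecords-cong R? R? λ i j _ → mk⇔ (≡.subst₂ R (p i) (p j)) (≡.subst₂ R (≡.sym (p i)) (≡.sym (p j)))

  adjacent-opposite : (f : Fin n → A) → adjacent R? (f ∘ opposite) ≡ adjacent (swapArguments R?) f
  adjacent-opposite {zero}  f = ≡.refl
  adjacent-opposite {suc n} f = ≡.trans
    (#-cong {n = n} λ i → ≡.cong (λ j → does (R? (f j) (f (inject₁ (opposite i))))) (opposite-inject₁ i))
    (≡.sym (#-permute (λ i → does (R? (f (suc i)) (f (inject₁ i)))) reverse))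

less? : ∀ n → Decidable (Fin._<_ {n} {n})
less? n = _<?_

greater? : ∀ n → Decidable (Fin._>_ {n} {n})
greater? n i j = j <? i

des≡adjacent : (π : Permutation n n) → des π ≡ adjacent (greater? n) (π ⟨$⟩ʳ_)
des≡adjacent {zero}  π = ≡.refl
des≡adjacent {suc n} π = count-allFin {n = n} λ i → (π ⟨$⟩ʳ suc i) <? (π ⟨$⟩ʳ inject₁ i)

rmax≡rightRecords : (π : Permutation n n) → rmax π ≡ rightRecords (greater? n) (π ⟨$⟩ʳ_)
rmax≡rightRecords {n} π = count-allFin (isRightRecord? (greater? n) (π ⟨$⟩ʳ_))

des-cong : {π ρ : Permutation n n} → π Perm.≈ ρ → des π ≡ des ρ
des-cong {n} {π} {ρ} p = ≡.trans (des≡adjacent π) (≡.trans (adjacent-≗ (greater? n) p) (≡.sym (des≡adjacent ρ)))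

ides-cong : {π ρ : Permutation n n} → π Perm.≈ ρ → ides π ≡ ides ρ
ides-cong {n} {π} {ρ} p = des-cong {π = flip π} {flip ρ} (flip-cong {π = π} {ρ} p)

rmax-cong : {π ρ : Permutation n n} → π Perm.≈ ρ → rmax π ≡ rmax ρ
rmax-cong {n} {π} {ρ} p = ≡.trans (rmax≡rightRecords π) (≡.trans (rightRecords-≗ (greater? n) p) (≡.sym (rmax≡rightRecords ρ)))

LeftMinimum : (Fin n → Fin n) → Fin n → Set
LeftMinimum f i = ∀ j → j Fin.< i → f i Fin.< f j

leftMinimum? : ∀ (f : Fin n → Fin n) i → Dec (LeftMinimum f i)
leftMinimum? f i = all? λ j → (j <? i) →-dec (f i <? f j)

lmin-cong : {π ρ : Permutation n n} → π Perm.≈ ρ → lmin π ≡ lmin ρ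
lmin-cong {n} {π} {ρ} p = ≡.trans (count-allFin (leftMinimum? (π ⟨$⟩ʳ_)))
  (≡.trans (#-cong λ i → does-⇔ (mk⇔
      (λ h j j<i → ≡.subst₂ Fin._<_ (p i) (p j) (h j j<i))
      (λ h j j<i → ≡.subst₂ Fin._<_ (≡.sym (p i)) (≡.sym (p j)) (h j j<i)))
    (leftMinimum? (π ⟨$⟩ʳ_) i) (leftMinimum? (ρ ⟨$⟩ʳ_) i))
  (≡.sym (count-allFin (leftMinimum? (ρ ⟨$⟩ʳ_)))))

≢∧≮⇒> : {i j : Fin n} → i ≢ j → ¬ (i Fin.< j) → j Fin.< i
≢∧≮⇒> i≢j i≮j = ℕ.≤∧≢⇒< (ℕ.≮⇒≥ i≮j) (i≢j ∘ ≡.sym ∘ Fin.toℕ-injective)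

-- A right-to-left maximum is a point (i, πᵢ) of the diagram with no point above and to the right of
-- it. Exchanging the coordinates preserves this condition, so π carries the record positions of π
-- to those of π⁻¹.
rmax-flip : (π : Permutation n n) → rmax (flip π) ≡ rmax π
rmax-flip {n} π = begin
  rmax (flip π)                                           ≡⟨ rmax≡rightRecords (flip π) ⟩
  rightRecords (greater? n) (flip π ⟨$⟩ʳ_)                        ≡⟨ #-permute (does ∘ isRightRecord? (greater? n) (flip π ⟨$⟩ʳ_)) π ⟩
  # (does ∘ isRightRecord? (greater? n) (flip π ⟨$⟩ʳ_) ∘ (π ⟨$⟩ʳ_)) ≡⟨ #-cong (λ i → does-⇔ (mk⇔ (⇒ i) (⇐ i))
      (isRightRecord? (greater? n) (flip π ⟨$⟩ʳ_) (π ⟨$⟩ʳ i)) (isRightRecord? (greater? n) (π ⟨$⟩ʳ_) i)) ⟩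
  rightRecords (greater? n) (π ⟨$⟩ʳ_)                             ≡⟨ rmax≡rightRecords π ⟨
  rmax π                                                  ∎
  where
  open ≡.≡-Reasoning
  ⇒ : ∀ i → IsRightRecord Fin._>_ (flip π ⟨$⟩ʳ_) (π ⟨$⟩ʳ i) → IsRightRecord Fin._>_ (π ⟨$⟩ʳ_) i
  ⇒ i h k i<k = ≢∧≮⇒>
    (λ e → ℕ.<⇒≢ i<k (≡.cong toℕ (≡.trans (≡.sym (inverseˡ π)) (≡.trans (≡.cong (π ⟨$⟩ˡ_) e) (inverseˡ π)))))
    λ πi<πk → ℕ.<-asym i<k (≡.subst₂ Fin._<_ (inverseˡ π) (inverseˡ π) (h (π ⟨$⟩ʳ k) πi<πk))
  ⇐ : ∀ i → IsRightRecord Fin._>_ (π ⟨$⟩ʳ_) i → IsRightRecord Fin._>_ (flip π ⟨$⟩ʳ_) (π ⟨$⟩ʳ i)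
  ⇐ i h k πi<k = ≡.subst (π ⟨$⟩ˡ k Fin.<_) (≡.sym (inverseˡ π)) (≢∧≮⇒>
    (λ e → ℕ.<⇒≢ πi<k (≡.cong toℕ (≡.trans (≡.cong (π ⟨$⟩ʳ_) e) (inverseʳ π))))
    λ i<π⁻¹k → ℕ.<-asym πi<k (≡.subst (Fin._< (π ⟨$⟩ʳ i)) (inverseʳ π) (h (π ⟨$⟩ˡ k) i<π⁻¹k)))

reverseComplement : Permutation n n → Permutation n n
reverseComplement π = reverse ∘ₚ π ∘ₚ reverse

reverseComplement-adjoint : (π ρ : Permutation n n) → reverseComplement π Perm.≈ ρ → π Perm.≈ reverseComplement ρ
reverseComplement-adjoint π ρ p i = begin
  π ⟨$⟩ʳ i                                       ≡⟨ Fin.opposite-involutive _ ⟨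
  opposite (opposite (π ⟨$⟩ʳ i))                 ≡⟨ ≡.cong (opposite ∘ opposite ∘ (π ⟨$⟩ʳ_)) (Fin.opposite-involutive i) ⟨
  opposite (reverseComplement π ⟨$⟩ʳ opposite i) ≡⟨ ≡.cong opposite (p (opposite i)) ⟩
  reverseComplement ρ ⟨$⟩ʳ i                     ∎
  where open ≡.≡-Reasoning

adjacent-complement : (f : Fin n → Fin n) → adjacent (greater? n) (opposite ∘ f) ≡ adjacent (less? n) f
adjacent-complement {n} f = adjacent-cong (greater? n) (less? n) λ p q _ → mk⇔ (opposite-<⁻¹ {i = f q} {f p}) (opposite-< {i = f p} {f q})

adjacent-reverseComplement : (f : Fin n → Fin n) → adjacent (greater? n) (opposite ∘ f ∘ opposite) ≡ adjacent (greater? n) f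
adjacent-reverseComplement {n} f = ≡.trans (adjacent-complement (f ∘ opposite)) (adjacent-opposite (less? n) f)

des-reverseComplement : (π : Permutation n n) → des (reverseComplement π) ≡ des π
des-reverseComplement {n} π = ≡.trans (des≡adjacent (reverseComplement π))
  (≡.trans (adjacent-reverseComplement (π ⟨$⟩ʳ_)) (≡.sym (des≡adjacent π)))

ides-reverseComplement : (π : Permutation n n) → ides (reverseComplement π) ≡ ides π
ides-reverseComplement {n} π = ≡.trans
  -- Inverting a reverse-complement gives the reverse-complement of the inverse by computation
  -- alone.
  (des-cong {π = flip (reverseComplement π)} {reverseComplement (flip π)} λ _ → ≡.refl)
  (des-reverseComplement (flip π))

-- Reverse-complement turns the diagram by a half-turn: points with nothing to their upper right
-- become points with nothing to their lower left.
lmin-reverseComplement : (π : Permutation n n) → lmin (reverseComplement π) ≡ rmax π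
lmin-reverseComplement {n} π = begin
  lmin (reverseComplement π)          ≡⟨ count-allFin (leftMinimum? ρ) ⟩
  # (does ∘ leftMinimum? ρ)           ≡⟨ #-permute (does ∘ leftMinimum? ρ) reverse ⟩
  # (does ∘ leftMinimum? ρ ∘ opposite) ≡⟨ #-cong (λ i → does-⇔ (mk⇔ (⇒ i) (⇐ i))
      (leftMinimum? ρ (opposite i)) (isRightRecord? (greater? n) (π ⟨$⟩ʳ_) i)) ⟩
  rightRecords (greater? n) (π ⟨$⟩ʳ_)         ≡⟨ rmax≡rightRecords π ⟨
  rmax π                              ∎
  where
  open ≡.≡-Reasoning
  ρ : Fin n → Fin n
  ρ = reverseComplement π ⟨$⟩ʳ_
  ρ-opposite : ∀ i → ρ (opposite i) ≡ opposite (π ⟨$⟩ʳ i)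
  ρ-opposite i = ≡.cong (opposite ∘ (π ⟨$⟩ʳ_)) (Fin.opposite-involutive i)
  ⇒ : ∀ i → LeftMinimum ρ (opposite i) → IsRightRecord Fin._>_ (π ⟨$⟩ʳ_) i
  ⇒ i h j i<j = opposite-<⁻¹ (≡.subst₂ Fin._<_ (ρ-opposite i) (ρ-opposite j) (h (opposite j) (opposite-< i<j)))
  ⇐ : ∀ i → IsRightRecord Fin._>_ (π ⟨$⟩ʳ_) i → LeftMinimum ρ (opposite i)
  ⇐ i h j j<i = ≡.subst (Fin._< ρ j) (≡.sym (ρ-opposite i)) (opposite-< (h (opposite j)
    (≡.subst (Fin._< opposite j) (Fin.opposite-involutive i) (opposite-< j<i))))

-- Sums over permutations and words

_≈ₚ?_ : (π ρ : Permutation n n) → Dec (π Perm.≈ ρ)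
π ≈ₚ? ρ = all? λ i → (π ⟨$⟩ʳ i) Fin.≟ (ρ ⟨$⟩ʳ i)

_≗?_ : (w w′ : Fin n → Fin k) → Dec (w ≗ w′)
w ≗? w′ = all? λ i → w i Fin.≟ w′ i

words : ∀ k n → List (Fin n → Fin k)
words k zero    = (λ ()) ∷ []
words k (suc n) = cartesianProductWith Vector._∷_ (allFin k) (words k n)

module Sums (R : CommutativeRing c ℓ) where
  open RingOps R hiding (zero)
  open Algebra.Properties.Semiring.Sum semiring using (sum)
  open Relation.Binary.Reasoning.Setoid setoid
  open Solver commutativeSemiring using (solve; _:+_; _:=_)

  ∑ : List A → (A → Carrier) → Carrier
  ∑ xs w = foldr _+_ 0# (map w xs)

  ⟦_⟧ : Dec P → Carrier
  ⟦ P? ⟧ = if does P? then 1# else 0#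

  ∑-cong : {v w : A → Carrier} → (∀ x → v x ≈ w x) → ∀ xs → ∑ xs v ≈ ∑ xs w
  ∑-cong p []       = refl
  ∑-cong p (x ∷ xs) = +-cong (p x) (∑-cong p xs)

  ∑-0 : (xs : List A) → ∑ xs (λ _ → 0#) ≈ 0#
  ∑-0 []       = refl
  ∑-0 (x ∷ xs) = trans (+-identityˡ _) (∑-0 xs)

  ∑-+ : (xs : List A) (v w : A → Carrier) → ∑ xs (λ x → v x + w x) ≈ ∑ xs v + ∑ xs w
  ∑-+ []       v w = sym (+-identityˡ 0#)
  ∑-+ (x ∷ xs) v w = trans (+-congˡ (∑-+ xs v w))
    (solve 4 (λ a b c d → (a :+ b) :+ (c :+ d) := (a :+ c) :+ (b :+ d)) refl (v x) (w x) (∑ xs v) (∑ xs w))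

  ∑-*ˡ : ∀ a (xs : List A) w → ∑ xs (λ x → a * w x) ≈ a * ∑ xs w
  ∑-*ˡ a []       w = sym (zeroʳ a)
  ∑-*ˡ a (x ∷ xs) w = trans (+-congˡ (∑-*ˡ a xs w)) (sym (distribˡ a _ _))

  ∑-*ʳ : ∀ a (xs : List A) w → ∑ xs (λ x → w x * a) ≈ ∑ xs w * a
  ∑-*ʳ a xs w = trans (∑-cong (λ x → *-comm (w x) a) xs) (trans (∑-*ˡ a xs w) (*-comm a _))

  ∑-swap : (xs : List A) (ys : List B) (w : A → B → Carrier) →
           ∑ xs (λ x → ∑ ys (w x)) ≈ ∑ ys λ y → ∑ xs λ x → w x y
  ∑-swap []       ys w = sym (∑-0 ys)
  ∑-swap (x ∷ xs) ys w = trans (+-congˡ (∑-swap xs ys w)) (sym (∑-+ ys (w x) _))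

  ∑-++ : (xs ys : List A) (w : A → Carrier) → ∑ (xs ++ ys) w ≈ ∑ xs w + ∑ ys w
  ∑-++ []       ys w = sym (+-identityˡ _)
  ∑-++ (x ∷ xs) ys w = trans (+-congˡ (∑-++ xs ys w)) (sym (+-assoc _ _ _))

  ∑-map : (f : A → B) (xs : List A) (w : B → Carrier) → ∑ (map f xs) w ≡ ∑ xs (w ∘ f)
  ∑-map f []       w = ≡.refl
  ∑-map f (x ∷ xs) w = ≡.cong (w (f x) +_) (∑-map f xs w)

  ∑-product : {C : Set} (f : A → B → C) (xs : List A) (ys : List B) (w : C → Carrier) →
              ∑ (cartesianProductWith f xs ys) w ≈ ∑ xs λ x → ∑ ys λ y → w (f x y)
  ∑-product f []       ys w = refl
  ∑-product f (x ∷ xs) ys w = trans (∑-++ (map (f x) ys) (cartesianProductWith f xs ys) w)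
    (+-cong (reflexive (∑-map (f x) ys w)) (∑-product f xs ys w))

  ∑-tabulate : (f : Fin n → A) (w : A → Carrier) → ∑ (List.tabulate f) w ≡ sum (w ∘ f)
  ∑-tabulate {zero}  f w = ≡.refl
  ∑-tabulate {suc n} f w = ≡.cong (w (f zero) +_) (∑-tabulate (f ∘ suc) w)

  ∑-allFin : (w : Fin n → Carrier) → ∑ (allFin n) w ≡ sum w
  ∑-allFin {n} w = ∑-tabulate {n} (λ i → i) w

  ⟦⟧-true : (P? : Dec P) → P → ⟦ P? ⟧ ≈ 1#
  ⟦⟧-true P? p rewrite dec-true P? p = refl

  ⟦⟧-false : (P? : Dec P) → ¬ P → ⟦ P? ⟧ ≈ 0#
  ⟦⟧-false P? p rewrite dec-false P? p = refl

  ⟦⟧-⇔ : P ⇔ Q → (P? : Dec P) (Q? : Dec Q) → ⟦ P? ⟧ ≈ ⟦ Q? ⟧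
  ⟦⟧-⇔ e P? Q? rewrite does-⇔ e P? Q? = refl

  ⟦⟧-guard : (P? : Dec P) {a b : Carrier} → (P → a ≈ b) → ⟦ P? ⟧ * a ≈ ⟦ P? ⟧ * b
  ⟦⟧-guard (yes p) f = *-congˡ (f p)
  ⟦⟧-guard (no ¬p) f = trans (zeroˡ _) (sym (zeroˡ _))

  ⟦⟧-× : S ⇔ (P × Q) → (S? : Dec S) (P? : Dec P) (Q? : Dec Q) → ⟦ S? ⟧ ≈ ⟦ P? ⟧ * ⟦ Q? ⟧
  ⟦⟧-× e S? (no ¬p) Q?      = trans (⟦⟧-false S? (¬p ∘ proj₁ ∘ to e)) (sym (zeroˡ _))
  ⟦⟧-× e S? (yes p) (no ¬q) = trans (⟦⟧-false S? (¬q ∘ proj₂ ∘ to e)) (sym (zeroʳ _))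
  ⟦⟧-× e S? (yes p) (yes q) = trans (⟦⟧-true S? (from e (p , q))) (sym (*-identityˡ 1#))

  -- The ring-valued form of "each class is met exactly once". As an equation with right-hand side 1
  -- it can be inserted under any sum, which is how changes of variable are carried out below.
  Enumerates : {_∼_ : Rel A 0ℓ} → Decidable _∼_ → List A → Set ℓ
  Enumerates _∼?_ xs = ∀ y → ∑ xs (λ x → ⟦ x ∼? y ⟧) ≈ 1#

  module _ (S : Setoid 0ℓ 0ℓ) (_≟_ : Decidable (Setoid._≈_ S)) where
    private
      module S = Setoid S

    unique∧complete⇒enumerates : ∀ {xs} → AllPairs (λ x y → ¬ (x S.≈ y)) xs →
                                 (∀ y → Any (y S.≈_) xs) → Enumerates _≟_ xs
    unique∧complete⇒enumerates u e y = go u (e y)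
      where
      absent : ∀ {xs x} → y S.≈ x → All (λ z → ¬ (x S.≈ z)) xs → ∑ xs (λ x → ⟦ x ≟ y ⟧) ≈ 0#
      absent y≈x []       = refl
      absent y≈x (p ∷ ps) = trans
        (+-cong (⟦⟧-false (_ ≟ y) λ z≈y → p (S.sym (S.trans z≈y y≈x))) (absent y≈x ps)) (+-identityˡ 0#)
      differs : ∀ {xs x} → All (λ z → ¬ (x S.≈ z)) xs → Any (y S.≈_) xs → ¬ (x S.≈ y)
      differs (p ∷ _)  (here y≈z) x≈y = p (S.trans x≈y y≈z)
      differs (_ ∷ ps) (there q)  x≈y = differs ps q x≈y
      go : ∀ {xs} → AllPairs (λ x y → ¬ (x S.≈ y)) xs → Any (y S.≈_) xs → ∑ xs (λ x → ⟦ x ≟ y ⟧) ≈ 1#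
      go (ps ∷ _) (here y≈x) = trans (+-cong (⟦⟧-true (_ ≟ y) (S.sym y≈x)) (absent y≈x ps)) (+-identityʳ 1#)
      go (ps ∷ u) (there q)  = trans (+-cong (⟦⟧-false (_ ≟ y) (differs ps q)) (go u q)) (+-identityˡ 1#)

  allFin-enumerates : ∀ n → Enumerates Fin._≟_ (allFin n)
  allFin-enumerates n = unique∧complete⇒enumerates (≡.setoid (Fin n)) Fin._≟_ (Unique.allFin⁺ n) ∈.∈-allFin

  permutations-enumerates : ∀ n → Enumerates _≈ₚ?_ (permutations n)
  permutations-enumerates n = unique∧complete⇒enumerates (permutationSetoid n) _≈ₚ?_
    (permutations-unique n) permutations-complete

  words-enumerates : ∀ k n → Enumerates _≗?_ (words k n)
  words-enumerates k zero    y = trans (+-identityʳ _) (⟦⟧-true ((λ ()) ≗? y) λ ())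
  words-enumerates k (suc n) y = begin
    ∑ (words k (suc n)) (λ w → ⟦ w ≗? y ⟧)
      ≈⟨ ∑-product Vector._∷_ (allFin k) (words k n) _ ⟩
    ∑ (allFin k) (λ a → ∑ (words k n) λ w → ⟦ (a Vector.∷ w) ≗? y ⟧)
      ≈⟨ ∑-cong (λ a → ∑-cong (λ w → ⟦⟧-× (split a w) ((a Vector.∷ w) ≗? y) (a Fin.≟ y zero) (w ≗? (y ∘ suc)))
           (words k n)) (allFin k) ⟩
    ∑ (allFin k) (λ a → ∑ (words k n) λ w → ⟦ a Fin.≟ y zero ⟧ * ⟦ w ≗? (y ∘ suc) ⟧)
      ≈⟨ ∑-cong (λ a → trans (∑-*ˡ _ (words k n) _)
           (trans (*-congˡ (words-enumerates k n (y ∘ suc))) (*-identityʳ _))) (allFin k) ⟩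
    ∑ (allFin k) (λ a → ⟦ a Fin.≟ y zero ⟧)
      ≈⟨ allFin-enumerates k (y zero) ⟩
    1# ∎
    where
    split : ∀ a w → ((a Vector.∷ w) ≗ y) ⇔ (a ≡ y zero × w ≗ (y ∘ suc))
    split a w = mk⇔ (λ p → p zero , p ∘ suc) λ { (p , q) zero → p ; (p , q) (suc i) → q i }

  module _ {_∼_ : Rel A 0ℓ} (_∼?_ : Decidable _∼_) (xs : List A) (enum : Enumerates _∼?_ xs) where
    ∑-pick : (w : A → Carrier) → ∀ y → (∀ {x} → x ∼ y → w x ≈ w y) → ∑ xs (λ x → ⟦ x ∼? y ⟧ * w x) ≈ w y
    ∑-pick w y p = begin
      ∑ xs (λ x → ⟦ x ∼? y ⟧ * w x) ≈⟨ ∑-cong (λ x → ⟦⟧-guard (x ∼? y) p) xs ⟩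
      ∑ xs (λ x → ⟦ x ∼? y ⟧ * w y) ≈⟨ ∑-*ʳ (w y) xs _ ⟩
      ∑ xs (λ x → ⟦ x ∼? y ⟧) * w y ≈⟨ *-congʳ (enum y) ⟩
      1# * w y                      ≈⟨ *-identityˡ _ ⟩
      w y                           ∎

  module _ {_∼_ : Rel A 0ℓ} (_∼?_ : Decidable _∼_) (xs : List A) (enum : Enumerates _∼?_ xs)
           (∼-sym : ∀ {x y} → x ∼ y → y ∼ x)
           (f g : A → A) (adjoint : ∀ x y → f x ∼ y ⇔ x ∼ g y) where
    -- The adjunction makes g an inverse of f up to ∼. After w (f x) is spread over all y ∼ f x and
    -- the sums are exchanged, the bracket reads x ∼ g y, and its sum over x is 1 again.
    ∑-reindex : (w : A → Carrier) → (∀ {x y} → x ∼ y → w x ≈ w y) → ∑ xs (w ∘ f) ≈ ∑ xs w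
    ∑-reindex w w-cong = begin
      ∑ xs (w ∘ f)
        ≈⟨ ∑-cong (λ x → sym (∑-pick _∼?_ xs enum w (f x) w-cong)) xs ⟩
      ∑ xs (λ x → ∑ xs λ y → ⟦ y ∼? f x ⟧ * w y)
        ≈⟨ ∑-swap xs xs _ ⟩
      ∑ xs (λ y → ∑ xs λ x → ⟦ y ∼? f x ⟧ * w y)
        ≈⟨ ∑-cong (λ y → ∑-*ʳ (w y) xs _) xs ⟩
      ∑ xs (λ y → ∑ xs (λ x → ⟦ y ∼? f x ⟧) * w y)
        ≈⟨ ∑-cong (λ y → *-congʳ (trans (∑-cong (λ x → ⟦⟧-⇔ (mk⇔ (to (adjoint x y) ∘ ∼-sym) (∼-sym ∘ from (adjoint x y)))
             (y ∼? f x) (x ∼? g y)) xs) (enum (g y)))) xs ⟩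
      ∑ xs (λ y → 1# * w y)
        ≈⟨ ∑-cong (λ y → *-identityˡ (w y)) xs ⟩
      ∑ xs w ∎

  module _ (w : Permutation n n → Carrier) (w-cong : ∀ {π ρ} → π Perm.≈ ρ → w π ≈ w ρ) where
    ∑-permutations : (f g : Permutation n n → Permutation n n) → (∀ π ρ → f π Perm.≈ ρ ⇔ π Perm.≈ g ρ) →
                     ∑ (permutations n) (w ∘ f) ≈ ∑ (permutations n) w
    ∑-permutations f g adj = ∑-reindex _≈ₚ?_ (permutations n) (permutations-enumerates n) (λ p i → ≡.sym (p i)) f g adj w w-cong

    ∑-flip : ∑ (permutations n) (w ∘ flip) ≈ ∑ (permutations n) w
    ∑-flip = ∑-permutations flip flip λ π ρ → mk⇔
      (λ p → flip-cong {π = flip π} {ρ} p) (λ p → flip-cong {π = π} {flip ρ} p)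

    ∑-∘reverse : ∑ (permutations n) (λ π → w (π ∘ₚ reverse)) ≈ ∑ (permutations n) w
    ∑-∘reverse = ∑-permutations (_∘ₚ reverse) (_∘ₚ reverse) λ π ρ → mk⇔
      (λ p i → ≡.trans (≡.sym (Fin.opposite-involutive _)) (≡.cong opposite (p i)))
      (λ p i → ≡.trans (≡.cong opposite (p i)) (Fin.opposite-involutive _))

    ∑-reverseComplement : ∑ (permutations n) (w ∘ reverseComplement) ≈ ∑ (permutations n) w
    ∑-reverseComplement = ∑-permutations reverseComplement reverseComplement λ π ρ → mk⇔
      (reverseComplement-adjoint π ρ) (λ p i → ≡.sym (reverseComplement-adjoint ρ π (≡.sym ∘ p) i))

  ∑-words-∘ : (τ : Permutation n n) (w : (Fin n → Fin k) → Carrier) → (∀ {f g} → f ≗ g → w f ≈ w g) →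
              ∑ (words k n) (λ f → w (f ∘ (τ ⟨$⟩ʳ_))) ≈ ∑ (words k n) w
  ∑-words-∘ {n} {k} τ = ∑-reindex _≗?_ (words k n) (words-enumerates k n) (λ p i → ≡.sym (p i))
    (_∘ (τ ⟨$⟩ʳ_)) (_∘ (τ ⟨$⟩ˡ_)) λ f g → mk⇔
      (λ p i → ≡.trans (≡.cong f (≡.sym (inverseʳ τ))) (p (τ ⟨$⟩ˡ i)))
      (λ p i → ≡.trans (p (τ ⟨$⟩ʳ i)) (≡.cong g (inverseˡ τ)))

-- Standardisation of words

_⇔?_ : Dec P → Dec Q → Dec (P ⇔ Q)
P? ⇔? Q? = map′ (λ (f , g) → mk⇔ f g) (λ e → to e , from e) ((P? →-dec Q?) ×-dec (Q? →-dec P?))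

-- An up-closed set is a final segment. The threshold has n + 1 possible values, t = n standing for
-- the empty segment; these are the n + 1 possible first values of a permutation of length n + 1.
threshold : {U : Fin n → Set} → (∀ i → Dec (U i)) → (∀ {i j} → i Fin.< j → U i → U j) →
            ∃ λ (t : Fin (suc n)) → ∀ i → U i ⇔ t Fin.≤ i
threshold {zero}  U? up = zero , λ ()
threshold {suc n} {U} U? up with U? zero
... | yes u = zero , λ { zero → mk⇔ (λ _ → z≤n) (λ _ → u) ; (suc i) → mk⇔ (λ _ → z≤n) (λ _ → up (s≤s z≤n) u) }
... | no ¬u with threshold {n} {U ∘ suc} (U? ∘ suc) (up ∘ s≤s)
...   | t , p = suc t , λ { zero    → mk⇔ (λ u → contradiction u ¬u) λ ()
                          ; (suc i) → mk⇔ (s≤s ∘ to (p i)) (from (p i) ∘ ℕ.≤-pred) }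

threshold-unique : (s t : Fin (suc n)) → (∀ (i : Fin n) → s Fin.≤ i ⇔ t Fin.≤ i) → s ≡ t
threshold-unique {n} s t e = Fin.toℕ-injective (ℕ.≤-antisym (≤ s t λ i → from (e i)) (≤ t s λ i → to (e i)))
  where
  ≤ : (s t : Fin (suc n)) → (∀ (i : Fin n) → t Fin.≤ i → s Fin.≤ i) → s Fin.≤ t
  ≤ s t h with ℕ.<-cmp (toℕ t) n
  ... | tri< t<n _ _ = ≡.subst (toℕ s ℕ.≤_) (Fin.toℕ-fromℕ< t<n)
    (h (fromℕ< t<n) (ℕ.≤-reflexive (≡.sym (Fin.toℕ-fromℕ< t<n))))
  ... | tri≈ _ t≡n _ = ≡.subst (toℕ s ℕ.≤_) (≡.sym t≡n) (Fin.toℕ≤pred[n] s)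
  ... | tri> _ _ n<t = contradiction (Fin.toℕ≤pred[n] t) (ℕ.<⇒≱ n<t)

<-punchIn : (j : Fin (suc n)) (i : Fin n) → j Fin.< punchIn j i ⇔ j Fin.≤ i
<-punchIn zero    i       = mk⇔ (λ _ → z≤n) (λ _ → s≤s z≤n)
<-punchIn (suc j) zero    = mk⇔ (λ ()) (λ ())
<-punchIn (suc j) (suc i) = mk⇔ (λ { (s≤s p) → s≤s (to (<-punchIn j i) p) }) (λ { (s≤s p) → s≤s (from (<-punchIn j i) p) })

punchIn-mono-< : (j : Fin (suc n)) (p q : Fin n) → p Fin.< q ⇔ punchIn j p Fin.< punchIn j q
punchIn-mono-< zero    p       q       = mk⇔ s≤s ℕ.≤-pred
punchIn-mono-< (suc j) zero    zero    = mk⇔ (λ ()) (λ ())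
punchIn-mono-< (suc j) zero    (suc q) = mk⇔ (λ _ → s≤s z≤n) (λ _ → s≤s z≤n)
punchIn-mono-< (suc j) (suc p) zero    = mk⇔ (λ ()) (λ ())
punchIn-mono-< (suc j) (suc p) (suc q) = mk⇔
  (λ { (s≤s r) → s≤s (to (punchIn-mono-< j p q) r) }) (λ { (s≤s r) → s≤s (from (punchIn-mono-< j p q) r) })

⇔-trans : P ⇔ Q → Q ⇔ S → P ⇔ S
⇔-trans e f = mk⇔ (to f ∘ to e) (from e ∘ from f)

⇔-sym : P ⇔ Q → Q ⇔ P
⇔-sym e = mk⇔ (from e) (to e)

Below : Bool → Fin k → Fin k → Set
Below β a b = if β then b Fin.< a else b Fin.≤ a

-- The two instances are > and ≥.  In a word standardising to τ, consecutive values
-- of τ carry letters that differ strictly or weakly; `strict` says which.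
record Comparison (k : ℕ) : Set₁ where
  infix 4 _▷_ _▷?_
  field
    _▷_       : Rel (Fin k) 0ℓ
    _▷?_      : Decidable _▷_
    ▷-trans   : ∀ {a b c} → a ▷ b → b ▷ c → a ▷ c
    ▷-cotrans : ∀ {a c} → a ▷ c → ∀ b → a ▷ b ⊎ b ▷ c
    ▷-resp-≤  : ∀ {a b c} → a ▷ b → c Fin.≤ b → a ▷ c
    strict    : Bool → Bool
    step      : ∀ β a b → (if β then a ▷ b else ¬ (b ▷ a)) ⇔ Below (strict β) a b

module Standardisation (C : Comparison k) where
  open Comparison C

  -- τ ranks positions from the top: larger letters get smaller values, so the usual
  -- standardisation is the complement of τ.
  Standardises : (Fin n → Fin k) → (Fin n → Fin n) → Set
  Standardises w τ = ∀ p q → p Fin.< q → (w p ▷ w q) ⇔ (τ p Fin.< τ q)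

  standardises? : (w : Fin n → Fin k) (τ : Fin n → Fin n) → Dec (Standardises w τ)
  standardises? w τ = all? λ p → all? λ q → (p <? q) →-dec ((w p ▷? w q) ⇔? (τ p <? τ q))

  module _ (a : Fin k) (w : Fin n → Fin k) (τ : Permutation n n) where
    -- The condition on the value j given to a letter `a` put in front of w: the values of τ that
    -- `insert` pushes above j must be those of the letters b with a ▷ b.
    IsFirstLetter : Fin (suc n) → Set
    IsFirstLetter j = ∀ q → (a ▷ w q) ⇔ (j Fin.≤ (τ ⟨$⟩ʳ q))

    isFirstLetter? : ∀ j → Dec (IsFirstLetter j)
    isFirstLetter? j = all? λ q → (a ▷? w q) ⇔? (j Fin.≤? (τ ⟨$⟩ʳ q))

    standardises-insert : ∀ j → Standardises (a Vector.∷ w) (insert zero j τ ⟨$⟩ʳ_) ⇔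
                                (Standardises w (τ ⟨$⟩ʳ_) × IsFirstLetter j)
    standardises-insert j = mk⇔
      (λ s → (λ p q p<q → ⇔-trans (s (suc p) (suc q) (s≤s p<q)) (⇔-sym (punchIn-mono-< j _ _)))
           , λ q → ⇔-trans (s zero (suc q) (s≤s z≤n)) (<-punchIn j _))
      λ { (s , h) zero    (suc q) _         → ⇔-trans (h q) (⇔-sym (<-punchIn j _))
        ; (s , h) (suc p) (suc q) (s≤s p<q) → ⇔-trans (s p q p<q) (punchIn-mono-< j _ _) }

    -- Ranked by τ, the letters b with a ▷ b form a final segment; its beginning is the only
    -- admissible value.
    firstLetter : Standardises w (τ ⟨$⟩ʳ_) → ∃ λ j₀ → ∀ j → IsFirstLetter j ⇔ (j ≡ j₀)
    firstLetter s with threshold (λ i → a ▷? w (τ ⟨$⟩ˡ i)) up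
      where
      up : ∀ {i j} → i Fin.< j → a ▷ w (τ ⟨$⟩ˡ i) → a ▷ w (τ ⟨$⟩ˡ j)
      up {i} {j} i<j h with ℕ.<-cmp (toℕ (τ ⟨$⟩ˡ i)) (toℕ (τ ⟨$⟩ˡ j))
      ... | tri< p<q _ _ = ▷-trans h (from (s _ _ p<q) (≡.subst₂ Fin._<_ (≡.sym (inverseʳ τ)) (≡.sym (inverseʳ τ)) i<j))
      ... | tri≈ _ p≡q _ = ≡.subst (λ p → a ▷ w p) (Fin.toℕ-injective p≡q) h
      -- The other alternative, w (τ⁻¹ j) ▷ w (τ⁻¹ i), would give j < i because τ⁻¹ j is here the
      -- earlier position.
      ... | tri> _ _ q<p = [ (λ r → r) , (λ r → contradiction
          (≡.subst₂ Fin._<_ (inverseʳ τ) (inverseʳ τ) (to (s _ _ q<p) r)) (ℕ.<-asym i<j)) ]′ (▷-cotrans h (w (τ ⟨$⟩ˡ j)))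
    ... | j₀ , p = j₀ , λ j → mk⇔
      (λ h → threshold-unique j j₀ λ i → ⇔-trans
        (mk⇔ (λ r → from (h (τ ⟨$⟩ˡ i)) (≡.subst (j Fin.≤_) (≡.sym (inverseʳ τ)) r))
             (λ r → ≡.subst (j Fin.≤_) (inverseʳ τ) (to (h (τ ⟨$⟩ˡ i)) r)))
        (p i))
      λ { ≡.refl q → ⇔-trans
        (mk⇔ (≡.subst (λ r → a ▷ w r) (≡.sym (inverseˡ τ))) (≡.subst (λ r → a ▷ w r) (inverseˡ τ)))
        (p (τ ⟨$⟩ʳ q)) }

  module _ (R : CommutativeRing c ℓ) where
    open RingOps R hiding (zero)
    open Sums R
    open Relation.Binary.Reasoning.Setoid setoid

    -- The recursion of `permutations` matches the removal of the first letter: the inductive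
    -- hypothesis determines τ on the remaining word, and `firstLetter` then leaves a single value
    -- to insert.
    ∑-standardises : ∀ n (w : Fin n → Fin k) → ∑ (permutations n) (λ τ → ⟦ standardises? w (τ ⟨$⟩ʳ_) ⟧) ≈ 1#
    ∑-standardises zero    w = trans (+-identityʳ _) (⟦⟧-true (standardises? w (Perm.id ⟨$⟩ʳ_)) λ ())
    ∑-standardises (suc n) w = begin
      ∑ (permutations (suc n)) (λ τ → ⟦ standardises? w (τ ⟨$⟩ʳ_) ⟧)
        ≈⟨ ∑-product (insert zero) (allFin (suc n)) (permutations n) _ ⟩
      ∑ (allFin (suc n)) (λ j → ∑ (permutations n) λ τ → ⟦ standardises? w (insert zero j τ ⟨$⟩ʳ_) ⟧)
        ≈⟨ ∑-swap (allFin (suc n)) (permutations n) _ ⟩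
      ∑ (permutations n) (λ τ → ∑ (allFin (suc n)) λ j → ⟦ standardises? w (insert zero j τ ⟨$⟩ʳ_) ⟧)
        ≈⟨ ∑-cong (λ τ → trans (∑-cong (λ j → ⟦⟧-× (split τ j)
             (standardises? w (insert zero j τ ⟨$⟩ʳ_)) (S? τ) (isFirstLetter? (w zero) (w ∘ suc) τ j)) (allFin (suc n)))
             (∑-*ˡ ⟦ S? τ ⟧ (allFin (suc n)) _)) (permutations n) ⟩
      ∑ (permutations n) (λ τ → ⟦ S? τ ⟧ * ∑ (allFin (suc n)) λ j → ⟦ isFirstLetter? (w zero) (w ∘ suc) τ j ⟧)
        ≈⟨ ∑-cong (λ τ → trans (⟦⟧-guard (S? τ) (unique τ)) (*-identityʳ _)) (permutations n) ⟩
      ∑ (permutations n) (λ τ → ⟦ S? τ ⟧)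
        ≈⟨ ∑-standardises n (w ∘ suc) ⟩
      1# ∎
      where
      S? : (τ : Permutation n n) → Dec (Standardises (w ∘ suc) (τ ⟨$⟩ʳ_))
      S? τ = standardises? (w ∘ suc) (τ ⟨$⟩ʳ_)
      split : ∀ τ j → Standardises w (insert zero j τ ⟨$⟩ʳ_) ⇔
                      (Standardises (w ∘ suc) (τ ⟨$⟩ʳ_) × IsFirstLetter (w zero) (w ∘ suc) τ j)
      split τ j = ⇔-trans
        (mk⇔ (λ s p q p<q → ≡.subst₂ (λ a b → (a ▷ b) ⇔ _) (≗-∷ p) (≗-∷ q) (s p q p<q))
             (λ s p q p<q → ≡.subst₂ (λ a b → (a ▷ b) ⇔ _) (≡.sym (≗-∷ p)) (≡.sym (≗-∷ q)) (s p q p<q)))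
        (standardises-insert (w zero) (w ∘ suc) τ j)
        where
        ≗-∷ : w ≗ (w zero Vector.∷ (w ∘ suc))
        ≗-∷ zero    = ≡.refl
        ≗-∷ (suc i) = ≡.refl
      unique : ∀ τ → Standardises (w ∘ suc) (τ ⟨$⟩ʳ_) →
               ∑ (allFin (suc n)) (λ j → ⟦ isFirstLetter? (w zero) (w ∘ suc) τ j ⟧) ≈ 1#
      unique τ s with firstLetter (w zero) (w ∘ suc) τ s
      ... | j₀ , e = trans (∑-cong (λ j → ⟦⟧-⇔ (e j) (isFirstLetter? (w zero) (w ∘ suc) τ j) (j Fin.≟ j₀))
        (allFin (suc n))) (allFin-enumerates (suc n) j₀)

-- Monotone sequences

adjacent⇒all : (Q : Rel (Fin (suc n)) 0ℓ) → (∀ {r s t} → Q r s → Q s t → Q r t) →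
               (∀ i → Q (inject₁ i) (suc i)) → ∀ r s → r Fin.< s → Q r s
adjacent⇒all {suc n} Q Q-trans adj zero    (suc zero)    _         = adj zero
adjacent⇒all {suc n} Q Q-trans adj zero    (suc (suc s)) _         = Q-trans (adj zero)
  (adjacent⇒all (λ r s → Q (suc r) (suc s)) Q-trans (adj ∘ suc) zero (suc s) (s≤s z≤n))
adjacent⇒all {suc n} Q Q-trans adj (suc r) (suc s)       (s≤s r<s) =
  adjacent⇒all (λ r s → Q (suc r) (suc s)) Q-trans (adj ∘ suc) r s r<s
adjacent⇒all {zero}  Q Q-trans adj zero    zero          ()

below? : ∀ β (a b : Fin k) → Dec (Below β a b)
below? true  a b = b Fin.<? a
below? false a b = b Fin.≤? a

below⇒≤ : ∀ β {a b : Fin k} → Below β a b → b Fin.≤ a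
below⇒≤ true  = ℕ.<⇒≤
below⇒≤ false = λ b≤a → b≤a

-- The shape of the letters of a word listed in increasing order of their τ-values: a weakly
-- decreasing sequence whose drops must be strict where β says so.
Chain : (Fin n → Bool) → (Fin (suc n) → Fin k) → Set
Chain β c = ∀ i → Below (β i) (c (inject₁ i)) (c (suc i))

chain? : (β : Fin n → Bool) (c : Fin (suc n) → Fin k) → Dec (Chain β c)
chain? β c = all? λ i → below? (β i) (c (inject₁ i)) (c (suc i))

chain⇒≤head : (β : Fin n → Bool) (c : Fin (suc n) → Fin k) → Chain β c → ∀ r → c r Fin.≤ c zero
chain⇒≤head β c h zero    = ℕ.≤-refl
chain⇒≤head β c h (suc r) = adjacent⇒all (λ r s → c s Fin.≤ c r) (λ p q → ℕ.≤-trans q p)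
  (λ i → below⇒≤ (β i) (h i)) zero (suc r) (s≤s z≤n)

chain-∷ : (β : Fin (suc n) → Bool) (a : Fin k) (c : Fin (suc n) → Fin k) →
          Chain β (a Vector.∷ c) ⇔ (Below (β zero) a (c zero) × Chain (β ∘ suc) c)
chain-∷ β a c = mk⇔ (λ h → h zero , h ∘ suc) λ { (p , h) zero → p ; (p , h) (suc i) → h i }

inverseAscents : Permutation (suc n) (suc n) → Fin n → Bool
inverseAscents τ i = does ((τ ⟨$⟩ˡ inject₁ i) <? (τ ⟨$⟩ˡ suc i))

module _ (C : Comparison k) where
  open Comparison C
  open Standardisation C

  module _ (g : Fin (suc n) → Fin (suc n)) (g-injective : ∀ {r s} → g r ≡ g s → r ≡ s)
           (c : Fin (suc n) → Fin k) where
    -- The order of (letter, position) pairs is lexicographic, with ties between equal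
    -- letters broken by position in the direction that ▷ prescribes; hence transitive.
    Sorted : Rel (Fin (suc n)) 0ℓ
    Sorted r s = (g r Fin.< g s → c r ▷ c s) × (g s Fin.< g r → ¬ (c s ▷ c r))

    sorted-trans : ∀ {r s t} → Sorted r s → Sorted s t → Sorted r t
    sorted-trans {r} {s} {t} (rs , ¬sr) (st , ¬ts) = forward , backward
      where
      forward : g r Fin.< g t → c r ▷ c t
      forward r<t with Fin.<-cmp (g r) (g s) | Fin.<-cmp (g s) (g t)
      ... | tri< r<s _ _ | tri< s<t _ _ = ▷-trans (rs r<s) (st s<t)
      ... | tri< r<s _ _ | tri≈ _ s≡t _ = ≡.subst (λ t → c r ▷ c t) (g-injective s≡t) (rs r<s)
      ... | tri< r<s _ _ | tri> _ _ t<s = [ (λ p → p) , (λ p → contradiction p (¬ts t<s)) ]′ (▷-cotrans (rs r<s) (c t))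
      ... | tri≈ _ r≡s _ | _            = ≡.subst (λ r → c r ▷ c t) (≡.sym (g-injective r≡s))
                                            (st (≡.subst (Fin._< g t) r≡s r<t))
      ... | tri> _ _ s<r | _            = [ (λ p → contradiction p (¬sr s<r)) , (λ p → p) ]′
                                            (▷-cotrans (st (ℕ.<-trans s<r r<t)) (c r))
      backward : g t Fin.< g r → ¬ (c t ▷ c r)
      backward t<r p with Fin.<-cmp (g r) (g s) | Fin.<-cmp (g s) (g t)
      ... | tri< r<s _ _ | _            = ¬ts (ℕ.<-trans t<r r<s) (▷-trans p (rs r<s))
      ... | tri≈ _ r≡s _ | _            = ¬ts (≡.subst (g t Fin.<_) r≡s t<r) (≡.subst (λ r → c t ▷ c r) (g-injective r≡s) p)
      ... | tri> _ _ s<r | tri< s<t _ _ = ¬sr s<r (▷-trans (st s<t) p)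
      ... | tri> _ _ s<r | tri≈ _ s≡t _ = ¬sr s<r (≡.subst (λ t → c t ▷ c r) (≡.sym (g-injective s≡t)) p)
      ... | tri> _ _ s<r | tri> _ _ t<s = [ ¬ts t<s , ¬sr s<r ]′ (▷-cotrans p (c s))

  module _ (τ : Permutation (suc n) (suc n)) (c : Fin (suc n) → Fin k) where
    private
      g : Fin (suc n) → Fin (suc n)
      g = τ ⟨$⟩ˡ_

      g-injective : ∀ {r s} → g r ≡ g s → r ≡ s
      g-injective {r} {s} p = ≡.trans (≡.sym (inverseʳ τ)) (≡.trans (≡.cong (τ ⟨$⟩ʳ_) p) (inverseʳ τ))

      Sorted′ : Rel (Fin (suc n)) 0ℓ
      Sorted′ = Sorted g g-injective c

      standardises⇒sorted : Standardises (c ∘ (τ ⟨$⟩ʳ_)) (τ ⟨$⟩ʳ_) → ∀ r s → r Fin.< s → Sorted′ r s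
      standardises⇒sorted h r s r<s =
          (λ p → ≡.subst₂ (λ i j → c i ▷ c j) (inverseʳ τ) (inverseʳ τ)
            (from (h (g r) (g s) p) (≡.subst₂ Fin._<_ (≡.sym (inverseʳ τ)) (≡.sym (inverseʳ τ)) r<s)))
        , (λ p q → ℕ.<-asym r<s (≡.subst₂ Fin._<_ (inverseʳ τ) (inverseʳ τ)
            (to (h (g s) (g r) p) (≡.subst₂ (λ i j → c i ▷ c j) (≡.sym (inverseʳ τ)) (≡.sym (inverseʳ τ)) q))))

      sorted⇒standardises : (∀ r s → r Fin.< s → Sorted′ r s) → Standardises (c ∘ (τ ⟨$⟩ʳ_)) (τ ⟨$⟩ʳ_)
      sorted⇒standardises h p q p<q = mk⇔ ⇒ λ τp<τq → proj₁ (h _ _ τp<τq) g<g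
        where
        g<g : g (τ ⟨$⟩ʳ p) Fin.< g (τ ⟨$⟩ʳ q)
        g<g = ≡.subst₂ Fin._<_ (≡.sym (inverseˡ τ)) (≡.sym (inverseˡ τ)) p<q
        ⇒ : c (τ ⟨$⟩ʳ p) ▷ c (τ ⟨$⟩ʳ q) → (τ ⟨$⟩ʳ p) Fin.< (τ ⟨$⟩ʳ q)
        ⇒ d with Fin.<-cmp (τ ⟨$⟩ʳ p) (τ ⟨$⟩ʳ q)
        ... | tri< r _ _ = r
        ... | tri≈ _ r _ = contradiction (≡.cong (toℕ ∘ g) r) (ℕ.<⇒≢ g<g)
        ... | tri> _ _ r = contradiction d (proj₂ (h _ _ r) g<g)

      sorted⇔below : ∀ i → Sorted′ (inject₁ i) (suc i) ⇔
                           Below (strict (inverseAscents τ i)) (c (inject₁ i)) (c (suc i))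
      sorted⇔below i = ⇔-trans (go (g (inject₁ i) <? g (suc i))) (step (inverseAscents τ i) _ _)
        where
        go : (d : Dec (g (inject₁ i) Fin.< g (suc i))) →
             Sorted′ (inject₁ i) (suc i) ⇔ (if does d then c (inject₁ i) ▷ c (suc i) else ¬ (c (suc i) ▷ c (inject₁ i)))
        go (yes p) = mk⇔ (λ s → proj₁ s p) (λ q → (λ _ → q) , (λ r → contradiction p (ℕ.<-asym r)))
        go (no ¬p) = mk⇔ (λ s → proj₂ s (≢∧≮⇒>
            (λ e → ℕ.<⇒≢ (inject₁<suc i) (≡.cong toℕ (g-injective e))) ¬p))
          (λ q → (λ p → contradiction p ¬p) , λ _ → q)

    -- By transitivity `Sorted` need only be checked for consecutive values of τ, and there `step`
    -- turns it into a weak or strict drop. Thus a word with standardisation τ is a chain read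
    -- through τ.
    standardises⇔chain : Standardises (c ∘ (τ ⟨$⟩ʳ_)) (τ ⟨$⟩ʳ_) ⇔ Chain (strict ∘ inverseAscents τ) c
    standardises⇔chain = mk⇔
      (λ h i → to (sorted⇔below i) (standardises⇒sorted h _ _ (inject₁<suc i)))
      (λ h → sorted⇒standardises (adjacent⇒all Sorted′
        (λ {r} {s} {t} → sorted-trans g g-injective c {r} {s} {t}) λ i → from (sorted⇔below i) (h i)))

module ChainCount (R : CommutativeRing c ℓ) where
  open RingOps R hiding (zero)
  open Sums R
  open Algebra.Properties.Semiring.Sum semiring using (sum; sum-cong-≋)
  open Relation.Binary.Reasoning.Setoid setoid
  open Series R using (X; _*ₛ_; *ₛ-cong; X-*ₛ)
  open Series R using (module S)
  private
    module SS = Solver S.commutativeSemiring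
  open Algebra.Properties.Semiring.Exp S.semiring using (^-homo-*)
  open Solver commutativeSemiring using (solve; _:*_; _:=_)

  -- The series 1 / (1 - X).
  J : ℕ → Carrier
  J _ = 1#

  *J : ∀ f n → (f *ₛ J) n ≈ sum {suc n} (f ∘ toℕ)
  *J f n = sum-cong-≋ {suc n} λ i → *-identityʳ (f (toℕ i))

  J-inverse : (S.1# S.- X) S.* J S.≈ S.1#
  J-inverse n = trans (S.distribʳ J S.1# (S.- X) n) (trans
    (+-cong (S.*-identityˡ J n) (sym (Algebra.Properties.Ring.-‿distribˡ-* S.ring X J n))) (go n))
    where
    go : ∀ n → 1# - (X S.* J) n ≈ S.1# n
    go zero    = trans (+-congˡ (-‿cong (trans (Series.*ₛ-head R X J) (zeroˡ 1#)))) (a-0≈a 1#)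
    go (suc n) = trans (+-congˡ (-‿cong (X-*ₛ J n))) (-‿inverseʳ 1#)

  ∑-upTo : ∀ {j} → j ℕ.≤ k → (f : ℕ → Carrier) →
           ∑ (allFin k) (λ b → ⟦ toℕ b ℕ.<? j ⟧ * f (toℕ b)) ≈ sum {j} (f ∘ toℕ)
  ∑-upTo {k} j≤k f = trans (reflexive (∑-allFin {k} _)) (go j≤k f)
    where
    go : ∀ {j k} → j ℕ.≤ k → (f : ℕ → Carrier) → sum {k} (λ b → ⟦ toℕ b ℕ.<? j ⟧ * f (toℕ b)) ≈ sum {j} (f ∘ toℕ)
    go {zero} {k} z≤n f = Series.sum-zero R {k} _ λ b → zeroˡ _
    go (s≤s p) f = +-cong (*-identityˡ _) (go p (f ∘ suc))

  -- Partial sums are the coefficients of f / (1 - X); excluding the last term costs one more factor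
  -- X.
  ∑-below : ∀ β (f : ℕ → Carrier) (a : Fin k) →
            ∑ (allFin k) (λ b → ⟦ below? β a b ⟧ * f (toℕ b)) ≈ (X S.^ bit β S.* (f S.* J)) (toℕ a)
  ∑-below {k} false f a = begin
    ∑ (allFin k) (λ b → ⟦ b Fin.≤? a ⟧ * f (toℕ b))
      ≈⟨ ∑-cong (λ b → *-congʳ (⟦⟧-⇔ (mk⇔ s≤s ℕ.≤-pred) (b Fin.≤? a) (toℕ b ℕ.<? suc (toℕ a)))) (allFin k) ⟩
    ∑ (allFin k) (λ b → ⟦ toℕ b ℕ.<? suc (toℕ a) ⟧ * f (toℕ b))
      ≈⟨ ∑-upTo (Fin.toℕ<n a) f ⟩
    sum {suc (toℕ a)} (f ∘ toℕ)  ≈⟨ *J f (toℕ a) ⟨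
    (f *ₛ J) (toℕ a)             ≈⟨ S.*-identityˡ (f S.* J) (toℕ a) ⟨
    (S.1# S.* (f S.* J)) (toℕ a) ∎
  ∑-below {k} true f a = trans (∑-upTo (ℕ.<⇒≤ (Fin.toℕ<n a)) f) (trans (go (toℕ a))
    (*ₛ-cong {X} {X S.^ 1} {f S.* J} {f S.* J} (S.sym {X S.^ 1} {X} (S.*-identityʳ X)) (λ _ → refl) (toℕ a)))
    where
    go : ∀ n → sum {n} (f ∘ toℕ) ≈ (X S.* (f S.* J)) n
    go zero    = sym (trans (Series.*ₛ-head R X (f S.* J)) (zeroˡ _))
    go (suc n) = trans (sym (*J f n)) (sym (X-*ₛ (f S.* J) n))

  -- The series X^b / (1 - X)ⁿ⁺¹ with b the number of strict places. The n drops and the last letter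
  -- add up to the first letter; after removal of the b forced units they are n + 1 free nonnegative
  -- integers.
  chainSeries : (Fin n → Bool) → ℕ → Carrier
  chainSeries {n} β = X S.^ # β S.* J S.^ suc n

  ∑-chain : (β : Fin n → Bool) (a : Fin k) →
            ∑ (words k (suc n)) (λ c → ⟦ c zero Fin.≟ a ⟧ * ⟦ chain? β c ⟧) ≈ chainSeries β (toℕ a)
  ∑-chain {zero} {k} β a = begin
    ∑ (words k 1) (λ c → ⟦ c zero Fin.≟ a ⟧ * ⟦ chain? β c ⟧)
      ≈⟨ ∑-product Vector._∷_ (allFin k) (words k 0) _ ⟩
    ∑ (allFin k) (λ b → ⟦ b Fin.≟ a ⟧ * ⟦ chain? β (b Vector.∷ (λ ())) ⟧ + 0#)
      ≈⟨ ∑-cong (λ b → trans (+-identityʳ _) (trans (*-congˡ (⟦⟧-true (chain? β (b Vector.∷ (λ ()))) λ ()))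
           (*-identityʳ _))) (allFin k) ⟩
    ∑ (allFin k) (λ b → ⟦ b Fin.≟ a ⟧)
      ≈⟨ allFin-enumerates k a ⟩
    1#
      ≈⟨ trans (S.*-identityˡ (J S.^ 1) (toℕ a)) (S.*-identityʳ J (toℕ a)) ⟨
    (X S.^ 0 S.* J S.^ 1) (toℕ a) ∎
  ∑-chain {suc n} {k} β a = begin
    ∑ (words k (suc (suc n))) (λ c → ⟦ c zero Fin.≟ a ⟧ * ⟦ chain? β c ⟧)
      ≈⟨ ∑-product Vector._∷_ (allFin k) (words k (suc n)) _ ⟩
    ∑ (allFin k) (λ b → ∑ (words k (suc n)) λ c → ⟦ b Fin.≟ a ⟧ * ⟦ chain? β (b Vector.∷ c) ⟧)
      ≈⟨ ∑-swap (allFin k) (words k (suc n)) _ ⟩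
    ∑ (words k (suc n)) (λ c → ∑ (allFin k) λ b → ⟦ b Fin.≟ a ⟧ * ⟦ chain? β (b Vector.∷ c) ⟧)
      ≈⟨ ∑-cong (λ c → ∑-pick Fin._≟_ (allFin k) (allFin-enumerates k) (λ b → ⟦ chain? β (b Vector.∷ c) ⟧) a
           λ { ≡.refl → refl }) (words k (suc n)) ⟩
    ∑ (words k (suc n)) (λ c → ⟦ chain? β (a Vector.∷ c) ⟧)
      ≈⟨ ∑-cong (λ c → ⟦⟧-× (chain-∷ β a c) (chain? β (a Vector.∷ c)) (below? (β zero) a (c zero)) (chain? (β ∘ suc) c))
           (words k (suc n)) ⟩
    ∑ (words k (suc n)) (λ c → ⟦ below? (β zero) a (c zero) ⟧ * ⟦ chain? (β ∘ suc) c ⟧)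
      -- The chains are regrouped by their second letter b, so that the inductive hypothesis applies
      -- to the chains starting at b.
      ≈⟨ ∑-cong (λ c → ∑-pick Fin._≟_ (allFin k) (allFin-enumerates k)
           (λ b → ⟦ below? (β zero) a b ⟧ * ⟦ chain? (β ∘ suc) c ⟧) (c zero) λ { ≡.refl → refl }) (words k (suc n)) ⟨
    ∑ (words k (suc n)) (λ c → ∑ (allFin k) λ b → ⟦ b Fin.≟ c zero ⟧ * (⟦ below? (β zero) a b ⟧ * ⟦ chain? (β ∘ suc) c ⟧))
      ≈⟨ ∑-swap (words k (suc n)) (allFin k) _ ⟩
    ∑ (allFin k) (λ b → ∑ (words k (suc n)) λ c → ⟦ b Fin.≟ c zero ⟧ * (⟦ below? (β zero) a b ⟧ * ⟦ chain? (β ∘ suc) c ⟧))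
      ≈⟨ ∑-cong (λ b → trans (∑-cong (λ c → trans
           (*-congʳ (⟦⟧-⇔ (mk⇔ ≡.sym ≡.sym) (b Fin.≟ c zero) (c zero Fin.≟ b)))
           (solve 3 (λ p q r → p :* (q :* r) := q :* (p :* r)) refl _ _ _)) (words k (suc n)))
           (∑-*ˡ _ (words k (suc n)) _)) (allFin k) ⟩
    ∑ (allFin k) (λ b → ⟦ below? (β zero) a b ⟧ * ∑ (words k (suc n)) λ c → ⟦ c zero Fin.≟ b ⟧ * ⟦ chain? (β ∘ suc) c ⟧)
      ≈⟨ ∑-cong (λ b → *-congˡ (∑-chain (β ∘ suc) b)) (allFin k) ⟩
    ∑ (allFin k) (λ b → ⟦ below? (β zero) a b ⟧ * chainSeries (β ∘ suc) (toℕ b))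
      ≈⟨ ∑-below (β zero) (chainSeries (β ∘ suc)) a ⟩
    (X S.^ bit (β zero) S.* (chainSeries (β ∘ suc) S.* J)) (toℕ a)
      ≈⟨ regroup (toℕ a) ⟩
    chainSeries β (toℕ a) ∎
    where
    regroup : X S.^ bit (β zero) S.* (chainSeries (β ∘ suc) S.* J) S.≈ chainSeries β
    regroup = S.trans
      (SS.solve 4 (λ p q r j → p SS.:* (q SS.:* r SS.:* j) SS.:= (p SS.:* q) SS.:* (j SS.:* r)) (λ _ → refl)
        (X S.^ bit (β zero)) (X S.^ # (β ∘ suc)) (J S.^ suc n) J)
      (S.*-congʳ {J S.^ suc (suc n)} (S.sym {X S.^ # β} (^-homo-* X (bit (β zero)) (# (β ∘ suc)))))

-- Words by first and largest letter

module Top (k : ℕ) where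
  open Algebra.Construct.NaturalChoice.Max (Fin.≤-totalOrder k) public

  top : (Fin (suc n) → Fin k) → Fin k
  top {zero}  w = w zero
  top {suc n} w = w zero ⊔ top (w ∘ suc)

  ≤top : (w : Fin (suc n) → Fin k) → ∀ i → w i Fin.≤ top w
  ≤top {zero}  w zero    = ℕ.≤-refl
  ≤top {suc n} w zero    = x≤x⊔y (w zero) (top (w ∘ suc))
  ≤top {suc n} w (suc i) = ℕ.≤-trans (≤top (w ∘ suc) i) (x≤y⊔x (w zero) (top (w ∘ suc)))

  top-attained : (w : Fin (suc n) → Fin k) → ∃ λ i → top w ≡ w i
  top-attained {zero}  w = zero , ≡.refl
  top-attained {suc n} w with ⊔-sel (w zero) (top (w ∘ suc)) | top-attained (w ∘ suc)
  ... | inj₁ p | _     = zero , p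
  ... | inj₂ p | i , q = suc i , ≡.trans p q

  top-≗ : {f g : Fin (suc n) → Fin k} → f ≗ g → top f ≡ top g
  top-≗ {zero}  p = p zero
  top-≗ {suc n} p = ≡.cong₂ _⊔_ (p zero) (top-≗ (p ∘ suc))

  top-chain : (β : Fin n → Bool) (c : Fin (suc n) → Fin k) (τ : Permutation (suc n) (suc n)) →
              Chain β c → top (c ∘ (τ ⟨$⟩ʳ_)) ≡ c zero
  top-chain β c τ h with top-attained (c ∘ (τ ⟨$⟩ʳ_))
  ... | i , p = Fin.≤-antisym
    (≡.subst (Fin._≤ c zero) (≡.sym p) (chain⇒≤head β c h (τ ⟨$⟩ʳ i)))
    (≡.subst (λ j → c j Fin.≤ top (c ∘ (τ ⟨$⟩ʳ_))) (inverseʳ τ) (≤top (c ∘ (τ ⟨$⟩ʳ_)) (τ ⟨$⟩ˡ zero)))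

-- Word sums as sums over standardisations

module WordSums (R : CommutativeRing c ℓ) (x v : CommutativeRing.Carrier R) {k : ℕ} (C : Comparison k) where
  open RingOps R hiding (zero)
  open Sums R
  open ChainCount R
  open Relation.Binary.Reasoning.Setoid setoid
  open Solver commutativeSemiring using (solve; _:*_; _:=_)
  open Comparison C
  open Standardisation C
  open Top k

  weight : {R : Rel A 0ℓ} (R? : Decidable R) → (Fin n → A) → Carrier
  weight R? f = x ^ adjacent R? f * v ^ rightRecords R? f

  weight-cong : {R : Rel A 0ℓ} (R? : Decidable R) {S : Rel B 0ℓ} (S? : Decidable S)
                {f : Fin n → A} {g : Fin n → B} →
                (∀ p q → p Fin.< q → R (f p) (f q) ⇔ S (g p) (g q)) → weight R? f ≈ weight S? g
  weight-cong R? S? iso = reflexive (≡.cong₂ (λ i j → x ^ i * v ^ j)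
    (adjacent-cong R? S? iso) (rightRecords-cong R? S? iso))

  maximumSum : ℕ → Fin k → Carrier
  maximumSum n m = ∑ (words k (suc n)) λ w → ⟦ top w Fin.≟ m ⟧ * weight _▷?_ w

  -- Words are grouped by their standardisation τ. The weight is constant on a group, since ▷ on the
  -- letters corresponds to < on the values of τ. The words of a group are the chains composed with
  -- τ, and a chain starts with its largest letter.
  maximumSum≈∑-permutations : ∀ n m → maximumSum n m ≈
    ∑ (permutations (suc n)) λ τ → weight (less? (suc n)) (τ ⟨$⟩ʳ_) * chainSeries (strict ∘ inverseAscents τ) (toℕ m)
  maximumSum≈∑-permutations n m = begin
    ∑ ws (λ w → ⟦ top w Fin.≟ m ⟧ * weight _▷?_ w)
      ≈⟨ ∑-cong (λ w → trans (sym (*-identityˡ _)) (trans (*-congʳ (sym (∑-standardises R (suc n) w)))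
           (sym (∑-*ʳ _ (permutations (suc n)) _)))) ws ⟩
    ∑ ws (λ w → ∑ (permutations (suc n)) λ τ → ⟦ standardises? w (τ ⟨$⟩ʳ_) ⟧ * (⟦ top w Fin.≟ m ⟧ * weight _▷?_ w))
      ≈⟨ ∑-swap ws (permutations (suc n)) _ ⟩
    ∑ (permutations (suc n)) (λ τ → ∑ ws λ w → ⟦ standardises? w (τ ⟨$⟩ʳ_) ⟧ * (⟦ top w Fin.≟ m ⟧ * weight _▷?_ w))
      ≈⟨ ∑-cong (λ τ → trans (∑-cong (λ w → pull τ w) ws) (∑-*ˡ _ ws _)) (permutations (suc n)) ⟩
    ∑ (permutations (suc n)) (λ τ → weight (less? (suc n)) (τ ⟨$⟩ʳ_) * ∑ ws (count τ))
      ≈⟨ ∑-cong (λ τ → *-congˡ (trans (sym (∑-words-∘ {suc n} {k} τ (count τ) (count-cong τ)))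
           (trans (∑-cong (reparametrise τ) ws) (∑-chain (strict ∘ inverseAscents τ) m)))) (permutations (suc n)) ⟩
    ∑ (permutations (suc n)) (λ τ → weight (less? (suc n)) (τ ⟨$⟩ʳ_) * chainSeries (strict ∘ inverseAscents τ) (toℕ m)) ∎
    where
    ws : List (Fin (suc n) → Fin k)
    ws = words k (suc n)

    count : Permutation (suc n) (suc n) → (Fin (suc n) → Fin k) → Carrier
    count τ w = ⟦ standardises? w (τ ⟨$⟩ʳ_) ⟧ * ⟦ top w Fin.≟ m ⟧

    pull : ∀ τ w → ⟦ standardises? w (τ ⟨$⟩ʳ_) ⟧ * (⟦ top w Fin.≟ m ⟧ * weight _▷?_ w) ≈
                   weight (less? (suc n)) (τ ⟨$⟩ʳ_) * count τ w
    pull τ w = trans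
      (⟦⟧-guard (standardises? w (τ ⟨$⟩ʳ_)) λ s → *-congˡ (weight-cong _▷?_ (less? (suc n)) {w} {τ ⟨$⟩ʳ_} s))
      (solve 3 (λ s t y → s :* (t :* y) := y :* (s :* t)) refl _ _ _)

    count-cong : ∀ τ {f g} → f ≗ g → count τ f ≈ count τ g
    count-cong τ {f} {g} p = *-cong
      (⟦⟧-⇔ (mk⇔ (λ s i j i<j → ≡.subst₂ (λ a b → (a ▷ b) ⇔ _) (p i) (p j) (s i j i<j))
                 (λ s i j i<j → ≡.subst₂ (λ a b → (a ▷ b) ⇔ _) (≡.sym (p i)) (≡.sym (p j)) (s i j i<j)))
        (standardises? f (τ ⟨$⟩ʳ_)) (standardises? g (τ ⟨$⟩ʳ_)))
      (reflexive (≡.cong (λ a → ⟦ a Fin.≟ m ⟧) (top-≗ p)))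

    reparametrise : ∀ τ c → count τ (c ∘ (τ ⟨$⟩ʳ_)) ≈ ⟦ c zero Fin.≟ m ⟧ * ⟦ chain? (strict ∘ inverseAscents τ) c ⟧
    reparametrise τ c = trans
      (*-congʳ (⟦⟧-⇔ (standardises⇔chain C τ c) (standardises? (c ∘ (τ ⟨$⟩ʳ_)) (τ ⟨$⟩ʳ_)) (chain? (strict ∘ inverseAscents τ) c)))
      (trans (⟦⟧-guard (chain? (strict ∘ inverseAscents τ) c) λ h →
        reflexive (≡.cong (λ a → ⟦ a Fin.≟ m ⟧) (top-chain (strict ∘ inverseAscents τ) c τ h))) (*-comm _ _))

-- Under > equal letters are ranked from right to left, under ≥ from left to right. A tie between
-- consecutive ranks is therefore excluded at the ascents of τ⁻¹ in the first case and at its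
-- descents in the second, whence `not`.
strictly weakly : ∀ k → Comparison k
strictly k = record
  { _▷_       = Fin._>_
  ; _▷?_      = greater? k
  ; ▷-trans   = λ p q → ℕ.<-trans q p
  ; ▷-cotrans = λ {a} {c} p b → [ (λ q → inj₁ q) , (λ q → inj₂ (ℕ.<-≤-trans p q)) ]′ (ℕ.<-≤-connex (toℕ b) (toℕ a))
  ; ▷-resp-≤  = λ p q → ℕ.≤-<-trans q p
  ; strict    = λ β → β
  ; step      = λ { true  a b → mk⇔ (λ p → p) (λ p → p)
                  ; false a b → mk⇔ ℕ.≮⇒≥ ℕ.≤⇒≯ }
  }
weakly k = record
  { _▷_       = Fin._≥_
  ; _▷?_      = λ a b → b Fin.≤? a
  ; ▷-trans   = λ p q → ℕ.≤-trans q p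
  ; ▷-cotrans = λ {a} {c} p b → [ inj₁ , (λ q → inj₂ (ℕ.≤-trans p q)) ]′ (ℕ.≤-total (toℕ b) (toℕ a))
  ; ▷-resp-≤  = λ p q → ℕ.≤-trans q p
  ; strict    = not
  ; step      = λ { true  a b → mk⇔ (λ p → p) (λ p → p)
                  ; false a b → mk⇔ ℕ.≰⇒> ℕ.<⇒≱ }
  }

-- Recurrences in the first letter

module Indicators (R : CommutativeRing c ℓ) where
  open RingOps R hiding (zero)
  open Sums R

  ⟦<suc⟧ : (a b : Fin k) → ⟦ toℕ b ℕ.<? suc (toℕ a) ⟧ ≈ ⟦ toℕ b ℕ.<? toℕ a ⟧ + ⟦ b Fin.≟ a ⟧
  ⟦<suc⟧ a b with Fin.<-cmp b a
  ... | tri< b<a b≢a _ = trans (⟦⟧-true (toℕ b ℕ.<? suc (toℕ a)) (ℕ.m≤n⇒m≤1+n b<a))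
    (sym (trans (+-cong (⟦⟧-true (toℕ b ℕ.<? toℕ a) b<a) (⟦⟧-false (b Fin.≟ a) b≢a)) (+-identityʳ 1#)))
  ... | tri≈ b≮a b≡a _ = trans (⟦⟧-true (toℕ b ℕ.<? suc (toℕ a)) (s≤s (ℕ.≤-reflexive (≡.cong toℕ b≡a))))
    (sym (trans (+-cong (⟦⟧-false (toℕ b ℕ.<? toℕ a) b≮a) (⟦⟧-true (b Fin.≟ a) b≡a)) (+-identityˡ 1#)))
  ... | tri> _ b≢a a<b = trans (⟦⟧-false (toℕ b ℕ.<? suc (toℕ a)) (ℕ.<⇒≱ a<b ∘ ℕ.≤-pred))
    (sym (trans (+-cong (⟦⟧-false (toℕ b ℕ.<? toℕ a) (ℕ.<-asym a<b)) (⟦⟧-false (b Fin.≟ a) b≢a)) (+-identityˡ 0#)))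

  ⟦⟧-absorb : P ⇔ Q → (P? : Dec P) (Q? : Dec Q) → (d : Carrier) → ⟦ P? ⟧ * d ≈ ⟦ Q? ⟧ * d
  ⟦⟧-absorb e P? Q? d = *-congʳ (⟦⟧-⇔ e P? Q?)

  ^bit-true : ∀ a (P? : Dec P) → P → a ^ bit (does P?) ≈ a
  ^bit-true a P? p rewrite dec-true P? p = *-identityʳ a

  ^bit-false : ∀ a (P? : Dec P) → ¬ P → a ^ bit (does P?) ≈ 1#
  ^bit-false a P? p rewrite dec-false P? p = refl

  ^bit-complement : ∀ {a b} → a + b ≈ 1# → (P? : Dec P) → a ^ bit (does P?) + b * ⟦ P? ⟧ ≈ 1#
  ^bit-complement a+b≈1 (yes _) = trans (+-cong (*-identityʳ _) (*-identityʳ _)) a+b≈1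
  ^bit-complement a+b≈1 (no _)  = trans (+-congˡ (zeroʳ _)) (+-identityʳ 1#)

module Recurrences (R : CommutativeRing c ℓ) (x v : CommutativeRing.Carrier R) {k : ℕ} (C : Comparison k) where
  open RingOps R hiding (zero)
  open Sums R
  open Indicators R
  open WordSums R x v C public
  open Relation.Binary.Reasoning.Setoid setoid
  open Solver commutativeSemiring using (solve; _:+_; _:*_; _:=_)
  open Comparison C
  open Top k
  open Algebra.Properties.Semiring.Exp semiring using (^-homo-*)

  belowSum : ℕ → ℕ → Carrier
  belowSum n j = ∑ (words k (suc n)) λ z → ⟦ toℕ (top z) ℕ.<? j ⟧ * weight _▷?_ z

  belowSum-zero : ∀ n → belowSum n 0 ≈ 0#
  belowSum-zero n = trans (∑-cong (λ z → zeroˡ _) (words k (suc n))) (∑-0 (words k (suc n)))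

  belowSum-suc : ∀ n m → belowSum n (suc (toℕ m)) ≈ belowSum n (toℕ m) + maximumSum n m
  belowSum-suc n m = trans (∑-cong (λ z → trans (*-congʳ (⟦<suc⟧ m (top z))) (distribʳ _ _ _)) (words k (suc n)))
    (∑-+ (words k (suc n)) _ _)

  module _ (n : ℕ) (m : Fin k) where
    private
      ws : List (Fin (suc n) → Fin k)
      ws = words k (suc n)

      mass : (Fin (suc n) → Fin k) → Carrier
      mass z = ⟦ top z Fin.≟ m ⟧ * weight _▷?_ z

    -- `followSum a` weighs the words that may stand after a first letter `a`: the factor x pays for
    -- a descent created at the front, while a record created there is left out.
    letterSum followSum ▷Sum : Fin k → Carrier
    letterSum a = ∑ ws λ z → ⟦ z zero Fin.≟ a ⟧ * mass z
    followSum a = ∑ ws λ z → x ^ bit (does (a ▷? z zero)) * mass z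
    ▷Sum a      = ∑ ws λ z → ⟦ a ▷? z zero ⟧ * mass z

    prefixSum : ℕ → Carrier
    prefixSum j = ∑ ws λ z → ⟦ toℕ (z zero) ℕ.<? j ⟧ * mass z

    prefixSum-zero : prefixSum 0 ≈ 0#
    prefixSum-zero = trans (∑-cong (λ z → zeroˡ _) ws) (∑-0 ws)

    prefixSum-suc : ∀ a → prefixSum (suc (toℕ a)) ≈ prefixSum (toℕ a) + letterSum a
    prefixSum-suc a = trans (∑-cong (λ z → trans (*-congʳ (⟦<suc⟧ a (z zero))) (distribʳ _ _ _)) ws) (∑-+ ws _ _)

    prefixSum-full : prefixSum (suc (toℕ m)) ≈ maximumSum n m
    prefixSum-full = ∑-cong (λ z → begin
      ⟦ toℕ (z zero) ℕ.<? suc (toℕ m) ⟧ * (⟦ top z Fin.≟ m ⟧ * weight _▷?_ z)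
        ≈⟨ solve 3 (λ a b d → a :* (b :* d) := b :* (a :* d)) refl _ _ _ ⟩
      ⟦ top z Fin.≟ m ⟧ * (⟦ toℕ (z zero) ℕ.<? suc (toℕ m) ⟧ * weight _▷?_ z)
        ≈⟨ ⟦⟧-guard (top z Fin.≟ m) (λ { ≡.refl → trans
             (*-congʳ (⟦⟧-true (toℕ (z zero) ℕ.<? suc (toℕ m)) (s≤s (≤top z zero)))) (*-identityˡ _) }) ⟩
      ⟦ top z Fin.≟ m ⟧ * weight _▷?_ z ∎) ws

    -- With y = 1 - x, the power x^b equals 1 - y b for b in {0, 1}. This trades the case
    -- distinction in the exponent for a sum over the first letters that `a` dominates, hence for
    -- prefix sums.
    followSum-complement : ∀ {y} → x + y ≈ 1# → ∀ a → followSum a + y * ▷Sum a ≈ maximumSum n m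
    followSum-complement {y} x+y≈1 a = begin
      followSum a + y * ▷Sum a
        ≈⟨ +-congˡ (∑-*ˡ y ws _) ⟨
      followSum a + ∑ ws (λ z → y * (⟦ a ▷? z zero ⟧ * mass z))
        ≈⟨ ∑-+ ws _ _ ⟨
      ∑ ws (λ z → x ^ bit (does (a ▷? z zero)) * mass z + y * (⟦ a ▷? z zero ⟧ * mass z))
        ≈⟨ ∑-cong (λ z → trans
             (solve 4 (λ p y q d → p :* d :+ y :* (q :* d) := (p :+ y :* q) :* d) refl _ y _ (mass z))
             (trans (*-congʳ (^bit-complement x+y≈1 (a ▷? z zero))) (*-identityˡ _))) ws ⟩
      ∑ ws mass ∎

  -- A new first letter can only add a descent and a record at the front, and it dominates all later
  -- letters exactly when it dominates the largest of them.
  weight-∷ : (a : Fin k) (z : Fin (suc n) → Fin k) → weight _▷?_ (a Vector.∷ z) ≈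
             x ^ bit (does (a ▷? z zero)) * v ^ bit (does (a ▷? top z)) * weight _▷?_ z
  weight-∷ {n} a z = begin
    x ^ (bit d ℕ.+ adjacent _▷?_ z) * v ^ (bit (does (isRightRecord? _▷?_ (a Vector.∷ z) zero)) ℕ.+ tailRecords)
      ≈⟨ *-cong (^-homo-* x (bit d) _) (trans (reflexive (≡.cong (v ^_) (≡.cong₂ (λ b r → bit b ℕ.+ r)
           (does-⇔ record⇔ (isRightRecord? _▷?_ (a Vector.∷ z) zero) (a ▷? top z))
           (#-cong λ i → does-⇔ (mk⇔ (λ h j i<j → h (suc j) (s≤s i<j)) (λ { h zero () ; h (suc j) (s≤s i<j) → h j i<j }))
             (isRightRecord? _▷?_ (a Vector.∷ z) (suc i)) (isRightRecord? _▷?_ z i)))))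
           (^-homo-* v (bit (does (a ▷? top z))) _)) ⟩
    x ^ bit d * x ^ adjacent _▷?_ z * (v ^ bit (does (a ▷? top z)) * v ^ rightRecords _▷?_ z)
      ≈⟨ solve 4 (λ p q r s → p :* q :* (r :* s) := p :* r :* (q :* s)) refl _ _ _ _ ⟩
    x ^ bit d * v ^ bit (does (a ▷? top z)) * weight _▷?_ z ∎
    where
    d : Bool
    d = does (a ▷? z zero)
    tailRecords : ℕ
    tailRecords = # λ i → does (isRightRecord? _▷?_ (a Vector.∷ z) (suc i))
    record⇔ : IsRightRecord _▷_ (a Vector.∷ z) zero ⇔ (a ▷ top z)
    record⇔ = mk⇔
      (λ h → let i , p = top-attained z in ≡.subst (a ▷_) (≡.sym p) (h (suc i) (s≤s z≤n)))
      λ { h (suc j) _ → ▷-resp-≤ h (≤top z j) ; h zero () }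

  letterSum-base : ∀ m a → letterSum 0 m a ≈ ⟦ a Fin.≟ m ⟧ * v
  letterSum-base m a = begin
    letterSum 0 m a
      ≈⟨ ∑-product Vector._∷_ (allFin k) (words k 0) _ ⟩
    ∑ (allFin k) (λ b → ⟦ b Fin.≟ a ⟧ * (⟦ b Fin.≟ m ⟧ * (1# * (v * 1#))) + 0#)
      ≈⟨ ∑-cong (λ b → trans (+-identityʳ _) (*-congˡ (*-congˡ (trans (*-identityˡ _) (*-identityʳ v))))) (allFin k) ⟩
    ∑ (allFin k) (λ b → ⟦ b Fin.≟ a ⟧ * (⟦ b Fin.≟ m ⟧ * v))
      ≈⟨ ∑-pick Fin._≟_ (allFin k) (allFin-enumerates k) (λ b → ⟦ b Fin.≟ m ⟧ * v) a (λ { ≡.refl → refl }) ⟩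
    ⟦ a Fin.≟ m ⟧ * v ∎

  letterSum-suc : ∀ n m a → letterSum (suc n) m a ≈ ∑ (words k (suc n)) λ z →
    ⟦ (a ⊔ top z) Fin.≟ m ⟧ * (x ^ bit (does (a ▷? z zero)) * v ^ bit (does (a ▷? top z)) * weight _▷?_ z)
  letterSum-suc n m a = begin
    letterSum (suc n) m a
      ≈⟨ ∑-product Vector._∷_ (allFin k) (words k (suc n)) _ ⟩
    ∑ (allFin k) (λ b → ∑ (words k (suc n)) λ z → ⟦ b Fin.≟ a ⟧ * (⟦ (b ⊔ top z) Fin.≟ m ⟧ * weight _▷?_ (b Vector.∷ z)))
      ≈⟨ ∑-swap (allFin k) (words k (suc n)) _ ⟩
    ∑ (words k (suc n)) (λ z → ∑ (allFin k) λ b → ⟦ b Fin.≟ a ⟧ * (⟦ (b ⊔ top z) Fin.≟ m ⟧ * weight _▷?_ (b Vector.∷ z)))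
      ≈⟨ ∑-cong (λ z → ∑-pick Fin._≟_ (allFin k) (allFin-enumerates k)
           (λ b → ⟦ (b ⊔ top z) Fin.≟ m ⟧ * weight _▷?_ (b Vector.∷ z)) a λ { ≡.refl → refl }) (words k (suc n)) ⟩
    ∑ (words k (suc n)) (λ z → ⟦ (a ⊔ top z) Fin.≟ m ⟧ * weight _▷?_ (a Vector.∷ z))
      ≈⟨ ∑-cong (λ z → *-congˡ (weight-∷ a z)) (words k (suc n)) ⟩
    ∑ (words k (suc n)) (λ z →
      ⟦ (a ⊔ top z) Fin.≟ m ⟧ * (x ^ bit (does (a ▷? z zero)) * v ^ bit (does (a ▷? top z)) * weight _▷?_ z)) ∎

  -- Since a < m, the maximum m must occur in the rest of the word, and since `a` does not dominate
  -- m, it is no record: only the possible descent is left.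
  letterSum-< : ∀ n {m a} → a Fin.< m → ¬ (a ▷ m) → letterSum (suc n) m a ≈ followSum n m a
  letterSum-< n {m} {a} a<m a⋫m = trans (letterSum-suc n m a) (∑-cong (λ z → begin
    ⟦ (a ⊔ top z) Fin.≟ m ⟧ * (X z * V z * weight _▷?_ z)
      ≈⟨ ⟦⟧-absorb (mk⇔ (cancel z) λ { ≡.refl → x≤y⇒x⊔y≈y (ℕ.<⇒≤ a<m) }) ((a ⊔ top z) Fin.≟ m) (top z Fin.≟ m) _ ⟩
    ⟦ top z Fin.≟ m ⟧ * (X z * V z * weight _▷?_ z)
      ≈⟨ ⟦⟧-guard (top z Fin.≟ m) (λ { ≡.refl → *-congʳ (trans (*-congˡ (^bit-false v (a ▷? top z) a⋫m)) (*-identityʳ _)) }) ⟩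
    ⟦ top z Fin.≟ m ⟧ * (X z * weight _▷?_ z)
      ≈⟨ solve 3 (λ p q r → p :* (q :* r) := q :* (p :* r)) refl _ _ _ ⟩
    X z * (⟦ top z Fin.≟ m ⟧ * weight _▷?_ z) ∎) (words k (suc n)))
    where
    X V : (Fin (suc n) → Fin k) → Carrier
    X z = x ^ bit (does (a ▷? z zero))
    V z = v ^ bit (does (a ▷? top z))
    cancel : ∀ z → a ⊔ top z ≡ m → top z ≡ m
    cancel z p with ⊔-sel a (top z)
    ... | inj₁ q = contradiction (≡.cong toℕ (≡.trans (≡.sym q) p)) (ℕ.<⇒≢ a<m)
    ... | inj₂ q = ≡.trans (≡.sym q) p

module StrictRecurrences (R : CommutativeRing c ℓ) (x v : CommutativeRing.Carrier R) (k : ℕ) where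
  open RingOps R hiding (zero)
  open Sums R
  open Indicators R
  open Recurrences R x v (strictly k) public
  open Relation.Binary.Reasoning.Setoid setoid
  open Solver commutativeSemiring using (solve; _:*_; _:=_)
  open Top k

  -- A leading m is a record only if the rest stays below m, and then it is also a descent, which
  -- gives x v. If the rest attains m again, the leading m is no record and `followSum` accounts for
  -- it.
  letterSum-diagonal : ∀ n m → letterSum (suc n) m m ≈ followSum n m m + x * v * belowSum n (toℕ m)
  letterSum-diagonal n m = begin
    letterSum (suc n) m m
      ≈⟨ letterSum-suc n m m ⟩
    ∑ (words k (suc n)) (λ z → ⟦ (m ⊔ top z) Fin.≟ m ⟧ * (X z * V z * W z))
      ≈⟨ ∑-cong split (words k (suc n)) ⟩
    ∑ (words k (suc n)) (λ z → X z * (⟦ top z Fin.≟ m ⟧ * W z) + x * v * (⟦ toℕ (top z) ℕ.<? toℕ m ⟧ * W z))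
      ≈⟨ trans (∑-+ (words k (suc n)) _ _) (+-congˡ (∑-*ˡ (x * v) (words k (suc n)) _)) ⟩
    followSum n m m + x * v * belowSum n (toℕ m) ∎
    where
    X V W : (Fin (suc n) → Fin k) → Carrier
    X z = x ^ bit (does (z zero <? m))
    V z = v ^ bit (does (top z <? m))
    W z = weight (greater? k) z
    split : ∀ z → ⟦ (m ⊔ top z) Fin.≟ m ⟧ * (X z * V z * W z) ≈
                  X z * (⟦ top z Fin.≟ m ⟧ * W z) + x * v * (⟦ toℕ (top z) ℕ.<? toℕ m ⟧ * W z)
    split z with Fin.<-cmp (top z) m
    ... | tri< t<m t≢m _ = begin
      ⟦ (m ⊔ top z) Fin.≟ m ⟧ * (X z * V z * W z)
        ≈⟨ *-cong (⟦⟧-true ((m ⊔ top z) Fin.≟ m) (x≤y⇒y⊔x≈y (ℕ.<⇒≤ t<m))) (*-congʳ (*-cong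
             (^bit-true x (z zero <? m) (ℕ.≤-<-trans (≤top z zero) t<m)) (^bit-true v (top z <? m) t<m))) ⟩
      1# * (x * v * W z)
        ≈⟨ solve 3 (λ o p w → o :* (p :* w) := p :* (o :* w)) refl 1# (x * v) (W z) ⟩
      x * v * (1# * W z)
        ≈⟨ trans (+-cong (trans (*-congˡ (trans (*-congʳ (⟦⟧-false (top z Fin.≟ m) t≢m)) (zeroˡ _))) (zeroʳ _))
             (*-congˡ (*-congʳ (⟦⟧-true (toℕ (top z) ℕ.<? toℕ m) t<m)))) (+-identityˡ _) ⟨
      X z * (⟦ top z Fin.≟ m ⟧ * W z) + x * v * (⟦ toℕ (top z) ℕ.<? toℕ m ⟧ * W z) ∎
    ... | tri≈ t≮m t≡m _ = begin
      ⟦ (m ⊔ top z) Fin.≟ m ⟧ * (X z * V z * W z)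
        ≈⟨ *-cong (⟦⟧-true ((m ⊔ top z) Fin.≟ m) (x≤y⇒y⊔x≈y (ℕ.≤-reflexive (≡.cong toℕ t≡m))))
             (*-congʳ (trans (*-congˡ (^bit-false v (top z <? m) t≮m)) (*-identityʳ _))) ⟩
      1# * (X z * W z)
        ≈⟨ solve 3 (λ o p w → o :* (p :* w) := p :* (o :* w)) refl 1# (X z) (W z) ⟩
      X z * (1# * W z)
        ≈⟨ trans (+-cong (*-congˡ (*-congʳ (⟦⟧-true (top z Fin.≟ m) t≡m)))
             (trans (*-congˡ (trans (*-congʳ (⟦⟧-false (toℕ (top z) ℕ.<? toℕ m) t≮m)) (zeroˡ _))) (zeroʳ _)))
             (+-identityʳ _) ⟨
      X z * (⟦ top z Fin.≟ m ⟧ * W z) + x * v * (⟦ toℕ (top z) ℕ.<? toℕ m ⟧ * W z) ∎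
    ... | tri> t≮m t≢m m<t = trans
      (trans (*-congʳ (⟦⟧-false ((m ⊔ top z) Fin.≟ m) λ p → ℕ.<⇒≱ m<t (x⊔y≈x⇒y≤x p))) (zeroˡ _))
      (sym (trans (+-cong (trans (*-congˡ (trans (*-congʳ (⟦⟧-false (top z Fin.≟ m) t≢m)) (zeroˡ _))) (zeroʳ _))
        (trans (*-congˡ (trans (*-congʳ (⟦⟧-false (toℕ (top z) ℕ.<? toℕ m) t≮m)) (zeroˡ _))) (zeroʳ _))) (+-identityˡ 0#)))

module WeakRecurrences (R : CommutativeRing c ℓ) (x v : CommutativeRing.Carrier R) (k : ℕ) where
  open RingOps R hiding (zero)
  open Sums R
  open Indicators R
  open Recurrences R x v (weakly k) public
  open Relation.Binary.Reasoning.Setoid setoid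
  open Solver commutativeSemiring using (solve; _:*_; _:=_)
  open Comparison (weakly k)
  open Top k

  -- Under ≥ a leading m dominates whatever follows, whether or not m occurs again, so the descent
  -- and the record are always present. This is why the bound is m + 1 here and not m.
  letterSum-diagonal : ∀ n m → letterSum (suc n) m m ≈ x * v * belowSum n (suc (toℕ m))
  letterSum-diagonal n m = begin
    letterSum (suc n) m m
      ≈⟨ letterSum-suc n m m ⟩
    ∑ (words k (suc n)) (λ z → ⟦ (m ⊔ top z) Fin.≟ m ⟧ * (x ^ bit (does (m ▷? z zero)) * v ^ bit (does (m ▷? top z)) * W z))
      ≈⟨ ∑-cong (λ z → trans (⟦⟧-absorb (mk⇔ (λ p → s≤s (x⊔y≈x⇒y≤x p)) (λ p → x≤y⇒y⊔x≈y (ℕ.≤-pred p)))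
           ((m ⊔ top z) Fin.≟ m) (toℕ (top z) ℕ.<? suc (toℕ m)) _)
           (trans (⟦⟧-guard (toℕ (top z) ℕ.<? suc (toℕ m)) λ p → *-congʳ (*-cong
             (^bit-true x (m ▷? z zero) (ℕ.≤-trans (≤top z zero) (ℕ.≤-pred p)))
             (^bit-true v (m ▷? top z) (ℕ.≤-pred p))))
           (solve 3 (λ o p w → o :* (p :* w) := p :* (o :* w)) refl _ (x * v) (W z)))) (words k (suc n)) ⟩
    ∑ (words k (suc n)) (λ z → x * v * (⟦ toℕ (top z) ℕ.<? suc (toℕ m) ⟧ * W z))
      ≈⟨ ∑-*ˡ (x * v) (words k (suc n)) _ ⟩
    x * v * belowSum n (suc (toℕ m)) ∎
    where
    W : (Fin (suc n) → Fin k) → Carrier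
    W z = weight _▷?_ z

  ▷Sum≈prefixSum : ∀ n m a → ▷Sum n m a ≈ prefixSum n m (suc (toℕ a))
  ▷Sum≈prefixSum n m a = ∑-cong (λ z → ⟦⟧-absorb (mk⇔ s≤s ℕ.≤-pred)
    (z zero Fin.≤? a) (toℕ (z zero) ℕ.<? suc (toℕ a)) _) (words k (suc n))

-- The linear system of the first letters

module LetterSystem (R : CommutativeRing c ℓ) where
  open RingOps R hiding (zero)
  open Relation.Binary.Reasoning.Setoid setoid
  open Solver commutativeSemiring using (solve; _:+_; _:*_; _:=_)
  open Algebra.Properties.Ring ring using (+-cancelʳ)

  module _ {k : ℕ} (m : Fin k) {x y t q σ v : Carrier} (x+y≈1 : x + y ≈ 1#) (q+t≈1 : q + t ≈ 1#)
           {W L : Fin k → Carrier} {P : ℕ → Carrier} {M D : Carrier}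
           (P-zero : P 0 ≈ 0#) (P-suc : ∀ a → P (suc (toℕ a)) ≈ P (toℕ a) + W a) (P-full : P (suc (toℕ m)) ≈ M)
           (W-< : ∀ {a} → a Fin.< m → W a ≈ t * (σ * L a)) where
    private
      -- The range stops at m because `W-<` only speaks of first letters below m; the equation for m
      -- itself is used once, at the end.
      induction : (Q : ℕ → Set ℓ) → Q 0 → (∀ a → a Fin.< m → Q (toℕ a) → Q (suc (toℕ a))) → ∀ j → j ℕ.≤ toℕ m → Q j
      induction Q base stp zero    _   = base
      induction Q base stp (suc j) j<m = ≡.subst (Q ∘ suc) toℕ-a
        (stp a (≡.subst (ℕ._< toℕ m) (≡.sym toℕ-a) j<m) (≡.subst Q (≡.sym toℕ-a) (induction Q base stp j (ℕ.<⇒≤ j<m))))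
        where
        j<k : j ℕ.< k
        j<k = ℕ.<-trans j<m (Fin.toℕ<n m)
        a : Fin k
        a = fromℕ< j<k
        toℕ-a : toℕ a ≡ j
        toℕ-a = Fin.toℕ-fromℕ< j<k

    -- σM = qʲσM + P j by induction on j: the equation for the letter j then reads
    -- W j = t qʲσM.
    strict-solution : σ * y ≈ 1# → (∀ a → L a + y * P (toℕ a) ≈ M) → W m ≈ t * (σ * (L m + v * D)) →
                      t * v * D + x * M ≈ q ^ suc (toℕ m) * M
    strict-solution σy≈1 L+yP≈M W-m = +-cancelʳ (y * M) _ _ (begin
      t * v * D + x * M + y * M
        ≈⟨ solve 4 (λ p x y M → p :+ x :* M :+ y :* M := p :+ (x :+ y) :* M) refl _ x y M ⟩
      t * v * D + (x + y) * M
        ≈⟨ +-congˡ (*-congʳ (trans x+y≈1 (sym σy≈1))) ⟩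
      t * v * D + σ * y * M
        ≈⟨ +-congʳ (trans (*-congʳ σy≈1) (*-identityˡ _)) ⟨
      σ * y * (t * v * D) + σ * y * M
        ≈⟨ solve 6 (λ σ y t v D M → σ :* y :* (t :* v :* D) :+ σ :* y :* M :=
             y :* (t :* (σ :* (v :* D)) :+ σ :* M)) refl σ y t v D M ⟩
      y * (t * (σ * (v * D)) + σ * M)
        -- `advance` leaves P m + tσ L m behind, which together with tσvD is P m + W m, that is, M.
        ≈⟨ *-congˡ (+-congˡ (advance (invariant (toℕ m) ℕ.≤-refl))) ⟩
      y * (t * (σ * (v * D)) + (q * (q ^ toℕ m * (σ * M)) + (P (toℕ m) + t * (σ * L m))))
        ≈⟨ *-congˡ (solve 6 (λ t σ vD r p L → t :* (σ :* vD) :+ (r :+ (p :+ t :* (σ :* L))) :=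
             r :+ (p :+ t :* (σ :* (L :+ vD)))) refl t σ (v * D) _ (P (toℕ m)) (L m)) ⟩
      y * (q * (q ^ toℕ m * (σ * M)) + (P (toℕ m) + t * (σ * (L m + v * D))))
        ≈⟨ *-congˡ (+-congˡ (trans (+-congˡ (sym W-m)) (trans (sym (P-suc m)) P-full))) ⟩
      y * (q * (q ^ toℕ m * (σ * M)) + M)
        ≈⟨ solve 5 (λ y q r σ M → y :* (q :* (r :* (σ :* M)) :+ M) := q :* r :* ((σ :* y) :* M) :+ y :* M) refl y q _ σ M ⟩
      q ^ suc (toℕ m) * (σ * y * M) + y * M
        ≈⟨ +-congʳ (*-congˡ (trans (*-congʳ σy≈1) (*-identityˡ M))) ⟩
      q ^ suc (toℕ m) * M + y * M ∎)
      where
      follow : ∀ {a} → σ * M ≈ q ^ toℕ a * (σ * M) + P (toℕ a) → σ * L a ≈ q ^ toℕ a * (σ * M)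
      follow {a} h = +-cancelʳ (P (toℕ a)) _ _ (begin
        σ * L a + P (toℕ a)             ≈⟨ +-congˡ (trans (*-congʳ σy≈1) (*-identityˡ _)) ⟨
        σ * L a + σ * y * P (toℕ a)     ≈⟨ solve 4 (λ σ L y p → σ :* L :+ σ :* y :* p := σ :* (L :+ y :* p)) refl σ _ y _ ⟩
        σ * (L a + y * P (toℕ a))       ≈⟨ *-congˡ (L+yP≈M a) ⟩
        σ * M                           ≈⟨ h ⟩
        q ^ toℕ a * (σ * M) + P (toℕ a) ∎)

      advance : ∀ {a} → σ * M ≈ q ^ toℕ a * (σ * M) + P (toℕ a) →
                σ * M ≈ q * (q ^ toℕ a * (σ * M)) + (P (toℕ a) + t * (σ * L a))
      advance {a} h = begin
        σ * M
          ≈⟨ h ⟩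
        r + P (toℕ a)
          ≈⟨ +-congʳ (trans (*-congʳ q+t≈1) (*-identityˡ r)) ⟨
        (q + t) * r + P (toℕ a)
          ≈⟨ solve 4 (λ q t r p → (q :+ t) :* r :+ p := q :* r :+ (p :+ t :* r)) refl q t r _ ⟩
        q * r + (P (toℕ a) + t * r)
          ≈⟨ +-congˡ (+-congˡ (*-congˡ (follow h))) ⟨
        q * r + (P (toℕ a) + t * (σ * L a)) ∎
        where r = q ^ toℕ a * (σ * M)

      invariant : ∀ j → j ℕ.≤ toℕ m → σ * M ≈ q ^ j * (σ * M) + P j
      invariant = induction (λ j → σ * M ≈ q ^ j * (σ * M) + P j)
        (sym (trans (+-cong (*-identityˡ _) P-zero) (+-identityʳ _)))
        λ a a<m h → trans (advance h) (+-cong (sym (*-assoc _ _ _)) (trans (+-congˡ (sym (W-< a<m))) (sym (P-suc a))))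

    -- Here qʲ(σM + P j) = σM by induction on j, since W j = t(σM + P (j + 1)).
    weak-solution : σ * y + 1# ≈ 0# → (∀ a → L a + y * P (suc (toℕ a)) ≈ M) → W m ≈ t * (σ * (v * D)) →
                    M + q ^ toℕ m * (t * v * D) ≈ q ^ toℕ m * (x * M)
    weak-solution σy+1≈0 L+yP≈M W-m = +-cancelʳ (r * (y * M)) _ _ (begin
      M + r * (t * v * D) + r * (y * M)
        ≈⟨ solve 4 (λ M r d y → M :+ r :* d :+ r :* (y :* M) := M :+ r :* (y :* M :+ d)) refl M r (t * v * D) y ⟩
      M + r * (y * M + t * v * D)
        ≈⟨ +-congˡ (*-congˡ yP) ⟨
      M + r * (y * P (toℕ m))
        -- Adding the zero (σy + 1) r M supplies the term σM that must stand next to P m for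
        -- `invariant` to apply.
        ≈⟨ +-congˡ (kill (r * M) (r * (y * P (toℕ m)))) ⟩
      M + ((σ * y + 1#) * (r * M) + r * (y * P (toℕ m)))
        ≈⟨ solve 6 (λ M r σ y o p → M :+ ((σ :* y :+ o) :* (r :* M) :+ r :* (y :* p)) :=
             M :+ (y :* (r :* (σ :* M :+ p)) :+ o :* (r :* M))) refl M r σ y 1# (P (toℕ m)) ⟩
      M + (y * (r * (σ * M + P (toℕ m))) + 1# * (r * M))
        ≈⟨ +-congˡ (+-cong (*-congˡ (invariant (toℕ m) ℕ.≤-refl)) (*-identityˡ _)) ⟩
      M + (y * (σ * M) + r * M)
        ≈⟨ +-congʳ (*-identityˡ M) ⟨
      1# * M + (y * (σ * M) + r * M)
        ≈⟨ solve 5 (λ o M y σ r → o :* M :+ (y :* (σ :* M) :+ r) := (σ :* y :+ o) :* M :+ r) refl 1# M y σ (r * M) ⟩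
      (σ * y + 1#) * M + r * M
        ≈⟨ kill M (r * M) ⟨
      r * M
        ≈⟨ *-congˡ (trans (*-congʳ x+y≈1) (*-identityˡ M)) ⟨
      r * ((x + y) * M)
        ≈⟨ solve 4 (λ r x y M → r :* ((x :+ y) :* M) := r :* (x :* M) :+ r :* (y :* M)) refl r x y M ⟩
      r * (x * M) + r * (y * M) ∎)
      where
      r : Carrier
      r = q ^ toℕ m

      kill : ∀ a b → b ≈ (σ * y + 1#) * a + b
      kill a b = sym (trans (+-congʳ (trans (*-congʳ σy+1≈0) (zeroˡ a))) (+-identityˡ b))

      yP : y * P (toℕ m) ≈ y * M + t * v * D
      yP = begin
        y * P (toℕ m)
          ≈⟨ kill (t * v * D) _ ⟩
        (σ * y + 1#) * (t * v * D) + y * P (toℕ m)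
          ≈⟨ solve 7 (λ σ y o t v D p → (σ :* y :+ o) :* (t :* v :* D) :+ y :* p :=
               y :* (p :+ t :* (σ :* (v :* D))) :+ o :* (t :* v :* D)) refl σ y 1# t v D (P (toℕ m)) ⟩
        y * (P (toℕ m) + t * (σ * (v * D))) + 1# * (t * v * D)
          ≈⟨ +-cong (*-congˡ (trans (+-congˡ (sym W-m)) (trans (sym (P-suc m)) P-full))) (*-identityˡ _) ⟩
        y * M + t * v * D ∎

      follow : ∀ a → σ * L a ≈ σ * M + P (suc (toℕ a))
      follow a = begin
        σ * L a
          ≈⟨ kill (P (suc (toℕ a))) _ ⟩
        (σ * y + 1#) * P (suc (toℕ a)) + σ * L a
          ≈⟨ solve 5 (λ σ y o p L → (σ :* y :+ o) :* p :+ σ :* L := σ :* (L :+ y :* p) :+ o :* p) refl σ y 1# _ (L a) ⟩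
        σ * (L a + y * P (suc (toℕ a))) + 1# * P (suc (toℕ a))
          ≈⟨ +-cong (*-congˡ (L+yP≈M a)) (*-identityˡ _) ⟩
        σ * M + P (suc (toℕ a)) ∎

      advance : ∀ a → a Fin.< m → q * (σ * M + P (suc (toℕ a))) ≈ σ * M + P (toℕ a)
      advance a a<m = +-cancelʳ (t * (σ * M + P (suc (toℕ a)))) _ _ (begin
        q * N + t * N             ≈⟨ distribʳ N q t ⟨
        (q + t) * N               ≈⟨ trans (*-congʳ q+t≈1) (*-identityˡ N) ⟩
        σ * M + P (suc (toℕ a))   ≈⟨ +-congˡ (trans (P-suc a) (+-congˡ (trans (W-< a<m) (*-congˡ (follow a))))) ⟩
        σ * M + (P (toℕ a) + t * N) ≈⟨ +-assoc _ _ _ ⟨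
        σ * M + P (toℕ a) + t * N ∎)
        where N = σ * M + P (suc (toℕ a))

      invariant : ∀ j → j ℕ.≤ toℕ m → q ^ j * (σ * M + P j) ≈ σ * M
      invariant = induction (λ j → q ^ j * (σ * M + P j) ≈ σ * M)
        (trans (*-identityˡ _) (trans (+-congˡ P-zero) (+-identityʳ _)))
        λ a a<m h → trans (trans (*-congʳ (*-comm _ _)) (*-assoc _ _ _)) (trans (*-congˡ (advance a a<m)) h)

-- Generating functions in t

module Hat (R : CommutativeRing c ℓ) (s : CommutativeRing.Carrier R) where
  open RingOps R hiding (zero)
  open Series R using (C; X; C-*ₛ; X-*ₛ; *ₛ-head; module S)
  open Solver commutativeSemiring using (solve; _:*_; _:=_)

  -- f n is attached to the words of length n + 1, hence to s ⁿ⁺¹ t ⁿ⁺¹.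
  hat : (ℕ → Carrier) → ℕ → Carrier
  hat f zero    = 0#
  hat f (suc n) = s ^ suc n * f n

  hat-cong : ∀ {f g} → (∀ n → f n ≈ g n) → hat f S.≈ hat g
  hat-cong p zero    = refl
  hat-cong p (suc n) = *-congˡ (p n)

  hat-+ : ∀ f g → hat (λ n → f n + g n) S.≈ hat f S.+ hat g
  hat-+ f g zero    = sym (+-identityʳ 0#)
  hat-+ f g (suc n) = distribˡ _ _ _

  hat-* : ∀ a f → hat (λ n → a * f n) S.≈ C a S.* hat f
  hat-* a f zero    = sym (trans (C-*ₛ a (hat f) 0) (zeroʳ a))
  hat-* a f (suc n) = trans (solve 3 (λ s a f → s :* (a :* f) := a :* (s :* f)) refl _ a _) (sym (C-*ₛ a (hat f) (suc n)))

  hat-0 : ∀ {f} → (∀ n → f n ≈ 0#) → hat f S.≈ S.0#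
  hat-0 p zero    = refl
  hat-0 p (suc n) = trans (*-congˡ (p n)) (zeroʳ _)

  -- One more letter costs a factor s t; g₀ is the contribution of the one-letter words.
  hat-suc : ∀ {f g₀ g} → f 0 ≈ g₀ → (∀ n → f (suc n) ≈ g n) → hat f S.≈ X S.* (C s S.* (C g₀ S.+ hat g))
  hat-suc {f} {g₀} {g} p q zero    = sym (trans (*ₛ-head X (C s S.* (C g₀ S.+ hat g))) (zeroˡ _))
  hat-suc {f} {g₀} {g} p q (suc n) = sym (trans (X-*ₛ (C s S.* (C g₀ S.+ hat g)) n) (trans (C-*ₛ s (C g₀ S.+ hat g) n) (go n)))
    where
    go : ∀ n → s * (C g₀ S.+ hat g) n ≈ s ^ suc n * f n
    go zero    = *-cong (sym (*-identityʳ s)) (trans (+-identityʳ g₀) (sym p))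
    go (suc n) = trans (*-congˡ (trans (+-identityˡ _) (*-congˡ (sym (q n))))) (sym (*-assoc _ _ _))

  C-cong : ∀ {a b} → a ≈ b → C a S.≈ C b
  C-cong p zero    = p
  C-cong p (suc n) = refl

  C-+ : ∀ a b → C (a + b) S.≈ C a S.+ C b
  C-+ a b zero    = refl
  C-+ a b (suc n) = sym (+-identityʳ 0#)

  C-* : ∀ a b → C (a * b) S.≈ C a S.* C b
  C-* a b zero    = sym (C-*ₛ a (C b) 0)
  C-* a b (suc n) = sym (trans (C-*ₛ a (C b) (suc n)) (zeroʳ a))

  C-0 : C 0# S.≈ S.0#
  C-0 zero    = refl
  C-0 (suc n) = refl

  C-^ : ∀ a n → C (a ^ n) S.≈ C a S.^ n
  C-^ a zero    = S.refl {S.1#}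
  C-^ a (suc n) = S.trans {C (a * a ^ n)} {C a S.* C (a ^ n)} (C-* a (a ^ n)) (S.*-congˡ {C a} (C-^ a n))

module GeneratingFunctions (R : CommutativeRing c ℓ) (x v s : CommutativeRing.Carrier R) {k : ℕ} (𝒞 : Comparison k) where
  open RingOps R hiding (zero)
  open Series R using (C; X; module S)
  open Hat R s
  open Recurrences R x v 𝒞

  M̂ : Fin k → ℕ → Carrier
  M̂ m = hat λ n → maximumSum n m

  -- What may follow a leading record, whose own factor is v: nothing, or a word over the letters
  -- below j, which is entered by a descent worth x.
  D : ℕ → ℕ → Carrier
  D j = S.1# S.+ C x S.* hat λ n → belowSum n j

  Ŵ L̂ : Fin k → Fin k → ℕ → Carrier
  Ŵ m a = hat λ n → letterSum n m a
  L̂ m a = hat λ n → followSum n m a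

  P̂ : Fin k → ℕ → ℕ → Carrier
  P̂ m j = hat λ n → prefixSum n m j

  D-zero : D 0 S.≈ S.1#
  D-zero = S.trans {D 0} {S.1# S.+ C x S.* S.0#} {S.1#}
    (S.+-congˡ {S.1#} (S.*-congˡ {C x} (hat-0 belowSum-zero)))
    (S.trans {S.1# S.+ C x S.* S.0#} {S.1# S.+ S.0#} (S.+-congˡ {S.1#} (S.zeroʳ (C x))) (S.+-identityʳ S.1#))

  D-suc : ∀ m → D (suc (toℕ m)) S.≈ D (toℕ m) S.+ C x S.* M̂ m
  D-suc m = begin
    S.1# S.+ C x S.* hat (λ n → belowSum n (suc (toℕ m)))
      ≈⟨ S.+-congˡ {S.1#} (S.*-congˡ {C x} (S.trans {hat λ n → belowSum n (suc (toℕ m))}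
           (hat-cong λ n → belowSum-suc n m) (hat-+ (λ n → belowSum n (toℕ m)) (λ n → maximumSum n m)))) ⟩
    S.1# S.+ C x S.* (β S.+ M̂ m)    ≈⟨ S.+-congˡ {S.1#} (S.distribˡ (C x) β (M̂ m)) ⟩
    S.1# S.+ (C x S.* β S.+ C x S.* M̂ m) ≈⟨ S.+-assoc S.1# (C x S.* β) (C x S.* M̂ m) ⟨
    D (toℕ m) S.+ C x S.* M̂ m ∎
    where
    open Relation.Binary.Reasoning.Setoid S.setoid
    β : ℕ → Carrier
    β = hat λ n → belowSum n (toℕ m)

  P̂-suc : ∀ m a → P̂ m (suc (toℕ a)) S.≈ P̂ m (toℕ a) S.+ Ŵ m a
  P̂-suc m a = S.trans {P̂ m (suc (toℕ a))} (hat-cong λ n → prefixSum-suc n m a)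
    (hat-+ (λ n → prefixSum n m (toℕ a)) (λ n → letterSum n m a))

  open Comparison 𝒞

  Ŵ-< : ∀ {m a} → a Fin.< m → ¬ (a ▷ m) → Ŵ m a S.≈ X S.* (C s S.* L̂ m a)
  Ŵ-< {m} {a} a<m a⋫m = S.trans {Ŵ m a} {X S.* (C s S.* (C 0# S.+ L̂ m a))}
    (hat-suc (trans (letterSum-base m a) (trans (*-congʳ (Sums.⟦⟧-false R (a Fin.≟ m) (ℕ.<⇒≢ a<m ∘ ≡.cong toℕ))) (zeroˡ v)))
      (λ n → letterSum-< n a<m a⋫m))
    (S.*-congˡ {X} (S.*-congˡ {C s} (S.trans {C 0# S.+ L̂ m a} {S.0# S.+ L̂ m a} (S.+-congʳ {L̂ m a} C-0) (S.+-identityˡ (L̂ m a)))))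

  letterSum-base-≡ : ∀ m → letterSum 0 m m ≈ v
  letterSum-base-≡ m = trans (letterSum-base m m) (trans (*-congʳ (Sums.⟦⟧-true R (m Fin.≟ m) ≡.refl)) (*-identityˡ v))

  v-D : ∀ j → C v S.+ hat (λ n → x * v * belowSum n j) S.≈ C v S.* D j
  v-D j = begin
    C v S.+ hat (λ n → x * v * belowSum n j)   ≈⟨ S.+-congˡ {C v} (hat-* (x * v) λ n → belowSum n j) ⟩
    C v S.+ C (x * v) S.* β                    ≈⟨ S.+-cong (S.sym {C v S.* S.1#} (S.*-identityʳ (C v)))
                                                    (S.*-congʳ {β} (S.trans {C (x * v)} (C-cong (*-comm x v)) (C-* v x))) ⟩
    C v S.* S.1# S.+ C v S.* C x S.* β         ≈⟨ S.+-congˡ {C v S.* S.1#} (S.*-assoc (C v) (C x) β) ⟩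
    C v S.* S.1# S.+ C v S.* (C x S.* β)       ≈⟨ S.distribˡ (C v) S.1# (C x S.* β) ⟨
    C v S.* D j ∎
    where
    open Relation.Binary.Reasoning.Setoid S.setoid
    β : ℕ → Carrier
    β = hat λ n → belowSum n j

  L̂-complement : ∀ {y} → x + y ≈ 1# → ∀ m a → L̂ m a S.+ C y S.* (hat λ n → ▷Sum n m a) S.≈ M̂ m
  L̂-complement {y} x+y≈1 m a = S.trans {L̂ m a S.+ C y S.* hat Σ▷} {L̂ m a S.+ hat (λ n → y * Σ▷ n)} {M̂ m}
    (S.+-congˡ {L̂ m a} (S.sym {hat λ n → y * Σ▷ n} (hat-* y Σ▷)))
    (S.trans {L̂ m a S.+ hat (λ n → y * Σ▷ n)} {hat λ n → followSum n m a + y * Σ▷ n}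
      (S.sym {hat λ n → followSum n m a + y * Σ▷ n} (hat-+ (λ n → followSum n m a) (λ n → y * Σ▷ n)))
      (hat-cong λ n → followSum-complement n m x+y≈1 a))
    where
    Σ▷ : ℕ → Carrier
    Σ▷ n = ▷Sum n m a

q+X≈1 : (R : CommutativeRing c ℓ) → let open Series R in (S.1# S.- X) S.+ X S.≈ S.1#
q+X≈1 R = S.trans {(S.1# S.- X) S.+ X} {S.1# S.+ (S.- X S.+ X)} (S.+-assoc S.1# (S.- X) X)
  (S.trans {S.1# S.+ (S.- X S.+ X)} {S.1# S.+ S.0#} (S.+-congˡ {S.1#} (S.-‿inverseˡ X)) (S.+-identityʳ S.1#))
  where open Series R

module _ (R : CommutativeRing c ℓ) (x v s y : CommutativeRing.Carrier R) (k : ℕ) where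
  open RingOps R hiding (zero)
  open Series R using (C; X; powerSeries; module S)
  open Hat R s

  C-+≈1 : x + y ≈ 1# → C x S.+ C y S.≈ S.1#
  C-+≈1 p = S.trans {C x S.+ C y} {C (x + y)} (S.sym {C (x + y)} (C-+ x y)) (C-cong p)

  module _ where
    open StrictRecurrences R x v k
    open GeneratingFunctions R x v s (strictly k)

    strict-equation : x + y ≈ 1# → s * y ≈ 1# → ∀ m →
                      X S.* C v S.* D (toℕ m) S.+ C x S.* M̂ m S.≈ (S.1# S.- X) S.^ suc (toℕ m) S.* M̂ m
    strict-equation x+y≈1 sy≈1 m = LetterSystem.strict-solution powerSeries m
      {C x} {C y} {X} {S.1# S.- X} {C s} {C v} (C-+≈1 x+y≈1) (q+X≈1 R)
      {Ŵ m} {L̂ m} {P̂ m} {M̂ m} {D (toℕ m)}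
      (hat-0 λ n → prefixSum-zero n m) (P̂-suc m) (hat-cong λ n → prefixSum-full n m)
      (λ a<m → Ŵ-< a<m (ℕ.<-asym a<m))
      (S.trans {C s S.* C y} (S.sym {C (s * y)} (C-* s y)) (C-cong sy≈1))
      (L̂-complement x+y≈1 m)
      (S.trans {Ŵ m m} {X S.* (C s S.* (C v S.+ hat λ n → followSum n m m + x * v * belowSum n (toℕ m)))}
        (hat-suc (letterSum-base-≡ m) (λ n → letterSum-diagonal n m))
        (S.*-congˡ {X} (S.*-congˡ {C s} diagonal)))
      where
      β : ℕ → Carrier
      β = hat λ n → x * v * belowSum n (toℕ m)
      diagonal : C v S.+ hat (λ n → followSum n m m + x * v * belowSum n (toℕ m)) S.≈ L̂ m m S.+ C v S.* D (toℕ m)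
      diagonal = begin
        C v S.+ hat (λ n → followSum n m m + x * v * belowSum n (toℕ m))
          ≈⟨ S.+-congˡ {C v} (hat-+ (λ n → followSum n m m) (λ n → x * v * belowSum n (toℕ m))) ⟩
        C v S.+ (L̂ m m S.+ β) ≈⟨ S.+-assoc (C v) (L̂ m m) β ⟨
        C v S.+ L̂ m m S.+ β   ≈⟨ S.+-congʳ {β} (S.+-comm (C v) (L̂ m m)) ⟩
        L̂ m m S.+ C v S.+ β   ≈⟨ S.+-assoc (L̂ m m) (C v) β ⟩
        L̂ m m S.+ (C v S.+ β) ≈⟨ S.+-congˡ {L̂ m m} (v-D (toℕ m)) ⟩
        L̂ m m S.+ C v S.* D (toℕ m) ∎
        where open Relation.Binary.Reasoning.Setoid S.setoid

  module _ where
    open WeakRecurrences R x v k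
    open GeneratingFunctions R x v s (weakly k)

    weak-equation : x + y ≈ 1# → s * y + 1# ≈ 0# → ∀ m →
                    M̂ m S.+ (S.1# S.- X) S.^ toℕ m S.* (X S.* C v S.* D (suc (toℕ m))) S.≈
                    (S.1# S.- X) S.^ toℕ m S.* (C x S.* M̂ m)
    weak-equation x+y≈1 sy+1≈0 m = LetterSystem.weak-solution powerSeries m
      {C x} {C y} {X} {S.1# S.- X} {C s} {C v} (C-+≈1 x+y≈1) (q+X≈1 R)
      {Ŵ m} {L̂ m} {P̂ m} {M̂ m} {D (suc (toℕ m))}
      (hat-0 λ n → prefixSum-zero n m) (P̂-suc m) (hat-cong λ n → prefixSum-full n m)
      (λ a<m → Ŵ-< a<m (ℕ.<⇒≱ a<m))
      (S.trans {C s S.* C y S.+ S.1#} {C (s * y + 1#)}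
        (S.sym {C (s * y + 1#)} (S.trans {C (s * y + 1#)} (C-+ (s * y) 1#) (S.+-congʳ {S.1#} (C-* s y))))
        (S.trans {C (s * y + 1#)} (C-cong sy+1≈0) C-0))
      (λ a → S.trans {L̂ m a S.+ C y S.* P̂ m (suc (toℕ a))} {L̂ m a S.+ C y S.* hat (λ n → ▷Sum n m a)} {M̂ m}
        (S.+-congˡ {L̂ m a} (S.*-congˡ {C y} (hat-cong λ n → sym (▷Sum≈prefixSum n m a))))
        (L̂-complement x+y≈1 m a))
      (S.trans {Ŵ m m} {X S.* (C s S.* (C v S.+ hat λ n → x * v * belowSum n (suc (toℕ m))))}
        (hat-suc (letterSum-base-≡ m) (λ n → letterSum-diagonal n m))
        (S.*-congˡ {X} (S.*-congˡ {C s} (v-D (suc (toℕ m))))))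

-- Closed forms

module ClosedFormSteps (R : CommutativeRing c ℓ) where
  open RingOps R hiding (zero)
  open Relation.Binary.Reasoning.Setoid setoid
  open Solver commutativeSemiring using (solve; _:+_; _:*_; _:=_)
  open Algebra.Properties.Ring ring using (+-cancelʳ)

  ∏-suc : ∀ n (f : ℕ → Carrier) → (∏[1≤ i ≤ suc n ] f i) ≈ (∏[1≤ i ≤ n ] f i) * f (suc n)
  ∏-suc n f = trans (Algebra.Properties.Monoid.Sum.sum-init-last *-monoid {n} (λ i → f (suc (toℕ i))))
    (*-cong (reflexive (Algebra.Properties.Monoid.Sum.sum-cong-≗ *-monoid {n} λ i → ≡.cong (f ∘ suc) (Fin.toℕ-inject₁ i)))
      (reflexive (≡.cong (f ∘ suc) (Fin.toℕ-fromℕ n))))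

  divide : ∀ {a b c} (p : Unit b) → a * b ≈ c → a ≈ c / b [ p ]
  divide {a} {b} {c} p ab≈c = begin
    a                         ≈⟨ *-identityʳ a ⟨
    a * 1#                    ≈⟨ *-congˡ (Unit.isInverse p) ⟨
    a * (b * Unit.inverse p)  ≈⟨ *-assoc _ _ _ ⟨
    a * b * Unit.inverse p    ≈⟨ *-congʳ ab≈c ⟩
    c / b [ p ]               ∎

  divide-* : ∀ {a b c d} (p : Unit b) → a * b ≈ c * d → a ≈ c / b [ p ] * d
  divide-* p ab≈cd = trans (divide p ab≈cd) (solve 3 (λ c d i → c :* d :* i := c :* i :* d) refl _ _ _)

  minus-plus : ∀ a b → (a - b) + b ≈ a
  minus-plus a b = trans (+-assoc _ _ _) (trans (+-congˡ (-‿inverseˡ b)) (+-identityʳ a))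

  module _ {x v t q M D : Carrier} where
    strict-quotient : t * v * D + x * M ≈ q * M → M * (q - x) ≈ v * t * D
    strict-quotient e = +-cancelʳ (x * M) _ _ (begin
      M * (q - x) + x * M    ≈⟨ solve 3 (λ M d x → M :* d :+ x :* M := (d :+ x) :* M) refl M _ x ⟩
      ((q - x) + x) * M      ≈⟨ *-congʳ (minus-plus q x) ⟩
      q * M                  ≈⟨ e ⟨
      t * v * D + x * M      ≈⟨ +-congʳ (*-congʳ (*-comm t v)) ⟩
      v * t * D + x * M      ∎)

    -- Substituting M = vtD / (q - x) turns D + xM into D (1 - xvt / (x - q)), which for q = (1 -
    -- t)ⁱ adds the i-th factor of the first product.
    strict-product : M * (q - x) ≈ v * t * D → (D + x * M) * (x - q) ≈ D * ((x - q) - x * v * t)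
    strict-product e = +-cancelʳ (x * (v * t * D)) _ _ (begin
      (D + x * M) * (x - q) + x * (v * t * D)
        ≈⟨ +-congˡ (*-congˡ e) ⟨
      (D + x * M) * (x - q) + x * (M * (q - x))
        ≈⟨ solve 5 (λ D x M a b → (D :+ x :* M) :* a :+ x :* (M :* b) := D :* a :+ x :* M :* (a :+ b)) refl D x M _ _ ⟩
      D * (x - q) + x * M * ((x - q) + (q - x))
        ≈⟨ +-congˡ (trans (*-congˡ (trans (+-congˡ (sym (neg-minus x q))) (-‿inverseʳ (x - q)))) (zeroʳ _)) ⟩
      D * (x - q) + 0#
        ≈⟨ +-identityʳ _ ⟩
      D * (x - q)
        ≈⟨ *-congˡ (minus-plus (x - q) (x * v * t)) ⟨
      D * (((x - q) - x * v * t) + x * v * t)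
        ≈⟨ solve 5 (λ D a x v t → D :* (a :+ x :* v :* t) := D :* a :+ x :* (v :* t :* D)) refl D _ x v t ⟩
      D * ((x - q) - x * v * t) + x * (v * t * D) ∎)

  module _ {x v t q M D D′ : Carrier} (D′≈ : D′ ≈ D + x * M) where
    weak-quotient : M + q * (t * v * D′) ≈ q * (x * M) → M * (x * q - 1#) ≈ v * t * q * D′
    weak-quotient e = +-cancelʳ (1# * M) _ _ (begin
      M * (x * q - 1#) + 1# * M   ≈⟨ solve 3 (λ M d o → M :* d :+ o :* M := (d :+ o) :* M) refl M _ 1# ⟩
      ((x * q - 1#) + 1#) * M     ≈⟨ *-congʳ (minus-plus (x * q) 1#) ⟩
      x * q * M                   ≈⟨ solve 3 (λ x q M → x :* q :* M := q :* (x :* M)) refl x q M ⟩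
      q * (x * M)                 ≈⟨ e ⟨
      M + q * (t * v * D′)        ≈⟨ solve 5 (λ M q t v d → M :+ q :* (t :* v :* d) := v :* t :* q :* d :+ M) refl M q t v D′ ⟩
      v * t * q * D′ + M          ≈⟨ +-congˡ (*-identityˡ M) ⟨
      v * t * q * D′ + 1# * M     ∎)

    -- Here M is a multiple of D′ and not of D, so D = D′ - xM expresses the old product through the
    -- new one. The factor is therefore obtained upside down: D = D′ (xq(vt - 1) + 1) / (1 - xq).
    weak-product : M * (x * q - 1#) ≈ v * t * q * D′ → D′ * (x * q * (v * t - 1#) + 1#) ≈ D * (1# - x * q)
    weak-product e = +-cancelʳ (D′ * (x * q * 1#)) _ _ (begin
      D′ * (x * q * (v * t - 1#) + 1#) + D′ * (x * q * 1#)
        ≈⟨ solve 5 (λ D′ x q g o → D′ :* (x :* q :* g :+ o) :+ D′ :* (x :* q :* o) := D′ :* (x :* q :* (g :+ o) :+ o))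
             refl D′ x q (v * t - 1#) 1# ⟩
      D′ * (x * q * ((v * t - 1#) + 1#) + 1#)
        ≈⟨ *-congˡ (+-congʳ (*-congˡ (minus-plus (v * t) 1#))) ⟩
      D′ * (x * q * (v * t) + 1#)
        ≈⟨ solve 6 (λ D′ x q v t o → D′ :* (x :* q :* (v :* t) :+ o) := x :* (v :* t :* q :* D′) :+ o :* D′) refl D′ x q v t 1# ⟩
      x * (v * t * q * D′) + 1# * D′
        ≈⟨ +-cong (*-congˡ (sym e)) (*-congˡ D′≈) ⟩
      x * (M * (x * q - 1#)) + 1# * (D + x * M)
        ≈⟨ solve 5 (λ x M g o D → x :* (M :* g) :+ o :* (D :+ x :* M) := x :* (M :* (g :+ o)) :+ D :* o) refl x M (x * q - 1#) 1# D ⟩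
      x * (M * ((x * q - 1#) + 1#)) + D * 1#
        ≈⟨ +-cong (*-congˡ (*-congˡ (minus-plus (x * q) 1#))) (*-congˡ (sym (minus-plus 1# (x * q)))) ⟩
      x * (M * (x * q)) + D * ((1# - x * q) + x * q)
        ≈⟨ solve 5 (λ x M q D f → x :* (M :* (x :* q)) :+ D :* (f :+ x :* q) := D :* f :+ (D :+ x :* M) :* (x :* q))
             refl x M q D (1# - x * q) ⟩
      D * (1# - x * q) + (D + x * M) * (x * q)
        ≈⟨ +-congˡ (*-cong (sym D′≈) (sym (*-identityʳ _))) ⟩
      D * (1# - x * q) + D′ * (x * q * 1#) ∎)

module ClosedForms (K : CommutativeRing c ℓ) (v₀ : CommutativeRing.Carrier K) where
  private
    module Sx = Series K
    module X = RingOps Sx.powerSeries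
    module St = Series Sx.powerSeries
  open RightHandSides K v₀
  open RingOps St.powerSeries hiding (zero)
  open ClosedFormSteps St.powerSeries
  open Relation.Binary.Reasoning.Setoid setoid

  -- Scaling each letter by s absorbs the denominators (1 - x)ⁿ. At infinity 1 / (1 - u) = -w / (1 -
  -- w) with w = u⁻¹; its sign is moved into `s₋`, so that t itself keeps its sign.
  y s s₋ : X.Carrier
  y = X.1# X.- Sx.X
  s = X.Unit.inverse Sx.unit-1-X
  s₋ = X.- s

  x+y≈1 : Sx.X X.+ y X.≈ X.1#
  x+y≈1 = X.trans {Sx.X X.+ y} {y X.+ Sx.X} (X.+-comm Sx.X y) (ClosedFormSteps.minus-plus Sx.powerSeries X.1# Sx.X)

  sy≈1 : s X.* y X.≈ X.1#
  sy≈1 = X.trans {s X.* y} {y X.* s} (X.*-comm s y) (X.Unit.isInverse Sx.unit-1-X)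

  s₋y+1≈0 : s₋ X.* y X.+ X.1# X.≈ X.0#
  s₋y+1≈0 = X.trans {s₋ X.* y X.+ X.1#} {X.- (s X.* y) X.+ s X.* y}
    (X.+-cong {s₋ X.* y} {X.- (s X.* y)} {X.1#} {s X.* y}
      (X.sym {X.- (s X.* y)} {s₋ X.* y} (Algebra.Properties.Ring.-‿distribˡ-* X.ring s y)) (X.sym {s X.* y} sy≈1))
    (X.-‿inverseˡ (s X.* y))

  below-induction : ∀ k (Q : ℕ → Set ℓ) → Q 0 → (∀ (m : Fin k) → Q (toℕ m) → Q (suc (toℕ m))) → ∀ j → j ℕ.≤ k → Q j
  below-induction k Q base stp zero    _   = base
  below-induction k Q base stp (suc j) j<k = ≡.subst (Q ∘ suc) (Fin.toℕ-fromℕ< j<k)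
    (stp (fromℕ< j<k) (≡.subst Q (≡.sym (Fin.toℕ-fromℕ< j<k)) (below-induction k Q base stp j (ℕ.<⇒≤ j<k))))

  module _ (k : ℕ) where
    open GeneratingFunctions Sx.powerSeries Sx.X (Sx.C v₀) s (strictly k)

    private
      factor : ℕ → Carrier
      factor i = ((x - (1# - t) ^ i) - x * v * t) / (x - (1# - t) ^ i) [ unit₂ i ]

      quotient : ∀ m → M̂ m * ((1# - t) ^ suc (toℕ m) - x) ≈ v * t * D (toℕ m)
      quotient m = strict-quotient {x} {v} {t} {(1# - t) ^ suc (toℕ m)} {M̂ m} {D (toℕ m)}
        (strict-equation Sx.powerSeries Sx.X (Sx.C v₀) s y k x+y≈1 sy≈1 m)

      D-product : ∀ j → j ℕ.≤ k → D j ≈ (∏[1≤ i ≤ j ] factor i)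
      D-product = below-induction k (λ j → D j ≈ (∏[1≤ i ≤ j ] factor i)) D-zero λ m h → begin
        D (suc (toℕ m))
          ≈⟨ D-suc m ⟩
        D (toℕ m) + x * M̂ m
          ≈⟨ divide (unit₂ (suc (toℕ m)))
               (strict-product {x} {v} {t} {(1# - t) ^ suc (toℕ m)} {M̂ m} {D (toℕ m)} (quotient m)) ⟩
        D (toℕ m) * ((x - (1# - t) ^ suc (toℕ m)) - x * v * t) / (x - (1# - t) ^ suc (toℕ m)) [ unit₂ (suc (toℕ m)) ]
          ≈⟨ *-assoc (D (toℕ m)) ((x - (1# - t) ^ suc (toℕ m)) - x * v * t) (Unit.inverse (unit₂ (suc (toℕ m)))) ⟩
        D (toℕ m) * factor (suc (toℕ m))
          ≈⟨ *-congʳ {factor (suc (toℕ m))} h ⟩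
        (∏[1≤ i ≤ toℕ m ] factor i) * factor (suc (toℕ m))
          ≈⟨ ∏-suc (toℕ m) factor ⟨
        (∏[1≤ i ≤ suc (toℕ m) ] factor i) ∎

    M̂≈firstSummand : ∀ m → M̂ m ≈ firstSummand (suc (toℕ m))
    M̂≈firstSummand m = trans {M̂ m} (divide-* {M̂ m} {(1# - t) ^ suc (toℕ m) - x} {v * t} {D (toℕ m)}
        (unit₁ (suc (toℕ m))) (quotient m))
      (*-congˡ {v * t / ((1# - t) ^ suc (toℕ m) - x) [ unit₁ (suc (toℕ m)) ]} (D-product (toℕ m) (ℕ.<⇒≤ (Fin.toℕ<n m))))

  module _ (k : ℕ) where
    open GeneratingFunctions Sx.powerSeries Sx.X (Sx.C v₀) s₋ (weakly k)

    private
      factor : ℕ → Carrier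
      factor i = (1# - x * (1# - t) ^ (i ℕ.∸ 1)) / (x * (1# - t) ^ (i ℕ.∸ 1) * (v * t - 1#) + 1#) [ unit₄ (i ℕ.∸ 1) ]

      quotient : ∀ m → M̂ m * (x * (1# - t) ^ toℕ m - 1#) ≈ v * t * (1# - t) ^ toℕ m * D (suc (toℕ m))
      quotient m = weak-quotient {x} {v} {t} {(1# - t) ^ toℕ m} {M̂ m} {D (toℕ m)} {D (suc (toℕ m))} (D-suc m)
        (weak-equation Sx.powerSeries Sx.X (Sx.C v₀) s₋ y k x+y≈1 s₋y+1≈0 m)

      D-product : ∀ j → j ℕ.≤ k → D j ≈ (∏[1≤ i ≤ j ] factor i)
      D-product = below-induction k (λ j → D j ≈ (∏[1≤ i ≤ j ] factor i)) D-zero λ m h → begin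
        D (suc (toℕ m))
          ≈⟨ divide (unit₄ (toℕ m)) (weak-product {x} {v} {t} {(1# - t) ^ toℕ m} {M̂ m} {D (toℕ m)} {D (suc (toℕ m))}
               (D-suc m) (quotient m)) ⟩
        D (toℕ m) * (1# - x * (1# - t) ^ toℕ m) / (x * (1# - t) ^ toℕ m * (v * t - 1#) + 1#) [ unit₄ (toℕ m) ]
          ≈⟨ *-assoc (D (toℕ m)) (1# - x * (1# - t) ^ toℕ m) (Unit.inverse (unit₄ (toℕ m))) ⟩
        D (toℕ m) * factor (suc (toℕ m))
          ≈⟨ *-congʳ {factor (suc (toℕ m))} h ⟩
        (∏[1≤ i ≤ toℕ m ] factor i) * factor (suc (toℕ m))
          ≈⟨ ∏-suc (toℕ m) factor ⟨
        (∏[1≤ i ≤ suc (toℕ m) ] factor i) ∎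

    M̂≈secondSummand : ∀ m → M̂ m ≈ secondSummand (suc (toℕ m))
    M̂≈secondSummand m = trans {M̂ m} (divide-* {M̂ m} {x * (1# - t) ^ toℕ m - 1#} {v * t * (1# - t) ^ toℕ m} {D (suc (toℕ m))}
        (unit₃ (toℕ m)) (quotient m))
      -- The product has m + 1 factors because `quotient` expresses M through D (m + 1).
      (*-congˡ {v * t * (1# - t) ^ toℕ m / (x * (1# - t) ^ toℕ m - 1#) [ unit₃ (toℕ m) ]} (D-product (suc (toℕ m)) (Fin.toℕ<n m)))

-- Symmetries

module Symmetries (R : CommutativeRing c ℓ) where
  open RingOps R hiding (zero)
  open Sums R
  open Relation.Binary.Reasoning.Setoid setoid
  open Solver commutativeSemiring using (solve; _:*_; _:=_)

  1^ : ∀ n → 1# ^ n ≈ 1#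
  1^ zero    = refl
  1^ (suc n) = trans (*-identityˡ _) (1^ n)

  -- A `Unit` carries a chosen inverse, and 𝒢 divides by denominators whose factors come in
  -- different orders; uniqueness makes the quotients comparable.
  inverse-unique : ∀ {a b c d} → a * b ≈ 1# → c * d ≈ 1# → a ≈ c → b ≈ d
  inverse-unique {a} {b} {c} {d} p q a≈c = begin
    b             ≈⟨ *-identityʳ b ⟨
    b * 1#        ≈⟨ *-congˡ q ⟨
    b * (c * d)   ≈⟨ *-congˡ (*-congʳ a≈c) ⟨
    b * (a * d)   ≈⟨ solve 3 (λ a b d → b :* (a :* d) := a :* b :* d) refl a b d ⟩
    a * b * d     ≈⟨ *-congʳ p ⟩
    1# * d        ≈⟨ *-identityˡ d ⟩
    d             ∎

  /-cong : ∀ {a b c d} (p : Unit b) (q : Unit d) → a ≈ c → b ≈ d → a / b [ p ] ≈ c / d [ q ]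
  /-cong p q a≈c b≈d = *-cong a≈c (inverse-unique (Unit.isInverse p) (Unit.isInverse q) b≈d)

  term : (x u v q z : Carrier) → Permutation n n → Carrier
  term x u v q z π = u ^ des π * x ^ ides π * q ^ lmin π * v ^ rmax π * z ^ lmax π

  drop-1 : ∀ a b k l → a * 1# ^ k * b * 1# ^ l ≈ a * b
  drop-1 a b k l = trans (*-cong (*-congʳ (trans (*-congˡ (1^ k)) (*-identityʳ a))) (1^ l)) (*-identityʳ _)

  reduced : ∀ x u v (π : Permutation n n) → term x u v 1# 1# π ≈ u ^ des π * x ^ ides π * v ^ rmax π
  reduced x u v π = drop-1 _ _ (lmin π) (lmax π)

  ^-congʳ : ∀ a {m n} → m ≡ n → a ^ m ≈ a ^ n
  ^-congʳ a ≡.refl = refl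

  module _ (x u v : Carrier) (1-x : Unit (1# - x)) (1-u : Unit (1# - u)) where
    private
      D : ∀ n → Unit ((1# - u) ^ n * (1# - x) ^ n)
      D n = unit-* (unit-^ n 1-u) (unit-^ n 1-x)

      D′ : ∀ n → Unit ((1# - x) ^ n * (1# - u) ^ n)
      D′ n = unit-* (unit-^ n 1-x) (unit-^ n 1-u)

    𝒢-flip : ∀ n → 𝒢 R x u v 1# 1# 1-x 1-u n ≈ 𝒢 R u x v 1# 1# 1-u 1-x n
    𝒢-flip zero      = refl
    𝒢-flip n@(suc _) = begin
      ∑ (permutations n) (λ π → term x u v 1# 1# π / _ [ D n ])
        ≈⟨ ∑-cong (λ π → /-cong (D n) (D′ n) (trans (reduced x u v π) (*-cong (*-comm _ _) (^-congʳ v (≡.sym (rmax-flip π)))))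
             (*-comm _ _)) (permutations n) ⟩
      ∑ (permutations n) (w ∘ flip)
        ≈⟨ ∑-flip w (λ {π} {ρ} p → *-congʳ (*-cong (*-cong (^-congʳ x (des-cong {π = π} {ρ} p))
             (^-congʳ u (ides-cong {π = π} {ρ} p))) (^-congʳ v (rmax-cong {π = π} {ρ} p)))) ⟩
      ∑ (permutations n) w
        ≈⟨ ∑-cong (λ π → *-congʳ (sym (reduced u x v π))) (permutations n) ⟩
      ∑ (permutations n) (λ π → term u x v 1# 1# π / _ [ D′ n ]) ∎
      where
      w : Permutation n n → Carrier
      w π = (x ^ des π * u ^ ides π * v ^ rmax π) / _ [ D′ n ]

    𝒢-reverseComplement : ∀ n → 𝒢 R x u 1# v 1# 1-x 1-u n ≈ 𝒢 R x u v 1# 1# 1-x 1-u n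
    𝒢-reverseComplement zero      = refl
    𝒢-reverseComplement n@(suc _) = begin
      ∑ (permutations n) (λ π → term x u 1# v 1# π / _ [ D n ])
        ≈⟨ ∑-cong (λ π → *-congʳ (drop π)) (permutations n) ⟩
      ∑ (permutations n) w
        ≈⟨ ∑-reverseComplement w (λ {π} {ρ} p → *-congʳ (*-cong (*-cong (^-congʳ u (des-cong {π = π} {ρ} p))
             (^-congʳ x (ides-cong {π = π} {ρ} p))) (^-congʳ v (lmin-cong {π = π} {ρ} p)))) ⟨
      ∑ (permutations n) (w ∘ reverseComplement)
        ≈⟨ ∑-cong (λ π → *-congʳ (trans (*-cong (*-cong (^-congʳ u (des-reverseComplement π))
             (^-congʳ x (ides-reverseComplement π))) (^-congʳ v (lmin-reverseComplement π)))
             (sym (reduced x u v π)))) (permutations n) ⟩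
      ∑ (permutations n) (λ π → term x u v 1# 1# π / _ [ D n ]) ∎
      where
      w : Permutation n n → Carrier
      w π = (u ^ des π * x ^ ides π * v ^ lmin π) / _ [ D n ]
      drop : ∀ π → term x u 1# v 1# π ≈ u ^ des π * x ^ ides π * v ^ lmin π
      drop π = trans (*-cong (trans (*-congˡ (1^ (rmax π))) (*-identityʳ _)) (1^ (lmax π))) (*-identityʳ _)

symmetries : (let open Rational in
    (𝒢 ℚ⟨x,u⟩[v] x u v 1# 1# unit-1-x unit-1-u ≈ₛ 𝒢 ℚ⟨x,u⟩[v] u x 1# v 1# unit-1-u unit-1-x)
    × (𝒢 ℚ⟨x,u⟩[v] u x 1# v 1# unit-1-u unit-1-x ≈ₛ 𝒢 ℚ⟨x,u⟩[v] x u 1# v 1# unit-1-x unit-1-u)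
    × (𝒢 ℚ⟨x,u⟩[v] x u 1# v 1# unit-1-x unit-1-u ≈ₛ 𝒢 ℚ⟨x,u⟩[v] u x v 1# 1# unit-1-u unit-1-x))
symmetries =
    (λ n → trans {G₁ n} {G₄ n} {G₂ n} (G₁≈G₄ n) (sym {G₂ n} {G₄ n} (G₂≈G₄ n)))
  , (λ n → trans {G₂ n} {G₄ n} {G₃ n} (G₂≈G₄ n)
      (trans {G₄ n} {G₁ n} {G₃ n} (sym {G₁ n} {G₄ n} (G₁≈G₄ n)) (sym {G₃ n} {G₁ n} (G₃≈G₁ n))))
  , λ n → trans {G₃ n} {G₁ n} {G₄ n} (G₃≈G₁ n) (G₁≈G₄ n)
  where
  open Rational
  open CommutativeRing ℚ⟨x,u⟩[v] using (_≈_; sym; trans; Carrier)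
  open Symmetries ℚ⟨x,u⟩[v]
  G₁ G₂ G₃ G₄ : ℕ → Carrier
  G₁ = 𝒢 ℚ⟨x,u⟩[v] x u v 1# 1# unit-1-x unit-1-u
  G₂ = 𝒢 ℚ⟨x,u⟩[v] u x 1# v 1# unit-1-u unit-1-x
  G₃ = 𝒢 ℚ⟨x,u⟩[v] x u 1# v 1# unit-1-x unit-1-u
  G₄ = 𝒢 ℚ⟨x,u⟩[v] u x v 1# 1# unit-1-u unit-1-x
  G₁≈G₄ : ∀ n → G₁ n ≈ G₄ n
  G₁≈G₄ = 𝒢-flip x u v unit-1-x unit-1-u
  G₃≈G₁ : ∀ n → G₃ n ≈ G₁ n
  G₃≈G₁ = 𝒢-reverseComplement x u v unit-1-x unit-1-u
  G₂≈G₄ : ∀ n → G₂ n ≈ G₄ n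
  G₂≈G₄ = 𝒢-reverseComplement u x v unit-1-u unit-1-x

-- Expansions of 𝒢

module Characterisation (R : CommutativeRing c ℓ) where
  open RingOps R hiding (zero)
  open Sums R
  open Symmetries R using (reduced; ^-congʳ; 1^)
  open ClosedFormSteps R using (divide)
  open Relation.Binary.Reasoning.Setoid setoid
  open Solver commutativeSemiring using (solve; _:+_; _:*_; _:=_)
  open Algebra.Properties.CommutativeSemiring.Exp commutativeSemiring using (^-distrib-*)

  ascentWeight : (x v : Carrier) → Permutation n n → Carrier
  ascentWeight {n} x v τ = x ^ adjacent (less? n) (τ ⟨$⟩ʳ_) * v ^ rightRecords (less? n) (τ ⟨$⟩ʳ_)

  -- The substitution that matches 𝒢 with the word sums is π = (complement of τ)⁻¹: des turns into
  -- the ascents of τ⁻¹, ides into the ascents of τ, and rmax into the right-to-left minima of τ,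
  -- the last one because rmax is invariant under inversion.
  des-flip-complement : (τ : Permutation (suc n) (suc n)) → des (flip (τ ∘ₚ reverse)) ≡ # (inverseAscents τ)
  des-flip-complement {n} τ = ≡.trans (des≡adjacent (flip (τ ∘ₚ reverse)))
    (adjacent-opposite (greater? (suc n)) (τ ⟨$⟩ˡ_))

  ides-flip-complement : (τ : Permutation n n) → ides (flip (τ ∘ₚ reverse)) ≡ adjacent (less? n) (τ ⟨$⟩ʳ_)
  ides-flip-complement τ = ≡.trans (des≡adjacent (τ ∘ₚ reverse)) (adjacent-complement (τ ⟨$⟩ʳ_))

  rmax-flip-complement : (τ : Permutation n n) → rmax (flip (τ ∘ₚ reverse)) ≡ rightRecords (less? n) (τ ⟨$⟩ʳ_)
  rmax-flip-complement {n} τ = ≡.trans (rmax-flip (τ ∘ₚ reverse)) (≡.trans (rmax≡rightRecords (τ ∘ₚ reverse))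
    (rightRecords-cong (greater? n) (less? n) λ p q _ →
      mk⇔ (opposite-<⁻¹ {i = τ ⟨$⟩ʳ q} {τ ⟨$⟩ʳ p}) (opposite-< {i = τ ⟨$⟩ʳ p} {τ ⟨$⟩ʳ q})))

  ∑-descents≈∑-ascents : ∀ n x u v →
    ∑ (permutations (suc n)) (λ π → u ^ des π * x ^ ides π * v ^ rmax π) ≈
    ∑ (permutations (suc n)) λ τ → u ^ # (inverseAscents τ) * ascentWeight x v τ
  ∑-descents≈∑-ascents n x u v = begin
    ∑ (permutations (suc n)) w
      ≈⟨ ∑-flip w (λ {π} {ρ} p → w-cong {π} {ρ} p) ⟨
    ∑ (permutations (suc n)) (w ∘ flip)
      ≈⟨ ∑-∘reverse (w ∘ flip) (λ {π} {ρ} p → w-cong {flip π} {flip ρ} (flip-cong {π = π} {ρ} p)) ⟨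
    ∑ (permutations (suc n)) (λ τ → w (flip (τ ∘ₚ reverse)))
      ≈⟨ ∑-cong (λ τ → trans (*-cong (*-cong (^-congʳ u (des-flip-complement τ)) (^-congʳ x (ides-flip-complement τ)))
           (^-congʳ v (rmax-flip-complement τ))) (*-assoc _ _ _)) (permutations (suc n)) ⟩
    ∑ (permutations (suc n)) (λ τ → u ^ # (inverseAscents τ) * ascentWeight x v τ) ∎
    where
    w : Permutation (suc n) (suc n) → Carrier
    w π = u ^ des π * x ^ ides π * v ^ rmax π
    w-cong : ∀ {π ρ} → π Perm.≈ ρ → w π ≈ w ρ
    w-cong {π} {ρ} p = *-cong (*-cong (^-congʳ u (des-cong {π = π} {ρ} p)) (^-congʳ x (ides-cong {π = π} {ρ} p)))
      (^-congʳ v (rmax-cong {π = π} {ρ} p))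

  module _ (x u v : Carrier) (1-x : Unit (1# - x)) (1-u : Unit (1# - u)) where
    -- The denominator is invertible, so the numerator equation determines the coefficient. Both
    -- expansions are verified through this equation.
    𝒢-unique : ∀ n {g} → g * ((1# - u) ^ suc n * (1# - x) ^ suc n) ≈
                 ∑ (permutations (suc n)) (λ τ → u ^ # (inverseAscents τ) * ascentWeight x v τ) →
               𝒢 R x u v 1# 1# 1-x 1-u (suc n) ≈ g
    𝒢-unique n {g} h = sym (begin
      g
        ≈⟨ divide den h ⟩
      ∑ (permutations (suc n)) (λ τ → u ^ # (inverseAscents τ) * ascentWeight x v τ) / _ [ den ]
        ≈⟨ *-congʳ (∑-descents≈∑-ascents n x u v) ⟨
      ∑ (permutations (suc n)) (λ π → u ^ des π * x ^ ides π * v ^ rmax π) / _ [ den ]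
        ≈⟨ ∑-*ʳ (Unit.inverse den) (permutations (suc n)) _ ⟨
      ∑ (permutations (suc n)) (λ π → (u ^ des π * x ^ ides π * v ^ rmax π) / _ [ den ])
        ≈⟨ ∑-cong (λ π → *-congʳ (sym (reduced x u v π))) (permutations (suc n)) ⟩
      𝒢 R x u v 1# 1# 1-x 1-u (suc n) ∎)
      where
      den : Unit ((1# - u) ^ suc n * (1# - x) ^ suc n)
      den = unit-* (unit-^ (suc n) 1-u) (unit-^ (suc n) 1-x)

  module _ {x u σ j : Carrier} {n : ℕ} (p w : A → Carrier) (xs : List A) where
    -- All denominators collapse into the n-th power of κ = σ(1 - x) · j(1 - u). In the expansion at
    -- zero κ = 1; at infinity both factors contribute a sign and κ = u.
    clear-denominators :
      σ ^ n * ∑ xs (λ τ → w τ * (p τ * j ^ n)) * ((1# - u) ^ n * (1# - x) ^ n) ≈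
      ∑ xs (λ τ → p τ * w τ) * ((σ * (1# - x)) * (j * (1# - u))) ^ n
    clear-denominators = begin
      σ ^ n * ∑ xs (λ τ → w τ * (p τ * j ^ n)) * (U * X)
        ≈⟨ *-congʳ (*-congˡ (trans (∑-cong (λ τ → solve 3 (λ w p j → w :* (p :* j) := p :* w :* j) refl _ _ _) xs)
             (∑-*ʳ (j ^ n) xs _))) ⟩
      σ ^ n * (Σ * j ^ n) * (U * X)
        ≈⟨ solve 5 (λ σ Σ j U X → σ :* (Σ :* j) :* (U :* X) := Σ :* ((σ :* X) :* (j :* U))) refl (σ ^ n) Σ (j ^ n) U X ⟩
      Σ * ((σ ^ n * X) * (j ^ n * U))
        ≈⟨ *-congˡ (trans (*-cong (sym (^-distrib-* σ (1# - x) n)) (sym (^-distrib-* j (1# - u) n)))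
             (sym (^-distrib-* (σ * (1# - x)) (j * (1# - u)) n))) ⟩
      Σ * ((σ * (1# - x)) * (j * (1# - u))) ^ n ∎
      where
      U X Σ : Carrier
      U = (1# - u) ^ n
      X = (1# - x) ^ n
      Σ = ∑ xs λ τ → p τ * w τ

  finite-expansion : ∀ {x u σ j} n (w : Permutation (suc n) (suc n) → Carrier) →
    σ * (1# - x) ≈ 1# → (1# - u) * j ≈ 1# →
    σ ^ suc n * ∑ (permutations (suc n)) (λ τ → w τ * (u ^ # (inverseAscents τ) * j ^ suc n)) *
      ((1# - u) ^ suc n * (1# - x) ^ suc n) ≈
    ∑ (permutations (suc n)) λ τ → u ^ # (inverseAscents τ) * w τ
  finite-expansion {x} {u} {σ} {j} n w p q = trans
    (clear-denominators {x = x} {u} {σ} {j} {suc n} _ w (permutations (suc n)))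
    (trans (*-congˡ (trans (^-congˡ (suc n) (trans (*-cong p (trans (*-comm _ _) q)) (*-identityˡ 1#))) (1^ (suc n))))
      (*-identityʳ _))
    where open Algebra.Properties.Semiring.Exp semiring using (^-congˡ)

  -- Here r = u⁻¹. If τ⁻¹ has e ascents, it has n - e other places, whereas uᵉ / (1 - u)ⁿ⁺¹ requires
  -- the power n + 1 - e of r. The r in front makes up the difference and shifts the second series
  -- by one place.
  infinite-expansion : ∀ {x u σ j r} n (w : Permutation (suc n) (suc n) → Carrier) →
    σ * (1# - x) + 1# ≈ 0# → (1# - r) * j ≈ 1# → u * r ≈ 1# →
    r * (σ ^ suc n * ∑ (permutations (suc n)) (λ τ → w τ * (r ^ # (not ∘ inverseAscents τ) * j ^ suc n))) *
      ((1# - u) ^ suc n * (1# - x) ^ suc n) ≈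
    ∑ (permutations (suc n)) λ τ → u ^ # (inverseAscents τ) * w τ
  infinite-expansion {x} {u} {σ} {j} {r} n w p q ur≈1 = begin
    r * (σ ^ suc n * ∑ (permutations (suc n)) (λ τ → w τ * (r ^ e τ * j ^ suc n))) * ((1# - u) ^ suc n * (1# - x) ^ suc n)
      ≈⟨ *-assoc r _ _ ⟩
    r * (σ ^ suc n * ∑ (permutations (suc n)) (λ τ → w τ * (r ^ e τ * j ^ suc n)) * ((1# - u) ^ suc n * (1# - x) ^ suc n))
      ≈⟨ *-congˡ (clear-denominators {x = x} {u} {σ} {j} {suc n} _ w (permutations (suc n))) ⟩
    r * (∑ (permutations (suc n)) (λ τ → r ^ e τ * w τ) * ((σ * (1# - x)) * (j * (1# - u))) ^ suc n)
      ≈⟨ *-congˡ (*-congˡ (^-congˡ (suc n) κ≈u)) ⟩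
    r * (∑ (permutations (suc n)) (λ τ → r ^ e τ * w τ) * u ^ suc n)
      ≈⟨ solve 3 (λ r Σ v → r :* (Σ :* v) := r :* v :* Σ) refl r _ _ ⟩
    r * u ^ suc n * ∑ (permutations (suc n)) (λ τ → r ^ e τ * w τ)
      ≈⟨ ∑-*ˡ (r * u ^ suc n) (permutations (suc n)) _ ⟨
    ∑ (permutations (suc n)) (λ τ → r * u ^ suc n * (r ^ e τ * w τ))
      ≈⟨ ∑-cong (λ τ → trans (solve 5 (λ r u v s w → r :* (u :* v) :* (s :* w) := (u :* r) :* (v :* s) :* w) refl r u _ _ _)
           (*-congʳ (trans (*-congʳ ur≈1) (trans (*-identityˡ _) (cancel τ))))) (permutations (suc n)) ⟩
    ∑ (permutations (suc n)) (λ τ → u ^ # (inverseAscents τ) * w τ) ∎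
    where
    open Algebra.Properties.Semiring.Exp semiring using (^-congˡ; ^-homo-*)
    open Algebra.Properties.Ring ring using (+-cancelʳ)
    open ClosedFormSteps R using (minus-plus)

    e : Permutation (suc n) (suc n) → ℕ
    e τ = # (not ∘ inverseAscents τ)

    cancel : ∀ τ → u ^ n * r ^ e τ ≈ u ^ # (inverseAscents τ)
    cancel τ = begin
      u ^ n * r ^ e τ
        ≈⟨ *-congʳ (^-congʳ u (≡.sym (#-not (inverseAscents τ)))) ⟩
      u ^ (# (inverseAscents τ) ℕ.+ e τ) * r ^ e τ
        ≈⟨ *-congʳ (^-homo-* u (# (inverseAscents τ)) (e τ)) ⟩
      u ^ # (inverseAscents τ) * u ^ e τ * r ^ e τ
        ≈⟨ *-assoc _ _ _ ⟩
      u ^ # (inverseAscents τ) * (u ^ e τ * r ^ e τ)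
        ≈⟨ *-congˡ (trans (sym (^-distrib-* u r (e τ))) (trans (^-congˡ (e τ) ur≈1) (1^ (e τ)))) ⟩
      u ^ # (inverseAscents τ) * 1#
        ≈⟨ *-identityʳ _ ⟩
      u ^ # (inverseAscents τ) ∎

    -- From u r = 1 follows 1 - u = -u(1 - r), and j is the inverse of 1 - r.
    j-1-u : j * (1# - u) + u ≈ 0#
    j-1-u = +-cancelʳ (j * (1# - r) * u) _ _ (begin
      j * (1# - u) + u + j * (1# - r) * u
        ≈⟨ solve 5 (λ j a u b o → j :* a :+ u :+ j :* b :* u := u :+ j :* (a :+ b :* u)) refl j (1# - u) u (1# - r) 1# ⟩
      u + j * ((1# - u) + (1# - r) * u)
        ≈⟨ +-congˡ (trans (*-congˡ telescope) (zeroʳ j)) ⟩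
      u + 0#
        ≈⟨ trans (+-identityʳ u) (sym (trans (+-identityˡ _) (trans (*-congʳ (trans (*-comm _ _) q)) (*-identityˡ u)))) ⟩
      0# + j * (1# - r) * u ∎)
      where
      telescope : (1# - u) + (1# - r) * u ≈ 0#
      telescope = +-cancelʳ (r * u) _ _ (begin
        (1# - u) + (1# - r) * u + r * u
          ≈⟨ solve 4 (λ a b u r → a :+ b :* u :+ r :* u := a :+ (b :+ r) :* u) refl (1# - u) (1# - r) u r ⟩
        (1# - u) + ((1# - r) + r) * u
          ≈⟨ +-congˡ (trans (*-congʳ (minus-plus 1# r)) (*-identityˡ u)) ⟩
        (1# - u) + u
          ≈⟨ minus-plus 1# u ⟩
        1#
          ≈⟨ trans (+-identityˡ _) (trans (*-comm r u) ur≈1) ⟨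
        0# + r * u ∎)

    κ≈u : (σ * (1# - x)) * (j * (1# - u)) ≈ u
    κ≈u = +-cancelʳ (j * (1# - u)) _ _ (begin
      (σ * (1# - x)) * (j * (1# - u)) + j * (1# - u)
        ≈⟨ +-congˡ (*-identityˡ _) ⟨
      (σ * (1# - x)) * (j * (1# - u)) + 1# * (j * (1# - u))
        ≈⟨ distribʳ _ _ _ ⟨
      (σ * (1# - x) + 1#) * (j * (1# - u))
        ≈⟨ trans (*-congʳ p) (zeroˡ _) ⟩
      0#
        ≈⟨ trans (+-comm u _) j-1-u ⟨
      u + j * (1# - u) ∎)

-- From word sums to the two expansions

module MaximumSeries (R : CommutativeRing c ℓ) (x v s : CommutativeRing.Carrier R) (𝒞 : ∀ k → Comparison k)
                     (strict : Bool → Bool) (strict≗ : ∀ k β → Comparison.strict (𝒞 k) β ≡ strict β) where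
  open RingOps R hiding (zero)
  open Sums R using (∑; ∑-cong)
  open Series R using (C; X; C-*ₛ; powerSeries; module S)
  open Hat R s
  open ChainCount R using (J; chainSeries)
  open WordSums R x v using (maximumSum; maximumSum≈∑-permutations)
  open Characterisation R using (ascentWeight)
  open Characterisation powerSeries using () renaming (ascentWeight to ascentWeightₛ)
  open Sums powerSeries using () renaming (∑ to ∑ₛ; ∑-cong to ∑ₛ-cong)

  ∑ₛ-coefficient : (f : A → ℕ → Carrier) (xs : List A) → ∀ m → ∑ₛ xs f m ≡ ∑ xs λ a → f a m
  ∑ₛ-coefficient f []       m = ≡.refl
  ∑ₛ-coefficient f (a ∷ as) m = ≡.cong (f a m +_) (∑ₛ-coefficient f as m)

  C-ascentWeight : (τ : Permutation n n) → C (ascentWeight x v τ) S.≈ ascentWeightₛ (C x) (C v) τ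
  C-ascentWeight {n} τ = S.trans {C (x ^ i * v ^ j)} {C (x ^ i) S.* C (v ^ j)} (C-* (x ^ i) (v ^ j))
    (S.*-cong {C (x ^ i)} {C x S.^ i} {C (v ^ j)} {C v S.^ j} (C-^ x i) (C-^ v j))
    where
    i j : ℕ
    i = adjacent (less? n) (τ ⟨$⟩ʳ_)
    j = rightRecords (less? n) (τ ⟨$⟩ʳ_)

  -- The alphabet {0,…,m} varies with m, being the smallest one that contains m.
  diagonal : ℕ → ℕ → Carrier
  diagonal n m = hat (λ n → maximumSum (𝒞 (suc m)) n (fromℕ m)) n

  -- The largest letter m is the coefficient index of the chain series. When m varies, the word sums
  -- become the coefficients of a single series, in u or in u⁻¹.
  diagonal≈ : ∀ n → diagonal (suc n) S.≈
    C s S.^ suc n S.* ∑ₛ (permutations (suc n)) λ τ →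
      ascentWeightₛ (C x) (C v) τ S.* (X S.^ # (strict ∘ inverseAscents τ) S.* J S.^ suc n)
  diagonal≈ n = S.trans {diagonal (suc n)} {C (s ^ suc n) S.* H} pointwise
    (S.*-cong {C (s ^ suc n)} {C s S.^ suc n} {H} {∑ₛ ps λ τ → ascentWeightₛ (C x) (C v) τ S.* Z τ} (C-^ s (suc n))
      (∑ₛ-cong (λ τ → S.*-congʳ {Z τ} (C-ascentWeight τ)) ps))
    where
    ps : List (Permutation (suc n) (suc n))
    ps = permutations (suc n)
    Z : Permutation (suc n) (suc n) → ℕ → Carrier
    Z τ = chainSeries (strict ∘ inverseAscents τ)
    H : ℕ → Carrier
    H = ∑ₛ ps λ τ → C (ascentWeight x v τ) S.* Z τ
    pointwise : diagonal (suc n) S.≈ C (s ^ suc n) S.* H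
    pointwise m = trans (*-congˡ (begin
      maximumSum (𝒞 (suc m)) n (fromℕ m)
        ≈⟨ maximumSum≈∑-permutations (𝒞 (suc m)) n (fromℕ m) ⟩
      ∑ ps (λ τ → ascentWeight x v τ * chainSeries (Comparison.strict (𝒞 (suc m)) ∘ inverseAscents τ) (toℕ (fromℕ m)))
        ≈⟨ ∑-cong (λ τ → *-congˡ (reflexive (≡.cong₂ (λ e i → (X S.^ e S.* J S.^ suc n) i)
             (#-cong {f = Comparison.strict (𝒞 (suc m)) ∘ inverseAscents τ} λ i → strict≗ (suc m) (inverseAscents τ i))
             (Fin.toℕ-fromℕ m)))) ps ⟩
      ∑ ps (λ τ → ascentWeight x v τ * Z τ m)
        ≈⟨ ∑-cong (λ τ → sym (C-*ₛ (ascentWeight x v τ) (Z τ) m)) ps ⟩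
      ∑ ps (λ τ → (C (ascentWeight x v τ) S.* Z τ) m)
        ≡⟨ ∑ₛ-coefficient (λ τ → C (ascentWeight x v τ) S.* Z τ) ps m ⟨
      H m ∎)) (sym (C-*ₛ (s ^ suc n) H m))
      where open Relation.Binary.Reasoning.Setoid setoid

module Transport (A : CommutativeRing c ℓ) (T : CommutativeRing c′ ℓ′)
                 (ι : CommutativeRing.Carrier A → CommutativeRing.Carrier T)
                 (isHomomorphism : IsRingHomomorphism (CommutativeRing.rawRing A) (CommutativeRing.rawRing T) ι) where
  private
    module A = RingOps A
    module T = RingOps T
    module AΣ = Sums A
    module TΣ = Sums T
    module AC = Characterisation A
    module TC = Characterisation T
  open IsRingHomomorphism isHomomorphism using (+-homo; *-homo; -‿homo; 0#-homo; 1#-homo)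
    renaming (⟦⟧-cong to ι-cong)
  open Relation.Binary.Reasoning.Setoid T.setoid

  ^-homo : ∀ a n → ι (a A.^ n) T.≈ ι a T.^ n
  ^-homo a zero    = 1#-homo
  ^-homo a (suc n) = T.trans (*-homo a (a A.^ n)) (T.*-congˡ (^-homo a n))

  ∑-homo : (w : B → A.Carrier) (xs : List B) → ι (AΣ.∑ xs w) T.≈ TΣ.∑ xs (ι ∘ w)
  ∑-homo w []       = 0#-homo
  ∑-homo w (x ∷ xs) = T.trans (+-homo (w x) (AΣ.∑ xs w)) (T.+-congˡ (∑-homo w xs))

  1-‿homo : ∀ a → ι (A.1# A.- a) T.≈ T.1# T.- ι a
  1-‿homo a = T.trans (+-homo A.1# (A.- a)) (T.+-cong 1#-homo (-‿homo a))

  module _ {x v r σ j : A.Carrier} {x′ v′ : T.Carrier} (x′≈ : ι x T.≈ x′) (v′≈ : ι v T.≈ v′) (n : ℕ)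
           (e : Permutation (suc n) (suc n) → ℕ) where
    private
      ps : List (Permutation (suc n) (suc n))
      ps = permutations (suc n)

      summand : Permutation (suc n) (suc n) → A.Carrier
      summand τ = AC.ascentWeight x v τ A.* (r A.^ e τ A.* j A.^ suc n)

      summand′ : Permutation (suc n) (suc n) → T.Carrier
      summand′ τ = TC.ascentWeight x′ v′ τ T.* (ι r T.^ e τ T.* ι j T.^ suc n)

      power : ∀ {a b} i → ι a T.≈ b → ι (a A.^ i) T.≈ b T.^ i
      power i p = T.trans (^-homo _ i) (Algebra.Properties.Semiring.Exp.^-congˡ T.semiring i p)

      summand-homo : ∀ τ → ι (summand τ) T.≈ summand′ τ
      summand-homo τ = T.trans (*-homo _ _) (T.*-cong
        (T.trans (*-homo _ _) (T.*-cong (power (adjacent (less? (suc n)) (τ ⟨$⟩ʳ_)) x′≈)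
          (power (rightRecords (less? (suc n)) (τ ⟨$⟩ʳ_)) v′≈)))
        (T.trans (*-homo _ _) (T.*-cong (^-homo r (e τ)) (^-homo j (suc n)))))

    expansion-homo : ∀ {d} → d A.≈ σ A.^ suc n A.* AΣ.∑ ps summand → ι d T.≈ ι σ T.^ suc n T.* TΣ.∑ ps summand′
    expansion-homo {d} d≈ = begin
      ι d                                              ≈⟨ ι-cong d≈ ⟩
      ι (σ A.^ suc n A.* AΣ.∑ ps summand)              ≈⟨ *-homo (σ A.^ suc n) _ ⟩
      ι (σ A.^ suc n) T.* ι (AΣ.∑ ps summand)          ≈⟨ T.*-cong (^-homo σ (suc n))
                                                            (T.trans (∑-homo summand ps) (TΣ.∑-cong summand-homo ps)) ⟩
      ι σ T.^ suc n T.* TΣ.∑ ps summand′ ∎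

  module _ {x v r σ j : A.Carrier} {d : ℕ → A.Carrier} {x′ u v′ : T.Carrier}
           (1-x : T.Unit (T.1# T.- x′)) (1-u : T.Unit (T.1# T.- u)) (x′≈ : ι x T.≈ x′) (v′≈ : ι v T.≈ v′)
           (j-inverse : (A.1# A.- r) A.* j A.≈ A.1#) where
    private
      σ-homo : ι (σ A.* (A.1# A.- x)) T.≈ ι σ T.* (T.1# T.- x′)
      σ-homo = T.trans (*-homo σ (A.1# A.- x)) (T.*-congˡ (T.trans (1-‿homo x) (T.+-congˡ (T.-‿cong x′≈))))

      j-inverse′ : (T.1# T.- ι r) T.* ι j T.≈ T.1#
      j-inverse′ = T.trans (T.*-congʳ (T.sym (1-‿homo r))) (T.trans (T.sym (*-homo (A.1# A.- r) j))
        (T.trans (ι-cong j-inverse) 1#-homo))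

    𝒢-finite : (∀ n → d (suc n) A.≈ σ A.^ suc n A.* AΣ.∑ (permutations (suc n)) λ τ →
                 AC.ascentWeight x v τ A.* (r A.^ # (inverseAscents τ) A.* j A.^ suc n)) →
               d 0 A.≈ A.0# → σ A.* (A.1# A.- x) A.≈ A.1# → ι r T.≈ u →
               ∀ n → 𝒢 T x′ u v′ T.1# T.1# 1-x 1-u n T.≈ ι (d n)
    𝒢-finite d≈ d₀≈0 σ-inverse u≈ zero    = T.sym (T.trans (ι-cong d₀≈0) 0#-homo)
    𝒢-finite d≈ d₀≈0 σ-inverse u≈ (suc n) = TC.𝒢-unique x′ u v′ 1-x 1-u n (T.trans
      (T.*-cong (expansion-homo x′≈ v′≈ n (λ τ → # (inverseAscents τ)) (d≈ n))
        (T.*-congʳ (^-congˡ (suc n) (T.+-congˡ (T.-‿cong (T.sym u≈))))))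
      (T.trans (TC.finite-expansion {x′} {ι r} {ι σ} {ι j} n (TC.ascentWeight x′ v′)
        (T.trans (T.sym σ-homo) (T.trans (ι-cong σ-inverse) 1#-homo)) j-inverse′)
        (TΣ.∑-cong (λ τ → T.*-congʳ (^-congˡ (# (inverseAscents τ)) u≈)) (permutations (suc n)))))
      where open Algebra.Properties.Semiring.Exp T.semiring using (^-congˡ)

    -- The word sums live in A, where only r is available. The element u exists in T alone, as an
    -- inverse of ι r, so the comparison with 𝒢 is made after applying ι.
    𝒢-infinite : {g : ℕ → A.Carrier} →
                 (∀ n → d (suc n) A.≈ σ A.^ suc n A.* AΣ.∑ (permutations (suc n)) λ τ →
                   AC.ascentWeight x v τ A.* (r A.^ # (not ∘ inverseAscents τ) A.* j A.^ suc n)) →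
                 g 0 A.≈ A.0# → (∀ n → g n A.≈ r A.* d n) → σ A.* (A.1# A.- x) A.+ A.1# A.≈ A.0# → u T.* ι r T.≈ T.1# →
                 ∀ n → 𝒢 T x′ u v′ T.1# T.1# 1-x 1-u n T.≈ ι (g n)
    𝒢-infinite d≈ g₀≈0 g≈ σ-inverse u-inverse zero    = T.sym (T.trans (ι-cong g₀≈0) 0#-homo)
    𝒢-infinite d≈ g₀≈0 g≈ σ-inverse u-inverse (suc n) = TC.𝒢-unique x′ u v′ 1-x 1-u n (T.trans
      (T.*-congʳ (T.trans (ι-cong (g≈ (suc n))) (T.trans (*-homo r (d (suc n)))
        (T.*-congˡ (expansion-homo x′≈ v′≈ n (λ τ → # (not ∘ inverseAscents τ)) (d≈ n))))))
      (TC.infinite-expansion {x′} {u} {ι σ} {ι j} {ι r} n (TC.ascentWeight x′ v′)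
        (T.trans (T.+-cong (T.sym σ-homo) (T.sym 1#-homo))
          (T.trans (T.sym (+-homo _ A.1#)) (T.trans (ι-cong σ-inverse) 0#-homo)))
        j-inverse′ u-inverse))

module _ (R : CommutativeRing c ℓ) where
  open RingOps R hiding (zero)
  open Frac R using (ι; cross; fractions)

  ι-isRingHomomorphism : IsRingHomomorphism (CommutativeRing.rawRing R) (CommutativeRing.rawRing fractions) ι
  ι-isRingHomomorphism = record
    { isSemiringHomomorphism = record
      { isNearSemiringHomomorphism = record
        { +-isMonoidHomomorphism = record
          { isMagmaHomomorphism = record
            { isRelHomomorphism = record { cong = λ p → cross (*-congʳ p) }
            ; homo = λ a b → cross (trans (*-congˡ (*-identityʳ 1#))
                (*-congʳ (sym (+-cong (*-identityʳ a) (*-identityʳ b)))))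
            }
          ; ε-homo = cross refl
          }
        ; *-homo = λ a b → cross (*-congˡ (*-identityʳ 1#))
        }
      ; 1#-homo = cross refl
      }
    ; -‿homo = λ a → cross refl
    }

module _ (K : CommutativeRing c ℓ) (v₀ : CommutativeRing.Carrier K) where
  private
    module Sx = Series K
    R : CommutativeRing c ℓ
    R = Sx.powerSeries
    module R = RingOps R
    module S = RingOps (Series.powerSeries R)
    module Rhs = RightHandSides K v₀
  open Series R using (C; X)
  open ClosedForms K v₀ using (s; s₋; sy≈1; s₋y+1≈0; M̂≈firstSummand; M̂≈secondSummand)

  private
    C-1- : ∀ a → C (R.1# R.- a) S.≈ S.1# S.- C a
    C-1- a = S.sym {S.1# S.- C a} {C (R.1# R.- a)} (Series.1-C≈C R a)

    C-s : ∀ s → C s S.* (S.1# S.- C Sx.X) S.≈ C (s R.* (R.1# R.- Sx.X))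
    C-s s = S.trans {C s S.* (S.1# S.- C Sx.X)} {C s S.* C (R.1# R.- Sx.X)}
      (S.*-congˡ {C s} (S.sym {C (R.1# R.- Sx.X)} (C-1- Sx.X)))
      (S.sym {C (s R.* (R.1# R.- Sx.X))} (Hat.C-* R s s (R.1# R.- Sx.X)))

  module _ where
    open ExpansionAtZero K v₀
    open MaximumSeries R Sx.X (Sx.C v₀) s strictly (λ β → β) (λ _ _ → ≡.refl)

    private
      -- M̂ is a series in t for each m and `diagonal` a series in u for each n: the same double
      -- array, read along its other index.
      firstCoefficient : ∀ n m → Rhs.firstSeries m n R.≈ diagonal n m
      firstCoefficient n m = R.sym {diagonal n m} (≡.subst (λ i → diagonal n m R.≈ Rhs.firstSummand (suc i) n)
        (Fin.toℕ-fromℕ m) (M̂≈firstSummand (suc m) (fromℕ m) n))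

    firstFormula : 𝒢 K⟦x⟧⟦u⟧ x u v 1# 1# unit-1-x unit-1-u ≈ₛ swap Rhs.firstSeries
    firstFormula n = S.trans {𝒢 K⟦x⟧⟦u⟧ x u v 1# 1# unit-1-x unit-1-u n} {diagonal n}
      (Transport.𝒢-finite (Series.powerSeries R) K⟦x⟧⟦u⟧ (λ f → f) identity
        {C Sx.X} {C (Sx.C v₀)} {X} {C s} {ChainCount.J R} {diagonal} {x} {u} {v} unit-1-x unit-1-u
        (S.refl {x}) (S.refl {v}) (ChainCount.J-inverse R) diagonal≈ (λ _ → R.refl {R.0#})
        (S.trans {C s S.* (S.1# S.- C Sx.X)} (C-s s) (Hat.C-cong R s sy≈1)) (S.refl {u}) n)
      λ m → R.sym {Rhs.firstSeries m n} (firstCoefficient n m)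
      where
      identity : IsRingHomomorphism (CommutativeRing.rawRing (Series.powerSeries R)) (CommutativeRing.rawRing K⟦x⟧⟦u⟧) (λ f → f)
      identity = isRingHomomorphism (CommutativeRing.rawRing (Series.powerSeries R)) λ {f} → S.refl {f}

  module _ where
    open ExpansionAtInfinity K v₀
    open MaximumSeries R Sx.X (Sx.C v₀) s₋ weakly not (λ _ _ → ≡.refl)
    private
      module F = RingOps Frac-K⟦x⟧⟦w⟧

      secondCoefficient : ∀ n m → Rhs.secondSeries (suc m) n R.≈ diagonal n m
      secondCoefficient n m = R.sym {diagonal n m} (≡.subst (λ i → diagonal n m R.≈ Rhs.secondSummand (suc i) n)
        (Fin.toℕ-fromℕ m) (M̂≈secondSummand (suc m) (fromℕ m) n))

      -- The factor X is the r in front of `infinite-expansion`: words with largest letter m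
      -- contribute to the power m + 1 of w = u⁻¹, and the power 0 receives nothing.
      shifted : ∀ n → swap Rhs.secondSeries n S.≈ X S.* diagonal n
      shifted n zero    = R.sym {(X S.* diagonal n) 0} (R.trans {(X S.* diagonal n) 0} (Series.*ₛ-head R X (diagonal n)) (R.zeroˡ (diagonal n 0)))
      shifted n (suc m) = R.trans {Rhs.secondSeries (suc m) n} {diagonal n m} (secondCoefficient n m)
        (R.sym {(X S.* diagonal n) (suc m)} (Series.X-*ₛ R (diagonal n) m))

      σ-inverse : C s₋ S.* (S.1# S.- C Sx.X) S.+ S.1# S.≈ S.0#
      σ-inverse = S.trans {C s₋ S.* (S.1# S.- C Sx.X) S.+ S.1#} {C s₋y S.+ S.1#} (S.+-congʳ {S.1#} (C-s s₋))
        (S.trans {C s₋y S.+ S.1#} {C (s₋y R.+ R.1#)} (S.sym {C (s₋y R.+ R.1#)} (Hat.C-+ R s s₋y R.1#))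
          (S.trans {C (s₋y R.+ R.1#)} {C R.0#} (Hat.C-cong R s s₋y+1≈0) (Hat.C-0 R s)))
        where
        s₋y : R.Carrier
        s₋y = s₋ R.* (R.1# R.- Sx.X)

      u-inverse : u F.* ι X F.≈ F.1#
      u-inverse = Frac.cross (S.trans {S.1# S.* X S.* S.1#} (S.*-assoc S.1# X S.1#) (S.refl {S.1# S.* (X S.* S.1#)}))

    secondFormula : 𝒢 Frac-K⟦x⟧⟦w⟧ x u v 1# 1# unit-1-x unit-1-u ≈ₛ ι ∘ swap Rhs.secondSeries
    secondFormula = Transport.𝒢-infinite (Series.powerSeries R) Frac-K⟦x⟧⟦w⟧ ι (ι-isRingHomomorphism (Series.powerSeries R))
      {C Sx.X} {C (Sx.C v₀)} {X} {C s₋} {ChainCount.J R} {diagonal} {x} {u} {v} unit-1-x unit-1-u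
      F.refl F.refl (ChainCount.J-inverse R)
      {swap Rhs.secondSeries} diagonal≈
      -- The constant term in t of each summand agrees with that of M̂, which is 0 because `hat`
      -- begins with 0.
      (λ { zero → R.refl {R.0#} ; (suc m) → secondCoefficient 0 m }) shifted σ-inverse u-inverse

theorem2 : (let open AtZero in
    𝒢 ℚ[v]⟦x⟧⟦u⟧ x u v 1# 1# unit-1-x unit-1-u ≈ₛ swap Summands.firstSeries)
    ×
    (let open AtInfinity in
    𝒢 Frac-ℚ[v]⟦x⟧⟦w⟧ x u v 1# 1# unit-1-x unit-1-u ≈ₛ ι ∘ swap Summands.secondSeries)
    ×
    (let open Rational in
    (𝒢 ℚ⟨x,u⟩[v] x u v 1# 1# unit-1-x unit-1-u ≈ₛ 𝒢 ℚ⟨x,u⟩[v] u x 1# v 1# unit-1-u unit-1-x)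
    × (𝒢 ℚ⟨x,u⟩[v] u x 1# v 1# unit-1-u unit-1-x ≈ₛ 𝒢 ℚ⟨x,u⟩[v] x u 1# v 1# unit-1-x unit-1-u)
    × (𝒢 ℚ⟨x,u⟩[v] x u 1# v 1# unit-1-x unit-1-u ≈ₛ 𝒢 ℚ⟨x,u⟩[v] u x v 1# 1# unit-1-u unit-1-x))
theorem2 = firstFormula ℚ[v] (Poly.X ℚ-ring) , secondFormula ℚ[v] (Poly.X ℚ-ring) , symmetries
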